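{- For every integer $r\geq2$, $$W_r(n)\sim\frac{A_r}{n^r},\qquad n\to\infty,\qquad\text{where } A_r:=\sum_{m=0}^\infty W_r(m).$$
   Context: The cycle structure of a permutation of $n$ letters is the partition $\lambda=(\lambda_1,\dots,\lambda_n)$ of $n$ (nonnegative integers with $\sum_j j\lambda_j=n$) where $\lambda_j$ is the number of cycles of length $j$. $W_r(n)$ is the probability that $r$ uniformly random independent permutations of $n$ letters have the same cycle structure, for $n\geq1$; $W_r(0):=1$. -}

module Defs where

open import Data.Nat as ℕ using (ℕ; zero; suc; _!; _^_; _≡ᵇ_; NonZero)
open import Data.Nat.Properties using (_!≢0; m^n≢0)
open import Data.Nat.DivMod using (_/_)
open import Data.Bool using (Bool; true; false; _∧_; if_then_else_)
open import Data.Fin using (Fin)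
open import Data.Fin.Properties using () renaming (_≟_ to _≟F_)
open import Data.List using (List; []; _∷_; [_]; map; concatMap; filter; length; upTo; allFin; foldr)
open import Data.Vec using (Vec; []; _∷_; lookup)
open import Data.Integer using (+_)
open import Data.Rational as ℚ using (ℚ; 1ℚ; 0ℚ)
open import Relation.Nullary.Decidable using (⌊_⌋)

-- A permutation of the n letters Fin n is represented by its table of values
-- (a vector v with σ(i) = lookup v i) that is injective (hence bijective).

allB : ∀ {a} {A : Set a} → (A → Bool) → List A → Bool
allB p = foldr (λ x b → p x ∧ b) true

allVecs : (n k : ℕ) → List (Vec (Fin n) k)
allVecs n zero    = [ [] ]
allVecs n (suc k) = concatMap (λ x → map (x ∷_) (allVecs n k)) (allFin n)

_==F_ : ∀ {n} → Fin n → Fin n → Bool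
i ==F j = ⌊ i ≟F j ⌋

isPerm : ∀ {n} → Vec (Fin n) n → Bool
isPerm {n} v = allB (λ i → allB (λ j → if lookup v i ==F lookup v j then i ==F j else true) (allFin n)) (allFin n)

perms : (n : ℕ) → List (Vec (Fin n) n)
perms n = filter (λ v → isPerm v Data.Bool.≟ true) (allVecs n n)

iter : ∀ {n} → Vec (Fin n) n → ℕ → Fin n → Fin n
iter v zero    i = i
iter v (suc k) i = lookup v (iter v k i)

cycleLen : ∀ {n} → Vec (Fin n) n → Fin n → ℕ
cycleLen {n} v i = go (Data.List.map suc (upTo n))
  where
  go : List ℕ → ℕ
  go []       = 0
  go (k ∷ ks) = if iter v k i ==F i then k else go ks

-- cycle structure (λ_1, …, λ_n): λ_j = number of cycles of length j
--   = (number of letters lying in a cycle of length j) / j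
cycleType : ∀ {n} → Vec (Fin n) n → List ℕ
cycleType {n} v =
  Data.List.map (λ j → length (filter (λ i → cycleLen v i ℕ.≟ suc j) (allFin n)) / suc j) (upTo n)

_==L_ : List ℕ → List ℕ → Bool
[]       ==L []       = true
(x ∷ xs) ==L (y ∷ ys) = (x ≡ᵇ y) ∧ (xs ==L ys)
_        ==L _        = false

tuples : (n r : ℕ) → List (List (Vec (Fin n) n))
tuples n zero    = [ [] ]
tuples n (suc r) = concatMap (λ σ → map (σ ∷_) (tuples n r)) (perms n)

sameType : ∀ {n} → List (Vec (Fin n) n) → Bool
sameType []       = true
sameType (σ ∷ τs) = allB (λ τ → cycleType σ ==L cycleType τ) τs

-- W_r(n): probability that r independent uniform permutations of n letters
-- have the same cycle structure = #{good r-tuples} / (n!)^r ;  W_r(0) := 1.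
W : ℕ → ℕ → ℚ
W r zero      = 1ℚ
W r n@(suc _) =
  ((+ length (filter (λ t → sameType t Data.Bool.≟ true) (tuples n r))) ℚ./ ((n !) ^ r))
    {{m^n≢0 (n !) r {{n !≢0}}}}

partialSum : ℕ → ℕ → ℚ
partialSum r zero    = 0ℚ
partialSum r (suc M) = partialSum r M ℚ.+ W r M

{-# OPTIONS --safe #-}
-- Write p(v) = 1/z_v for the probability of the cycle type v, so that W_r(n) = Σ_{v ⊢ n} p(v)^r.
-- Removing a part of size k gives k vₖ p(v) = p(v - eₖ); summing over k, n p(v) = Σ_k p(v - eₖ).
-- Hence n^r W_r(n) = Σ_v (Σ_k p(v - eₖ))^r, whose diagonal part Σ_v Σ_k p(v - eₖ)^r is exactly
-- Σ_{m<n} W_r(m).  The cross terms are bounded by a multiple of those for r = 2, and removing two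
-- distinct parts k, l bounds the latter by E(n) = Σ_{k+l+m=n} W_2(m) / (k l).  Since
-- Σ_{k+l=s} 1/(k l) is at most 1 and tends to 0, first n² W_2(n) ≤ 2 Σ_{m<n} W_2(m), which makes
-- Σ W_2 converge, and then E(n) → 0.
-- The formula for p(v) comes from building the permutations of n + 1 letters out of those of n letters
-- by inserting one letter into a cycle, combined with the same removal identity.
module Submission where

open import Defs
open import Algebra using (module CommutativeRing)
open import Data.Bool as Bool using (Bool; true; false; if_then_else_)
open import Data.Fin as Fin using (Fin; zero; suc; toℕ)
import Data.Fin.Properties as Finₚ
open import Data.Integer as ℤ using (+_)
import Data.Integer.Properties as ℤₚ
open import Data.List using (List; []; _∷_; [_]; map; _++_; concatMap; filter; length; allFin; tabulate; upTo; applyUpTo; cartesianProductWith)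
import Data.List.Properties as Listₚ
open import Data.List.Membership.DecPropositional using () renaming (_∈?_ to member?)
open import Data.List.Membership.Propositional using (_∈_)
import Data.List.Membership.Propositional.Properties as ∈ₚ
open import Data.List.Membership.Propositional.Properties.WithK using (unique∧set⇒bag)
open import Data.List.Relation.Binary.BagAndSetEquality using (_∼[_]_; set; ∼bag⇒↭)
open import Data.List.Relation.Binary.Permutation.Propositional as Perm using (_↭_)
open import Data.List.Relation.Unary.All using ([])
open import Data.List.Relation.Unary.AllPairs using ([]; _∷_)
open import Data.List.Relation.Unary.Any using (here; there)
open import Data.List.Relation.Unary.Unique.Propositional using (Unique)
import Data.List.Relation.Unary.Unique.Propositional.Properties as Uniqueₚ
open import Data.Nat as ℕ using (ℕ; zero; suc; _≤_; _^_)
import Data.Nat.DivMod as DivMod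
open import Data.Nat.Divisibility as ∣ using (_∣_)
import Data.Nat.Properties as ℕₚ
open import Data.Product using (_×_; _,_; proj₁; proj₂; ∃-syntax)
open import Data.Rational as ℚ using (ℚ; Positive; 0ℚ; 1ℚ; _+_; _<_; _-_; _*_; ∣_∣; _/_)
import Data.Rational.Properties as ℚₚ
open import Data.Rational.Solver using (module +-*-Solver)
import Data.Rational.Unnormalised as ℚᵘ
import Data.Rational.Unnormalised.Properties as ℚᵘₚ
open import Data.Sum using (inj₁; inj₂)
open import Data.Vec as Vec using (Vec; []; _∷_; lookup; updateAt)
import Data.Vec.Properties as Vecₚ
open import Function using (_∘_; id; mk⇔)
open import Relation.Binary using (DecidableEquality)
open import Relation.Binary.PropositionalEquality using (_≡_; _≢_; refl; sym; trans; cong; cong₂; subst; module ≡-Reasoning)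
open import Relation.Nullary using (¬_; Dec; yes; no; contradiction)
open import Relation.Unary using (Decidable)

open import Algebra.Properties.CommutativeSemiring.Exp (CommutativeRing.commutativeSemiring ℚₚ.+-*-commutativeRing) as Exp using () renaming (_^_ to _^ℚ_)
open +-*-Solver using (solve; _:+_; _:*_; _:-_; :-_; _:=_; con)

-- For r > 2 the comparison of cross terms with those for r = 2 needs a uniform bound on n p(v). The
-- one used, n p(v) ≤ 29, comes from n² W_2(n) ≤ 28, hence from the boundedness of Σ W_2. For r = 2
-- the expansion of the square is an exact identity and asks for no such bound, so there is no
-- circle. With S(n) the sum of W_2(m) over m < n, n² W_2(n) ≤ 2 S(n) says S(n+1) ≤ (1 + 2/n²) S(n).
-- The product of these factors converges; the invariant n S(n) ≤ 14 (n - 2), n ≥ 3, makes this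
-- explicit. All estimates stay rational: harmonic sums are bounded without logarithms, n p(v)
-- without square roots, and late partial sums stand in for A_r. The formula for p(v) is proved in
-- the form Σ_σ G(type σ) = n! Σ_v p(v) G(v) for every function G. Going from n to n + 1 letters
-- replaces G by its sum over all insertions of a letter, which is no longer an indicator, so the
-- induction has to range over all G.

private variable
  A B C : Set
  m n N : ℕ
  p₀ q₀ r₀ s₀ : ℚ

-- Rational arithmetic and finite sums

*-monoʳ : 0ℚ ℚ.≤ r₀ → p₀ ℚ.≤ q₀ → r₀ * p₀ ℚ.≤ r₀ * q₀
*-monoʳ {r₀} 0≤r = ℚₚ.*-monoˡ-≤-nonNeg r₀ {{ℚ.nonNegative 0≤r}}

*-monoˡ : 0ℚ ℚ.≤ r₀ → p₀ ℚ.≤ q₀ → p₀ * r₀ ℚ.≤ q₀ * r₀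
*-monoˡ {r₀} 0≤r = ℚₚ.*-monoʳ-≤-nonNeg r₀ {{ℚ.nonNegative 0≤r}}

*-mono : 0ℚ ℚ.≤ p₀ → 0ℚ ℚ.≤ s₀ → p₀ ℚ.≤ q₀ → r₀ ℚ.≤ s₀ → p₀ * r₀ ℚ.≤ q₀ * s₀
*-mono 0≤p 0≤s p≤q r≤s = ℚₚ.≤-trans (*-monoʳ 0≤p r≤s) (*-monoˡ 0≤s p≤q)

0≤* : 0ℚ ℚ.≤ p₀ → 0ℚ ℚ.≤ q₀ → 0ℚ ℚ.≤ p₀ * q₀
0≤* {p₀} {q₀} 0≤p 0≤q = subst (ℚ._≤ p₀ * q₀) (ℚₚ.*-zeroʳ p₀) (*-monoʳ 0≤p 0≤q)

0≤+ : 0ℚ ℚ.≤ p₀ → 0ℚ ℚ.≤ q₀ → 0ℚ ℚ.≤ p₀ + q₀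
0≤+ 0≤p 0≤q = ℚₚ.+-mono-≤ 0≤p 0≤q

0≤1 : 0ℚ ℚ.≤ 1ℚ
0≤1 = ℚₚ.nonNegative⁻¹ 1ℚ

p≤p+q : 0ℚ ℚ.≤ q₀ → p₀ ℚ.≤ p₀ + q₀
p≤p+q {q₀} {p₀} 0≤q = subst (ℚ._≤ p₀ + q₀) (ℚₚ.+-identityʳ p₀) (ℚₚ.+-monoʳ-≤ p₀ 0≤q)

≤-by : 0ℚ ℚ.≤ r₀ → p₀ + r₀ ≡ q₀ → p₀ ℚ.≤ q₀
≤-by {r₀} {p₀} 0≤r refl = p≤p+q 0≤r

+-congˡ : ∀ p₀ → q₀ ≡ r₀ → p₀ + q₀ ≡ p₀ + r₀
+-congˡ p₀ = cong (p₀ ℚ.+_)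

+-congʳ : ∀ p₀ → q₀ ≡ r₀ → q₀ + p₀ ≡ r₀ + p₀
+-congʳ p₀ = cong (ℚ._+ p₀)

*-congˡ : ∀ p₀ → q₀ ≡ r₀ → p₀ * q₀ ≡ p₀ * r₀
*-congˡ p₀ = cong (p₀ ℚ.*_)

*-congʳ : ∀ p₀ → q₀ ≡ r₀ → q₀ * p₀ ≡ r₀ * p₀
*-congʳ p₀ = cong (ℚ._* p₀)

0≤^ : ∀ n → 0ℚ ℚ.≤ p₀ → 0ℚ ℚ.≤ p₀ ^ℚ n
0≤^ zero    0≤p = 0≤1
0≤^ (suc n) 0≤p = 0≤* 0≤p (0≤^ n 0≤p)

^-mono : ∀ n → 0ℚ ℚ.≤ p₀ → p₀ ℚ.≤ q₀ → p₀ ^ℚ n ℚ.≤ q₀ ^ℚ n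
^-mono zero    0≤p p≤q = ℚₚ.≤-refl
^-mono (suc n) 0≤p p≤q = *-mono 0≤p (0≤^ n (ℚₚ.≤-trans 0≤p p≤q)) p≤q (^-mono n 0≤p p≤q)

opaque
  -- Opaque, so that large arguments such as factorials are handled by the laws below and not by
  -- reduction of fractions.
  ι : ℕ → ℚ
  ι n = + n / 1

  fromᵘ : ∀ n → ι n ≡ ℚ.fromℚᵘ (ℚᵘ.mkℚᵘ (+ n) 0)
  fromᵘ zero    = refl
  fromᵘ (suc n) = refl

  toᵘ : ∀ n → ℚ.toℚᵘ (ι n) ℚᵘ.≃ ℚᵘ.mkℚᵘ (+ n) 0
  toᵘ n = ℚᵘₚ.≃-trans (ℚᵘₚ.≃-reflexive (cong ℚ.toℚᵘ (fromᵘ n))) (ℚₚ.toℚᵘ-fromℚᵘ _)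

  ι-+ : ∀ m n → ι (m ℕ.+ n) ≡ ι m + ι n
  ι-+ m n = ℚₚ.toℚᵘ-injective (begin
    ℚ.toℚᵘ (ι (m ℕ.+ n))                ≈⟨ toᵘ (m ℕ.+ n) ⟩
    ℚᵘ.mkℚᵘ (+ (m ℕ.+ n)) 0             ≈⟨ ℚᵘ.*≡* (cong (ℤ._* + 1) (trans (ℤₚ.pos-+ m n) (sym (cong₂ ℤ._+_ (ℤₚ.*-identityʳ (+ m)) (ℤₚ.*-identityʳ (+ n)))))) ⟩
    ℚᵘ.mkℚᵘ (+ m) 0 ℚᵘ.+ ℚᵘ.mkℚᵘ (+ n) 0 ≈⟨ ℚᵘₚ.+-cong (toᵘ m) (toᵘ n) ⟨
    ℚ.toℚᵘ (ι m) ℚᵘ.+ ℚ.toℚᵘ (ι n)      ≈⟨ ℚₚ.toℚᵘ-homo-+ (ι m) (ι n) ⟨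
    ℚ.toℚᵘ (ι m + ι n)                  ∎)
    where open ℚᵘₚ.≃-Reasoning

  ι-* : ∀ m n → ι (m ℕ.* n) ≡ ι m * ι n
  ι-* m n = ℚₚ.toℚᵘ-injective (begin
    ℚ.toℚᵘ (ι (m ℕ.* n))                ≈⟨ toᵘ (m ℕ.* n) ⟩
    ℚᵘ.mkℚᵘ (+ (m ℕ.* n)) 0             ≈⟨ ℚᵘ.*≡* (cong (ℤ._* + 1) (ℤₚ.pos-* m n)) ⟩
    ℚᵘ.mkℚᵘ (+ m) 0 ℚᵘ.* ℚᵘ.mkℚᵘ (+ n) 0 ≈⟨ ℚᵘₚ.*-cong (toᵘ m) (toᵘ n) ⟨
    ℚ.toℚᵘ (ι m) ℚᵘ.* ℚ.toℚᵘ (ι n)      ≈⟨ ℚₚ.toℚᵘ-homo-* (ι m) (ι n) ⟨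
    ℚ.toℚᵘ (ι m * ι n)                  ∎)
    where open ℚᵘₚ.≃-Reasoning

  0≤ι : ∀ n → 0ℚ ℚ.≤ ι n
  0≤ι n = ℚₚ.nonNegative⁻¹ (ι n) {{ℚₚ.normalize-nonNeg n 1}}

  ι-pos : ∀ n → ℚ.Positive (ι (suc n))
  ι-pos n = ℚₚ.normalize-pos (suc n) 1

  ι-injective : ∀ {m n} → ι m ≡ ι n → m ≡ n
  ι-injective {m} {n} eq = ℤₚ.+-injective (ℤₚ.*-cancelʳ-≡ (+ m) (+ n) (+ 1) (ℚᵘₚ.drop-*≡*
    (ℚᵘₚ.≃-trans (ℚᵘₚ.≃-sym (toᵘ m)) (ℚᵘₚ.≃-trans (ℚᵘₚ.≃-reflexive (cong ℚ.toℚᵘ eq)) (toᵘ n)))))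

  ι-*-/ : ∀ a d .{{_ : ℕ.NonZero d}} → ι d * (+ a / d) ≡ ι a
  ι-*-/ a d@(suc d-1) = ℚₚ.toℚᵘ-injective (begin
    ℚ.toℚᵘ (ι d * (+ a / d))                ≈⟨ ℚₚ.toℚᵘ-homo-* (ι d) (+ a / d) ⟩
    ℚ.toℚᵘ (ι d) ℚᵘ.* ℚ.toℚᵘ (+ a / d)      ≈⟨ ℚᵘₚ.*-cong (toᵘ d) (ℚₚ.toℚᵘ-fromℚᵘ (ℚᵘ.mkℚᵘ (+ a) d-1)) ⟩
    ℚᵘ.mkℚᵘ (+ d) 0 ℚᵘ.* ℚᵘ.mkℚᵘ (+ a) d-1  ≈⟨ ℚᵘ.*≡* (trans (ℤₚ.*-identityʳ _) (trans (ℤₚ.*-comm (+ d) (+ a)) (cong (λ e → + a ℤ.* + e) (sym (ℕₚ.+-identityʳ d))))) ⟩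
    ℚᵘ.mkℚᵘ (+ a) 0                         ≈⟨ toᵘ a ⟨
    ℚ.toℚᵘ (ι a)                            ∎)
    where open ℚᵘₚ.≃-Reasoning

  -- 1 / (n + 1): the shift keeps the denominator positive and fits the index `toℕ k` of a part of
  -- size `toℕ k + 1`.
  recip : ℕ → ℚ
  recip n = + 1 / suc n

  recip-inverse : ∀ n → ι (suc n) * recip n ≡ 1ℚ
  recip-inverse n = ι-*-/ 1 (suc n)

  0≤recip : ∀ n → 0ℚ ℚ.≤ recip n
  0≤recip n = ℚₚ.nonNegative⁻¹ (recip n) {{ℚₚ.normalize-nonNeg 1 (suc n)}}

  ι≡/ : ∀ n → ι n ≡ + n / 1
  ι≡/ n = refl

  recip-0 : recip 0 ≡ 1ℚ
  recip-0 = refl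

  ι-0 : ι 0 ≡ 0ℚ
  ι-0 = refl

  ι-1 : ι 1 ≡ 1ℚ
  ι-1 = refl

ι-^ : ∀ m n → ι (m ^ n) ≡ ι m ^ℚ n
ι-^ m zero    = ι-1
ι-^ m (suc n) = trans (ι-* m (m ^ n)) (cong (ι m *_) (ι-^ m n))

ι-suc : ∀ n → ι (suc n) ≡ 1ℚ + ι n
ι-suc n = trans (ι-+ 1 n) (+-congʳ (ι n) ι-1)

ι-mono : ∀ {m n} → m ≤ n → ι m ℚ.≤ ι n
ι-mono {m} {n} m≤n = ≤-by (0≤ι (n ℕ.∸ m)) (trans (sym (ι-+ m (n ℕ.∸ m))) (cong ι (ℕₚ.m+[n∸m]≡n m≤n)))

*-cancelˡ-suc : ∀ n → ι (suc n) * p₀ ≡ ι (suc n) * q₀ → p₀ ≡ q₀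
*-cancelˡ-suc n eq = ℚₚ.≤-antisym
  (ℚₚ.*-cancelˡ-≤-pos (ι (suc n)) {{ι-pos n}} (ℚₚ.≤-reflexive eq))
  (ℚₚ.*-cancelˡ-≤-pos (ι (suc n)) {{ι-pos n}} (ℚₚ.≤-reflexive (sym eq)))

≤-recip : ∀ n → ι (suc n) * p₀ ℚ.≤ q₀ → p₀ ℚ.≤ recip n * q₀
≤-recip {p₀} {q₀} n h = begin
  p₀                            ≡⟨ ℚₚ.*-identityˡ p₀ ⟨
  1ℚ * p₀                       ≡⟨ cong (_* p₀) (trans (sym (recip-inverse n)) (ℚₚ.*-comm (ι (suc n)) (recip n))) ⟩
  recip n * ι (suc n) * p₀      ≡⟨ ℚₚ.*-assoc (recip n) _ p₀ ⟩
  recip n * (ι (suc n) * p₀)    ≤⟨ *-monoʳ (0≤recip n) h ⟩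
  recip n * q₀                  ∎
  where open ℚₚ.≤-Reasoning

recip-antimono : ∀ {m n} → m ≤ n → recip n ℚ.≤ recip m
recip-antimono {m} {n} m≤n = subst (recip n ℚ.≤_) (ℚₚ.*-identityʳ (recip m)) (≤-recip m (begin
  ι (suc m) * recip n ≤⟨ *-monoˡ (0≤recip n) (ι-mono (ℕ.s≤s m≤n)) ⟩
  ι (suc n) * recip n ≡⟨ recip-inverse n ⟩
  1ℚ                  ∎))
  where open ℚₚ.≤-Reasoning

recip≤1 : ∀ n → recip n ℚ.≤ 1ℚ
recip≤1 n = subst (recip n ℚ.≤_) recip-0 (recip-antimono {0} {n} ℕ.z≤n)

∑ : List A → (A → ℚ) → ℚ
∑ []       f = 0ℚ
∑ (x ∷ xs) f = f x + ∑ xs f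

∑-cong∈ : ∀ (xs : List A) {f g : A → ℚ} → (∀ {x} → x ∈ xs → f x ≡ g x) → ∑ xs f ≡ ∑ xs g
∑-cong∈ []       eq = refl
∑-cong∈ (x ∷ xs) eq = cong₂ _+_ (eq (here refl)) (∑-cong∈ xs (eq ∘ there))

∑-cong : ∀ (xs : List A) {f g : A → ℚ} → (∀ x → f x ≡ g x) → ∑ xs f ≡ ∑ xs g
∑-cong xs eq = ∑-cong∈ xs (λ {x} _ → eq x)

∑-mono∈ : ∀ (xs : List A) {f g : A → ℚ} → (∀ {x} → x ∈ xs → f x ℚ.≤ g x) → ∑ xs f ℚ.≤ ∑ xs g
∑-mono∈ []       le = ℚₚ.≤-refl
∑-mono∈ (x ∷ xs) le = ℚₚ.+-mono-≤ (le (here refl)) (∑-mono∈ xs (le ∘ there))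

∑-mono : ∀ (xs : List A) {f g : A → ℚ} → (∀ x → f x ℚ.≤ g x) → ∑ xs f ℚ.≤ ∑ xs g
∑-mono xs le = ∑-mono∈ xs (λ {x} _ → le x)

∑-zero : ∀ (xs : List A) → ∑ xs (λ _ → 0ℚ) ≡ 0ℚ
∑-zero []       = refl
∑-zero (x ∷ xs) = trans (ℚₚ.+-identityˡ _) (∑-zero xs)

0≤∑ : ∀ (xs : List A) {f : A → ℚ} → (∀ x → 0ℚ ℚ.≤ f x) → 0ℚ ℚ.≤ ∑ xs f
0≤∑ xs {f} 0≤f = subst (ℚ._≤ ∑ xs f) (∑-zero xs) (∑-mono xs 0≤f)

∑-+ : ∀ (xs : List A) (f g : A → ℚ) → ∑ xs (λ x → f x + g x) ≡ ∑ xs f + ∑ xs g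
∑-+ []       f g = refl
∑-+ (x ∷ xs) f g = trans (+-congˡ (f x + g x) (∑-+ xs f g))
  (solve 4 (λ a b c d → (a :+ b) :+ (c :+ d) := (a :+ c) :+ (b :+ d)) refl (f x) (g x) (∑ xs f) (∑ xs g))

∑-*ˡ : ∀ (xs : List A) c (f : A → ℚ) → ∑ xs (λ x → c * f x) ≡ c * ∑ xs f
∑-*ˡ []       c f = sym (ℚₚ.*-zeroʳ c)
∑-*ˡ (x ∷ xs) c f = trans (+-congˡ (c * f x) (∑-*ˡ xs c f)) (sym (ℚₚ.*-distribˡ-+ c (f x) (∑ xs f)))

∑-*ʳ : ∀ (xs : List A) c (f : A → ℚ) → ∑ xs (λ x → f x * c) ≡ ∑ xs f * c
∑-*ʳ xs c f = trans (∑-cong xs (λ x → ℚₚ.*-comm (f x) c)) (trans (∑-*ˡ xs c f) (ℚₚ.*-comm c (∑ xs f)))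

∑-swap : ∀ (xs : List A) (ys : List B) (f : A → B → ℚ) →
         ∑ xs (λ x → ∑ ys (f x)) ≡ ∑ ys (λ y → ∑ xs (λ x → f x y))
∑-swap []       ys f = sym (∑-zero ys)
∑-swap (x ∷ xs) ys f = trans (+-congˡ (∑ ys (f x)) (∑-swap xs ys f)) (sym (∑-+ ys (f x) (λ y → ∑ xs (λ x′ → f x′ y))))

∑-map : ∀ (g : A → B) xs (f : B → ℚ) → ∑ (map g xs) f ≡ ∑ xs (f ∘ g)
∑-map g []       f = refl
∑-map g (x ∷ xs) f = +-congˡ (f (g x)) (∑-map g xs f)

∑-++ : ∀ (xs ys : List A) (f : A → ℚ) → ∑ (xs ++ ys) f ≡ ∑ xs f + ∑ ys f
∑-++ []       ys f = sym (ℚₚ.+-identityˡ _)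
∑-++ (x ∷ xs) ys f = trans (+-congˡ (f x) (∑-++ xs ys f)) (sym (ℚₚ.+-assoc (f x) (∑ xs f) (∑ ys f)))

∑-concatMap : ∀ (g : A → List B) xs (f : B → ℚ) → ∑ (concatMap g xs) f ≡ ∑ xs (λ x → ∑ (g x) f)
∑-concatMap g []       f = refl
∑-concatMap g (x ∷ xs) f = trans (∑-++ (g x) (concatMap g xs) f) (+-congˡ (∑ (g x) f) (∑-concatMap g xs f))

∑-↭ : ∀ {xs ys : List A} → xs ↭ ys → (f : A → ℚ) → ∑ xs f ≡ ∑ ys f
∑-↭ Perm.refl         f = refl
∑-↭ (Perm.prep x ρ)   f = +-congˡ (f x) (∑-↭ ρ f)
∑-↭ {ys = _ ∷ _ ∷ ys} (Perm.swap x y ρ) f = trans (cong (λ t → f x + (f y + t)) (∑-↭ ρ f))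
  (solve 3 (λ a b c → a :+ (b :+ c) := b :+ (a :+ c)) refl (f x) (f y) (∑ ys f))
∑-↭ (Perm.trans ρ σ)  f = trans (∑-↭ ρ f) (∑-↭ σ f)

∑-filter : ∀ {P : A → Set} (P? : Decidable P) xs (f : A → ℚ) →
           (∀ {x} → ¬ P x → f x ≡ 0ℚ) → ∑ (filter P? xs) f ≡ ∑ xs f
∑-filter P? []       f f≡0 = refl
∑-filter P? (x ∷ xs) f f≡0 with P? x
... | yes _  = +-congˡ (f x) (∑-filter P? xs f f≡0)
... | no ¬Px = trans (∑-filter P? xs f f≡0)
                 (sym (trans (cong (_+ ∑ xs f) (f≡0 ¬Px)) (ℚₚ.+-identityˡ _)))

∑-tabulate : ∀ {n} (g : Fin n → A) (f : A → ℚ) → ∑ (tabulate g) f ≡ ∑ (allFin n) (f ∘ g)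
∑-tabulate g f = trans (cong (λ xs → ∑ xs f) (sym (Listₚ.map-tabulate id g))) (∑-map g (allFin _) f)

∑-allFin-suc : ∀ n (f : Fin (suc n) → ℚ) → ∑ (allFin (suc n)) f ≡ f zero + ∑ (allFin n) (f ∘ suc)
∑-allFin-suc n f = +-congˡ (f zero) (∑-tabulate suc f)

term≤∑ : ∀ {xs : List A} {x} (f : A → ℚ) → (∀ y → 0ℚ ℚ.≤ f y) → x ∈ xs → f x ℚ.≤ ∑ xs f
term≤∑ {xs = _ ∷ xs} f 0≤f (here refl) = p≤p+q (0≤∑ xs 0≤f)
term≤∑ {xs = y ∷ xs} f 0≤f (there x∈)  = ℚₚ.≤-trans (term≤∑ f 0≤f x∈)
  (≤-by (0≤f y) (ℚₚ.+-comm (∑ xs f) (f y)))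

𝟙 : {P : Set} → Dec P → ℚ
𝟙 (yes _) = 1ℚ
𝟙 (no _)  = 0ℚ

𝟙-yes : {P : Set} (P? : Dec P) → P → 𝟙 P? ≡ 1ℚ
𝟙-yes (yes _) _  = refl
𝟙-yes (no ¬P) P₀ = contradiction P₀ ¬P

𝟙-no : {P : Set} (P? : Dec P) → ¬ P → 𝟙 P? ≡ 0ℚ
𝟙-no (no _)  _  = refl
𝟙-no (yes P₀) ¬P = contradiction P₀ ¬P

𝟙-⇔ : {P Q : Set} (P? : Dec P) (Q? : Dec Q) → (P → Q) → (Q → P) → 𝟙 P? ≡ 𝟙 Q?
𝟙-⇔ (yes P₀) Q? P⇒Q Q⇒P = sym (𝟙-yes Q? (P⇒Q P₀))
𝟙-⇔ (no ¬P)  Q? P⇒Q Q⇒P = sym (𝟙-no Q? (¬P ∘ Q⇒P))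

ι-length : ∀ (xs : List A) → ι (length xs) ≡ ∑ xs (λ _ → 1ℚ)
ι-length []       = ι-0
ι-length (x ∷ xs) = trans (ι-suc (length xs)) (+-congˡ 1ℚ (ι-length xs))

ι-length-filter : ∀ {P : A → Set} (P? : Decidable P) xs →
                  ι (length (filter P? xs)) ≡ ∑ xs (λ x → 𝟙 (P? x))
ι-length-filter P? []       = ι-0
ι-length-filter P? (x ∷ xs) with P? x
... | yes _ = trans (ι-suc (length (filter P? xs))) (+-congˡ 1ℚ (ι-length-filter P? xs))
... | no _  = trans (ι-length-filter P? xs) (sym (ℚₚ.+-identityˡ _))

-- Partitions

unique∧set⇒↭ : ∀ {xs ys : List A} → Unique xs → Unique ys → xs ∼[ set ] ys → xs ↭ ys
unique∧set⇒↭ u u′ eq = ∼bag⇒↭ (unique∧set⇒bag u u′ eq)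

-- Uniqueness of the entries leaves exactly one position where the indicator is 1.
∑-𝟙 : (_≟_ : DecidableEquality A) {xs : List A} {x : A} (f : A → ℚ) → Unique xs → x ∈ xs →
      ∑ xs (λ y → f y * 𝟙 (y ≟ x)) ≡ f x
∑-𝟙 _≟_ {_ ∷ xs} {x} f u (here refl) = begin
  f x * 𝟙 (x ≟ x) + ∑ xs (λ y → f y * 𝟙 (y ≟ x))
    ≡⟨ cong₂ ℚ._+_ (trans (*-congˡ (f x) (𝟙-yes (x ≟ x) refl)) (ℚₚ.*-identityʳ (f x)))
                   (∑-cong∈ xs (λ {y} y∈ → trans (*-congˡ (f y) (𝟙-no (y ≟ x) (λ { refl → Uniqueₚ.Unique[x∷xs]⇒x∉xs u y∈ }))) (ℚₚ.*-zeroʳ (f y)))) ⟩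
  f x + ∑ xs (λ _ → 0ℚ)   ≡⟨ +-congˡ (f x) (∑-zero xs) ⟩
  f x + 0ℚ                ≡⟨ ℚₚ.+-identityʳ (f x) ⟩
  f x                     ∎
  where open ≡-Reasoning
∑-𝟙 _≟_ {z ∷ xs} {x} f u@(_ ∷ u′) (there x∈) = begin
  f z * 𝟙 (z ≟ x) + ∑ xs (λ y → f y * 𝟙 (y ≟ x))
    ≡⟨ cong₂ ℚ._+_ (trans (*-congˡ (f z) (𝟙-no (z ≟ x) (λ { refl → Uniqueₚ.Unique[x∷xs]⇒x∉xs u x∈ }))) (ℚₚ.*-zeroʳ (f z)))
                   (∑-𝟙 _≟_ f u′ x∈) ⟩
  0ℚ + f x                ≡⟨ ℚₚ.+-identityˡ (f x) ⟩
  f x                     ∎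
  where open ≡-Reasoning

-- Insertion and removal of a part. As `ℕ.pred` fixes 0, `dec` is meaningful only where the part
-- occurs; the sums below weight all other vectors by 0.
inc dec : Fin N → Vec ℕ N → Vec ℕ N
inc k v = updateAt v k suc
dec k v = updateAt v k ℕ.pred

dec-inc : ∀ (k : Fin N) v → dec k (inc k v) ≡ v
dec-inc zero    (x ∷ v) = refl
dec-inc (suc k) (x ∷ v) = cong (x ∷_) (dec-inc k v)

inc-dec : ∀ (k : Fin N) v → 1 ≤ lookup v k → inc k (dec k v) ≡ v
inc-dec zero    (suc x ∷ v) _  = refl
inc-dec (suc k) (x ∷ v)     le = cong (x ∷_) (inc-dec k v le)

inc-injective : ∀ (k : Fin N) {v w} → inc k v ≡ inc k w → v ≡ w
inc-injective k {v} {w} eq = trans (sym (dec-inc k v)) (trans (cong (dec k) eq) (dec-inc k w))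

-- A vector (v₀, v₁, …) stands for the partition with vⱼ parts of size d + j + 1.
weight : ℕ → Vec ℕ N → ℕ
weight d []      = 0
weight d (x ∷ v) = suc d ℕ.* x ℕ.+ weight (suc d) v

weight-inc : ∀ d (k : Fin N) v → weight d (inc k v) ≡ suc (d ℕ.+ toℕ k) ℕ.+ weight d v
weight-inc d zero    (x ∷ v) = begin
  suc d ℕ.* suc x ℕ.+ w         ≡⟨ cong (ℕ._+ w) (ℕₚ.*-suc (suc d) x) ⟩
  suc d ℕ.+ suc d ℕ.* x ℕ.+ w   ≡⟨ ℕₚ.+-assoc (suc d) (suc d ℕ.* x) w ⟩
  suc d ℕ.+ (suc d ℕ.* x ℕ.+ w) ≡⟨ cong (λ e → suc e ℕ.+ (suc d ℕ.* x ℕ.+ w)) (sym (ℕₚ.+-identityʳ d)) ⟩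
  suc (d ℕ.+ 0) ℕ.+ (suc d ℕ.* x ℕ.+ w) ∎
  where open ≡-Reasoning
        w = weight (suc d) v
weight-inc d (suc k) (x ∷ v) = begin
  suc d ℕ.* x ℕ.+ weight (suc d) (inc k v)  ≡⟨ cong (suc d ℕ.* x ℕ.+_) (weight-inc (suc d) k v) ⟩
  suc d ℕ.* x ℕ.+ (s ℕ.+ w)                 ≡⟨ ℕₚ.+-assoc (suc d ℕ.* x) s w ⟨
  suc d ℕ.* x ℕ.+ s ℕ.+ w                   ≡⟨ cong (ℕ._+ w) (ℕₚ.+-comm (suc d ℕ.* x) s) ⟩
  s ℕ.+ suc d ℕ.* x ℕ.+ w                   ≡⟨ ℕₚ.+-assoc s (suc d ℕ.* x) w ⟩
  s ℕ.+ (suc d ℕ.* x ℕ.+ w)                 ≡⟨ cong (λ e → suc e ℕ.+ (suc d ℕ.* x ℕ.+ w)) (sym (ℕₚ.+-suc d (toℕ k))) ⟩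
  suc (d ℕ.+ suc (toℕ k)) ℕ.+ (suc d ℕ.* x ℕ.+ w) ∎
  where open ≡-Reasoning
        w = weight (suc d) v
        s = suc (suc d ℕ.+ toℕ k)

∑-weight : ∀ d (v : Vec ℕ N) → ∑ (allFin N) (λ k → ι (suc (d ℕ.+ toℕ k) ℕ.* lookup v k)) ≡ ι (weight d v)
∑-weight d []                = sym ι-0
∑-weight {suc N} d (x ∷ v) = begin
  ∑ (allFin (suc N)) (λ k → ι (suc (d ℕ.+ toℕ k) ℕ.* lookup (x ∷ v) k))
    ≡⟨ ∑-allFin-suc N (λ k → ι (suc (d ℕ.+ toℕ k) ℕ.* lookup (x ∷ v) k)) ⟩
  ι (suc (d ℕ.+ 0) ℕ.* x) + ∑ (allFin N) (λ k → ι (suc (d ℕ.+ suc (toℕ k)) ℕ.* lookup v k))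
    ≡⟨ cong₂ ℚ._+_ (cong (λ e → ι (suc e ℕ.* x)) (ℕₚ.+-identityʳ d))
         (∑-cong (allFin N) (λ k → cong (λ e → ι (suc e ℕ.* lookup v k)) (ℕₚ.+-suc d (toℕ k)))) ⟩
  ι (suc d ℕ.* x) + ∑ (allFin N) (λ k → ι (suc (suc d ℕ.+ toℕ k) ℕ.* lookup v k))
    ≡⟨ +-congˡ (ι (suc d ℕ.* x)) (∑-weight (suc d) v) ⟩
  ι (suc d ℕ.* x) + ι (weight (suc d) v)
    ≡⟨ ι-+ (suc d ℕ.* x) (weight (suc d) v) ⟨
  ι (weight d (x ∷ v)) ∎
  where open ≡-Reasoning

-- factor d x = 1 / ((d+1)^x x!), so that prob 0 v = 1 / z_v is the probability
-- that a uniform permutation has cycle type v.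
factor : ℕ → ℕ → ℚ
factor d zero    = 1ℚ
factor d (suc x) = factor d x * recip (x ℕ.+ d ℕ.* suc x)

prob : ℕ → Vec ℕ N → ℚ
prob d []      = 1ℚ
prob d (x ∷ v) = factor d x * prob (suc d) v

-- Going from x to x + 1 parts of size d + 1 multiplies `factor` by 1 / ((d+1)(x+1)), because
-- `suc (x + d * suc x)` computes to (d+1)(x+1). The coefficient on the left cancels exactly this.
prob-inc : ∀ d (k : Fin N) v →
           ι (suc (d ℕ.+ toℕ k) ℕ.* suc (lookup v k)) * prob d (inc k v) ≡ prob d v
prob-inc d zero (x ∷ v) = begin
  ι (suc (d ℕ.+ 0) ℕ.* suc x) * (factor d x * recip y * P)
    ≡⟨ cong (λ e → ι (suc e ℕ.* suc x) * (factor d x * recip y * P)) (ℕₚ.+-identityʳ d) ⟩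
  ι (suc y) * (factor d x * recip y * P)
    ≡⟨ solve 4 (λ a b c e → a :* (b :* c :* e) := (a :* c) :* (b :* e)) refl (ι (suc y)) (factor d x) (recip y) P ⟩
  ι (suc y) * recip y * (factor d x * P)
    ≡⟨ *-congʳ (factor d x * P) (recip-inverse y) ⟩
  1ℚ * (factor d x * P)
    ≡⟨ ℚₚ.*-identityˡ (factor d x * P) ⟩
  factor d x * P ∎
  where open ≡-Reasoning
        y = x ℕ.+ d ℕ.* suc x
        P = prob (suc d) v
prob-inc d (suc k) (x ∷ v) = begin
  ι (suc (d ℕ.+ suc (toℕ k)) ℕ.* suc (lookup v k)) * (factor d x * P)
    ≡⟨ cong (λ e → ι (suc e ℕ.* suc (lookup v k)) * (factor d x * P)) (ℕₚ.+-suc d (toℕ k)) ⟩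
  c * (factor d x * P)
    ≡⟨ solve 3 (λ a b e → a :* (b :* e) := b :* (a :* e)) refl c (factor d x) P ⟩
  factor d x * (c * P)
    ≡⟨ *-congˡ (factor d x) (prob-inc (suc d) k v) ⟩
  factor d x * prob (suc d) v ∎
  where open ≡-Reasoning
        P = prob (suc d) (inc k v)
        c = ι (suc (suc d ℕ.+ toℕ k) ℕ.* suc (lookup v k))

0≤factor : ∀ d x → 0ℚ ℚ.≤ factor d x
0≤factor d zero    = 0≤1
0≤factor d (suc x) = 0≤* (0≤factor d x) (0≤recip (x ℕ.+ d ℕ.* suc x))

0≤prob : ∀ d (v : Vec ℕ N) → 0ℚ ℚ.≤ prob d v
0≤prob d []      = 0≤1
0≤prob d (x ∷ v) = 0≤* (0≤factor d x) (0≤prob (suc d) v)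

*≤1 : ∀ {p q} → 0ℚ ℚ.≤ q → p ℚ.≤ 1ℚ → q ℚ.≤ 1ℚ → p * q ℚ.≤ 1ℚ
*≤1 {p} {q} 0≤q p≤1 q≤1 = ℚₚ.≤-trans (*-monoˡ 0≤q p≤1) (subst (ℚ._≤ 1ℚ) (sym (ℚₚ.*-identityˡ q)) q≤1)

factor≤1 : ∀ d x → factor d x ℚ.≤ 1ℚ
factor≤1 d zero    = ℚₚ.≤-refl
factor≤1 d (suc x) = *≤1 (0≤recip (x ℕ.+ d ℕ.* suc x)) (factor≤1 d x) (recip≤1 (x ℕ.+ d ℕ.* suc x))

prob≤1 : ∀ d (v : Vec ℕ N) → prob d v ℚ.≤ 1ℚ
prob≤1 d []      = ℚₚ.≤-refl
prob≤1 d (x ∷ v) = *≤1 (0≤prob (suc d) v) (factor≤1 d x) (prob≤1 (suc d) v)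

-- A finite box that contains all partitions of b, since a multiplicity never exceeds the weight.
vectors≤ : ∀ N → ℕ → List (Vec ℕ N)
vectors≤ zero    b = [ [] ]
vectors≤ (suc N) b = cartesianProductWith _∷_ (upTo (suc b)) (vectors≤ N b)

vectors≤-unique : ∀ N b → Unique (vectors≤ N b)
vectors≤-unique zero    b = [] ∷ []
vectors≤-unique (suc N) b = Uniqueₚ.cartesianProductWith⁺ _∷_ Vecₚ.∷-injective (Uniqueₚ.upTo⁺ (suc b)) (vectors≤-unique N b)

∈-vectors≤ : ∀ d (v : Vec ℕ N) {b} → weight d v ≤ b → v ∈ vectors≤ N b
∈-vectors≤ d []      le = here refl
∈-vectors≤ d (x ∷ v) le = ∈ₚ.∈-cartesianProductWith⁺ _∷_
  (∈ₚ.∈-upTo⁺ (ℕ.s≤s (ℕₚ.≤-trans (ℕₚ.m≤m+n x (d ℕ.* x)) (ℕₚ.m+n≤o⇒m≤o (suc d ℕ.* x) le))))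
  (∈-vectors≤ (suc d) v (ℕₚ.m+n≤o⇒n≤o (suc d ℕ.* x) le))

-- Vectors of length N describe the partitions with parts of size at most N, which for n ≤ N are all
-- partitions of n. Keeping N apart from n puts partitions of different numbers into one type, so
-- that a part can be removed without changing the type.
partitions : ∀ N → ℕ → List (Vec ℕ N)
partitions N n = filter (λ v → weight 0 v ℕ.≟ n) (vectors≤ N n)

partitions-unique : ∀ N n → Unique (partitions N n)
partitions-unique N n = Uniqueₚ.filter⁺ (λ v → weight 0 v ℕ.≟ n) (vectors≤-unique N n)

∈-partitions⁺ : ∀ {v : Vec ℕ N} → weight 0 v ≡ n → v ∈ partitions N n
∈-partitions⁺ {n = n} {v} eq = ∈ₚ.∈-filter⁺ (λ v → weight 0 v ℕ.≟ n) (∈-vectors≤ 0 v (ℕₚ.≤-reflexive eq)) eq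

∈-partitions⁻ : ∀ {v : Vec ℕ N} → v ∈ partitions N n → weight 0 v ≡ n
∈-partitions⁻ {N} {n} v∈ = proj₂ (∈ₚ.∈-filter⁻ (λ v → weight 0 v ℕ.≟ n) {xs = vectors≤ N n} v∈)

size : Fin N → ℕ
size k = suc (toℕ k)

-- Removing one part of size `size k` is inverse to adding it. Both lists are free of duplicates, so
-- it suffices that they have the same entries.
inc-↭ : ∀ N n (k : Fin N) →
        filter (λ v → 1 ℕ.≤? lookup v k) (partitions N (size k ℕ.+ n)) ↭ map (inc k) (partitions N n)
inc-↭ N n k = unique∧set⇒↭ (Uniqueₚ.filter⁺ P? (partitions-unique N (size k ℕ.+ n)))
                (Uniqueₚ.map⁺ (inc-injective k) (partitions-unique N n)) (mk⇔ to from)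
  where
  P? = λ (v : Vec ℕ N) → 1 ℕ.≤? lookup v k
  to : ∀ {v} → v ∈ filter P? (partitions N (size k ℕ.+ n)) → v ∈ map (inc k) (partitions N n)
  to {v} v∈ with v∈′ , 1≤vₖ ← ∈ₚ.∈-filter⁻ P? {xs = partitions N (size k ℕ.+ n)} v∈ =
    subst (_∈ map (inc k) (partitions N n)) (inc-dec k v 1≤vₖ) (∈ₚ.∈-map⁺ (inc k) (∈-partitions⁺
      (ℕₚ.+-cancelˡ-≡ (size k) _ _ (trans (sym (weight-inc 0 k (dec k v)))
        (trans (cong (weight 0) (inc-dec k v 1≤vₖ)) (∈-partitions⁻ v∈′))))))
  from : ∀ {v} → v ∈ map (inc k) (partitions N n) → v ∈ filter P? (partitions N (size k ℕ.+ n))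
  from v∈ with w , w∈ , refl ← ∈ₚ.∈-map⁻ (inc k) v∈ = ∈ₚ.∈-filter⁺ P?
    (∈-partitions⁺ (trans (weight-inc 0 k w) (cong (size k ℕ.+_) (∈-partitions⁻ w∈))))
    (subst (1 ≤_) (sym (Vecₚ.lookup∘updateAt k w)) (ℕ.s≤s ℕ.z≤n))

-- With n the weight of v: the expected number of letters in cycles of length `size k` of a uniform
-- permutation of n letters, counted only when its cycle type is v.
biased : Fin N → Vec ℕ N → ℚ
biased k v = ι (size k ℕ.* lookup v k) * prob 0 v

0≤biased : ∀ (k : Fin N) v → 0ℚ ℚ.≤ biased k v
0≤biased k v = 0≤* (0≤ι (size k ℕ.* lookup v k)) (0≤prob 0 v)

biased-zero : ∀ (k : Fin N) v → ¬ (1 ≤ lookup v k) → biased k v ≡ 0ℚ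
biased-zero k v ¬1≤ = begin
  ι (size k ℕ.* lookup v k) * prob 0 v ≡⟨ cong (λ e → ι (size k ℕ.* e) * prob 0 v) (ℕₚ.n<1⇒n≡0 (ℕₚ.≰⇒> ¬1≤)) ⟩
  ι (size k ℕ.* 0) * prob 0 v          ≡⟨ *-congʳ (prob 0 v) (trans (cong ι (ℕₚ.*-zeroʳ (size k))) ι-0) ⟩
  0ℚ * prob 0 v                        ≡⟨ ℚₚ.*-zeroˡ (prob 0 v) ⟩
  0ℚ                                   ∎
  where open ≡-Reasoning

-- k vₖ / z_v = 1 / z_{v - eₖ}.
biased-inc : ∀ (k : Fin N) v → biased k (inc k v) ≡ prob 0 v
biased-inc k v = trans (cong (λ e → ι (size k ℕ.* e) * prob 0 (inc k v)) (Vecₚ.lookup∘updateAt k v)) (prob-inc 0 k v)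

-- Sorting the letters by cycle length: Σ k vₖ is the weight of v.
∑-biased : ∀ (v : Vec ℕ N) → ∑ (allFin N) (λ k → biased k v) ≡ ι (weight 0 v) * prob 0 v
∑-biased {N} v = trans (∑-*ʳ (allFin N) (prob 0 v) (λ k → ι (size k ℕ.* lookup v k))) (*-congʳ (prob 0 v) (∑-weight 0 v))

∑-remove : ∀ N n (k : Fin N) (F : Vec ℕ N → ℚ) → (∀ v → ¬ (1 ≤ lookup v k) → F v ≡ 0ℚ) →
           ∑ (partitions N (size k ℕ.+ n)) F ≡ ∑ (partitions N n) (F ∘ inc k)
∑-remove N n k F F≡0 = begin
  ∑ (partitions N (size k ℕ.+ n)) F               ≡⟨ ∑-filter P? (partitions N (size k ℕ.+ n)) F (λ {v} → F≡0 v) ⟨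
  ∑ (filter P? (partitions N (size k ℕ.+ n))) F   ≡⟨ ∑-↭ (inc-↭ N n k) F ⟩
  ∑ (map (inc k) (partitions N n)) F              ≡⟨ ∑-map (inc k) (partitions N n) F ⟩
  ∑ (partitions N n) (F ∘ inc k)                  ∎
  where open ≡-Reasoning
        P? = λ (v : Vec ℕ N) → 1 ℕ.≤? lookup v k

absent : ∀ (k : Fin N) (v : Vec ℕ N) → weight 0 v ℕ.< size k → ¬ (1 ≤ lookup v k)
absent k v lt 1≤vₖ = ℕₚ.<⇒≱ lt (subst (size k ≤_) eq (ℕₚ.m≤m+n (size k) (weight 0 (dec k v))))
  where eq = trans (sym (weight-inc 0 k (dec k v))) (cong (weight 0) (inc-dec k v 1≤vₖ))

∑-remove-none : ∀ N n (k : Fin N) (F : Vec ℕ N → ℚ) → (∀ v → ¬ (1 ≤ lookup v k) → F v ≡ 0ℚ) →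
                n ℕ.< size k → ∑ (partitions N n) F ≡ 0ℚ
∑-remove-none N n k F F≡0 n<k = trans
  (∑-cong∈ (partitions N n) (λ {v} v∈ → F≡0 v (absent k v (subst (ℕ._< size k) (sym (∈-partitions⁻ v∈)) n<k))))
  (∑-zero (partitions N n))

-- Permutations and insertion of a letter

concatMap-map : ∀ (f : A → B → C) xs ys → concatMap (λ x → map (f x) ys) xs ≡ cartesianProductWith f xs ys
concatMap-map f []       ys = refl
concatMap-map f (x ∷ xs) ys = cong (map (f x) ys ++_) (concatMap-map f xs ys)

∑-cartesianProductWith : ∀ (f : A → B → C) xs ys (F : C → ℚ) →
                         ∑ (cartesianProductWith f xs ys) F ≡ ∑ xs (λ x → ∑ ys (F ∘ f x))
∑-cartesianProductWith f xs ys F = begin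
  ∑ (cartesianProductWith f xs ys) F        ≡⟨ cong (λ zs → ∑ zs F) (concatMap-map f xs ys) ⟨
  ∑ (concatMap (λ x → map (f x) ys) xs) F   ≡⟨ ∑-concatMap (λ x → map (f x) ys) xs F ⟩
  ∑ xs (λ x → ∑ (map (f x) ys) F)           ≡⟨ ∑-cong xs (λ x → ∑-map (f x) ys F) ⟩
  ∑ xs (λ x → ∑ ys (F ∘ f x))               ∎
  where open ≡-Reasoning

lookup-ext : ∀ {u v : Vec A n} → (∀ i → lookup u i ≡ lookup v i) → u ≡ v
lookup-ext {u = []}    {[]}    eq = refl
lookup-ext {u = x ∷ u} {y ∷ v} eq = cong₂ _∷_ (eq zero) (lookup-ext (eq ∘ suc))

∧-true⁻ : ∀ {a b} → (a Bool.∧ b) ≡ true → a ≡ true × b ≡ true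
∧-true⁻ {true} {true} _ = refl , refl

allB⁺ : ∀ (f : A → Bool) xs → (∀ x → f x ≡ true) → allB f xs ≡ true
allB⁺ f []       eq = refl
allB⁺ f (x ∷ xs) eq rewrite eq x = allB⁺ f xs eq

allB⁻ : ∀ (f : A → Bool) {xs} → allB f xs ≡ true → ∀ {x} → x ∈ xs → f x ≡ true
allB⁻ f eq (here refl) = proj₁ (∧-true⁻ eq)
allB⁻ f eq (there x∈)  = allB⁻ f (proj₂ (∧-true⁻ eq)) x∈

record Injective (v : Vec (Fin n) m) : Set where
  constructor mkInjective
  field
    injective : ∀ {i j} → lookup v i ≡ lookup v j → i ≡ j

open Injective

isPerm⁺ : (v : Vec (Fin n) n) → Injective v → isPerm v ≡ true
isPerm⁺ {n} v inj = allB⁺ _ (allFin n) (λ i → allB⁺ _ (allFin n) (λ j → test i j))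
  where
  test : ∀ i j → (if lookup v i ==F lookup v j then i ==F j else true) ≡ true
  test i j with lookup v i Finₚ.≟ lookup v j | i Finₚ.≟ j
  ... | no _   | _     = refl
  ... | yes _  | yes _ = refl
  ... | yes eq | no ¬e = contradiction (injective inj eq) ¬e

isPerm⁻ : (v : Vec (Fin n) n) → isPerm v ≡ true → Injective v
isPerm⁻ {n} v eq = mkInjective (λ {i} {j} → test i j (allB⁻ _ (allB⁻ _ eq (∈ₚ.∈-allFin i)) (∈ₚ.∈-allFin j)))
  where
  test : ∀ i j → (if lookup v i ==F lookup v j then i ==F j else true) ≡ true → lookup v i ≡ lookup v j → i ≡ j
  test i j t e with lookup v i Finₚ.≟ lookup v j | i Finₚ.≟ j
  ... | _     | yes i≡j = i≡j
  ... | no ¬e | no _    = contradiction e ¬e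

allVecs-unique : ∀ n k → Unique (allVecs n k)
allVecs-unique n zero    = [] ∷ []
allVecs-unique n (suc k) = subst Unique (sym (concatMap-map _∷_ (allFin n) (allVecs n k)))
  (Uniqueₚ.cartesianProductWith⁺ _∷_ Vecₚ.∷-injective (Uniqueₚ.allFin⁺ n) (allVecs-unique n k))

∈-allVecs : ∀ {k} (v : Vec (Fin n) k) → v ∈ allVecs n k
∈-allVecs []                  = here refl
∈-allVecs {n} {suc k} (x ∷ v) = subst (x ∷ v ∈_) (sym (concatMap-map _∷_ (allFin n) (allVecs n k)))
  (∈ₚ.∈-cartesianProductWith⁺ _∷_ (∈ₚ.∈-allFin x) (∈-allVecs v))

perms-unique : ∀ n → Unique (perms n)
perms-unique n = Uniqueₚ.filter⁺ (λ v → isPerm v Bool.≟ true) (allVecs-unique n n)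

∈-perms⁺ : {v : Vec (Fin n) n} → Injective v → v ∈ perms n
∈-perms⁺ {v = v} inj = ∈ₚ.∈-filter⁺ (λ v → isPerm v Bool.≟ true) (∈-allVecs v) (isPerm⁺ v inj)

∈-perms⁻ : {v : Vec (Fin n) n} → v ∈ perms n → Injective v
∈-perms⁻ {n} {v} v∈ = isPerm⁻ v (proj₂ (∈ₚ.∈-filter⁻ (λ v → isPerm v Bool.≟ true) {xs = allVecs n n} v∈))

-- relabel x enumerates the letters other than x, with 0 standing in for x.
relabel : Fin (suc n) → Fin n → Fin (suc n)
relabel zero    y = suc y
relabel (suc a) y with y Finₚ.≟ a
... | yes _ = zero
... | no _  = suc y

relabel-≢ : ∀ {a y : Fin n} → y ≢ a → relabel (suc a) y ≡ suc y
relabel-≢ {a = a} {y} y≢a with y Finₚ.≟ a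
... | yes e = contradiction e y≢a
... | no _  = refl

relabel-≡ : ∀ (a : Fin n) → relabel (suc a) a ≡ zero
relabel-≡ a with a Finₚ.≟ a
... | yes _ = refl
... | no ¬e = contradiction refl ¬e

relabel≢ : ∀ (x : Fin (suc n)) y → relabel x y ≢ x
relabel≢ (suc a) y eq with y Finₚ.≟ a
relabel≢ (suc a) y refl | no y≢a = y≢a refl

relabel-injective : ∀ (x : Fin (suc n)) {y z} → relabel x y ≡ relabel x z → y ≡ z
relabel-injective zero    eq = Finₚ.suc-injective eq
relabel-injective (suc a) {y} {z} eq with y Finₚ.≟ a | z Finₚ.≟ a
... | yes y≡a | yes z≡a = trans y≡a (sym z≡a)
... | no _    | no _    = Finₚ.suc-injective eq

relabel-surjective : ∀ (x w : Fin (suc n)) → w ≢ x → ∃[ y ] relabel x y ≡ w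
relabel-surjective zero    zero    w≢x = contradiction refl w≢x
relabel-surjective zero    (suc b) w≢x = b , refl
relabel-surjective (suc a) zero    w≢x = a , relabel-≡ a
relabel-surjective (suc a) (suc b) w≢x = b , relabel-≢ (w≢x ∘ cong suc)

-- The new letter 0 becomes a fixed point (x = 0) or is put right before a in its cycle (x = suc a).
ins : Fin (suc n) → Vec (Fin n) n → Vec (Fin (suc n)) (suc n)
ins x v = x ∷ Vec.map (relabel x) v

lookup-ins : ∀ (x : Fin (suc n)) v j → lookup (ins x v) (suc j) ≡ relabel x (lookup v j)
lookup-ins x v j = Vecₚ.lookup-map j (relabel x) v

ins-injective : ∀ {x y : Fin (suc n)} {u v} → ins x u ≡ ins y v → x ≡ y × u ≡ v
ins-injective {x = x} {u = u} {v} eq with refl , eq′ ← Vecₚ.∷-injective eq =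
  refl , lookup-ext (λ j → relabel-injective x
    (trans (sym (lookup-ins x u j)) (trans (cong (λ w → lookup w j) eq′) (lookup-ins x v j))))

Injective-ins : ∀ (x : Fin (suc n)) {v} → Injective v → Injective (ins x v)
Injective-ins x {v} inj = mkInjective (λ {i} {j} → lem i j)
  where
  lem : ∀ i j → lookup (ins x v) i ≡ lookup (ins x v) j → i ≡ j
  lem zero    zero    eq = refl
  lem zero    (suc j) eq = contradiction (sym (trans eq (lookup-ins x v j))) (relabel≢ x (lookup v j))
  lem (suc i) zero    eq = contradiction (trans (sym (lookup-ins x v i)) eq) (relabel≢ x (lookup v i))
  lem (suc i) (suc j) eq = cong suc (injective inj (relabel-injective x
    (trans (sym (lookup-ins x v i)) (trans eq (lookup-ins x v j)))))

ins-surjective : ∀ (w : Vec (Fin (suc n)) (suc n)) → Injective w → ∃[ x ] ∃[ v ] Injective v × w ≡ ins x v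
ins-surjective (x ∷ u) inj = x , v , v-inj , cong (x ∷_) (lookup-ext u≡)
  where
  avoid : ∀ j → lookup u j ≢ x
  avoid j eq = contradiction (injective inj {suc j} {zero} eq) λ ()
  choose = λ j → relabel-surjective x (lookup u j) (avoid j)
  v = Vec.tabulate (proj₁ ∘ choose)
  lookup-v : ∀ j → relabel x (lookup v j) ≡ lookup u j
  lookup-v j = trans (cong (relabel x) (Vecₚ.lookup∘tabulate (proj₁ ∘ choose) j)) (proj₂ (choose j))
  v-inj : Injective v
  v-inj = mkInjective (λ {i} {j} eq → Finₚ.suc-injective (injective inj
    (trans (sym (lookup-v i)) (trans (cong (relabel x) eq) (lookup-v j)))))
  u≡ : ∀ j → lookup u j ≡ lookup (Vec.map (relabel x) v) j
  u≡ j = trans (sym (lookup-v j)) (sym (Vecₚ.lookup-map j (relabel x) v))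

-- In `ins x v` the letter 0 has image x, and deleting 0 from its cycle gives back v; so x and v are
-- both recovered from the permutation.
perms-↭ : ∀ n → perms (suc n) ↭ cartesianProductWith ins (allFin (suc n)) (perms n)
perms-↭ n = unique∧set⇒↭ (perms-unique (suc n))
  (Uniqueₚ.cartesianProductWith⁺ ins ins-injective (Uniqueₚ.allFin⁺ (suc n)) (perms-unique n)) (mk⇔ to from)
  where
  to : ∀ {w} → w ∈ perms (suc n) → w ∈ cartesianProductWith ins (allFin (suc n)) (perms n)
  to {w} w∈ with x , v , inj , refl ← ins-surjective w (∈-perms⁻ w∈) =
    ∈ₚ.∈-cartesianProductWith⁺ ins (∈ₚ.∈-allFin x) (∈-perms⁺ inj)
  from : ∀ {w} → w ∈ cartesianProductWith ins (allFin (suc n)) (perms n) → w ∈ perms (suc n)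
  from w∈ with x , v , _ , v∈ , refl ← ∈ₚ.∈-cartesianProductWith⁻ ins (allFin (suc n)) (perms n) w∈ =
    ∈-perms⁺ (Injective-ins x (∈-perms⁻ v∈))

-- Periods of letters

-- A specification of `cycleLen`: once some k is shown to be the least return time,
-- `IsPeriod-unique` identifies it with the result of the search.
record IsPeriod (v : Vec (Fin n) n) (i : Fin n) (k : ℕ) : Set where
  constructor isPeriod
  field
    positive : 1 ≤ k
    returns  : iter v k i ≡ i
    least    : ∀ j → 1 ≤ j → j ℕ.< k → iter v j i ≢ i

open IsPeriod

IsPeriod-unique : ∀ {v : Vec (Fin n) n} {i k l} → IsPeriod v i k → IsPeriod v i l → k ≡ l
IsPeriod-unique {k = k} {l} P Q = ℕₚ.≤-antisym
  (ℕₚ.≮⇒≥ (λ l<k → least P l (positive Q) l<k (returns Q)))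
  (ℕₚ.≮⇒≥ (λ k<l → least Q k (positive P) k<l (returns P)))

iter-+ : ∀ (v : Vec (Fin n) n) a b i → iter v (a ℕ.+ b) i ≡ iter v a (iter v b i)
iter-+ v zero    b i = refl
iter-+ v (suc a) b i = cong (lookup v) (iter-+ v a b i)

iter-lookup : ∀ (v : Vec (Fin n) n) k i → iter v k (lookup v i) ≡ lookup v (iter v k i)
iter-lookup v zero    i = refl
iter-lookup v (suc k) i = cong (lookup v) (iter-lookup v k i)

iter-injective : ∀ {v : Vec (Fin n) n} → Injective v → ∀ k {i j} → iter v k i ≡ iter v k j → i ≡ j
iter-injective inj zero    eq = eq
iter-injective inj (suc k) eq = iter-injective inj k (injective inj eq)

iter-cancel : ∀ {v : Vec (Fin n) n} → Injective v → ∀ {s t} i → s ℕ.< t → iter v s i ≡ iter v t i →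
              iter v (t ℕ.∸ s) i ≡ i
iter-cancel {v = v} inj {s} {t} i s<t eq = sym (iter-injective inj s
  (trans eq (trans (cong (λ e → iter v e i) (sym (ℕₚ.m+[n∸m]≡n (ℕₚ.<⇒≤ s<t)))) (iter-+ v s (t ℕ.∸ s) i))))

IsPeriod-lookup : ∀ {v : Vec (Fin n) n} {i k} → Injective v → IsPeriod v i k → IsPeriod v (lookup v i) k
IsPeriod-lookup {v = v} {i} {k} inj P = isPeriod (positive P)
  (trans (iter-lookup v k i) (cong (lookup v) (returns P)))
  (λ j 1≤j j<k eq → least P j 1≤j j<k (injective inj (trans (sym (iter-lookup v j i)) eq)))

IsPeriod-iter : ∀ {v : Vec (Fin n) n} {i k} → Injective v → IsPeriod v i k → ∀ t → IsPeriod v (iter v t i) k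
IsPeriod-iter inj P zero    = P
IsPeriod-iter inj P (suc t) = IsPeriod-lookup inj (IsPeriod-iter inj P t)

firstReturn : Vec (Fin n) n → Fin n → List ℕ → ℕ
firstReturn v i []       = 0
firstReturn v i (k ∷ ks) = if iter v k i ==F i then k else firstReturn v i ks

-- The search inside `cycleLen` is a local function, accessible only through its two defining
-- equations; these already determine it.
firstReturn-unique : ∀ (v : Vec (Fin n) n) i (go : List ℕ → ℕ) → go [] ≡ 0 →
                     (∀ k ks → go (k ∷ ks) ≡ (if iter v k i ==F i then k else go ks)) →
                     ∀ ks → go ks ≡ firstReturn v i ks
firstReturn-unique v i go nil cons []       = nil
firstReturn-unique v i go nil cons (k ∷ ks) =
  trans (cons k ks) (cong (if iter v k i ==F i then k else_) (firstReturn-unique v i go nil cons ks))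

cycleLen≡firstReturn : ∀ (v : Vec (Fin n) n) i → cycleLen v i ≡ firstReturn v i (map suc (upTo n))
cycleLen≡firstReturn {n} v i = main
  where
  -- Unification instantiates this with the local function of cycleLen, which cannot be named here.
  go : List ℕ → ℕ
  go = _
  main : cycleLen v i ≡ firstReturn v i (map suc (upTo n))
  main with map ℕ.suc (upTo n)
  ... | ks = firstReturn-unique v i go refl (λ _ _ → refl) ks

-- The list of candidates is given by an arbitrary f, so that the induction can drop its head by
-- passing to `f ∘ suc`.
firstReturn-least : ∀ (v : Vec (Fin n) n) i (f : ℕ → ℕ) m {t} → t ℕ.< m → iter v (f t) i ≡ i →
  ∃[ s ] s ℕ.< m × firstReturn v i (applyUpTo f m) ≡ f s × iter v (f s) i ≡ i ×
         (∀ {u} → u ℕ.< s → iter v (f u) i ≢ i)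
firstReturn-least v i f (suc m) {t} t<m eq with iter v (f 0) i Finₚ.≟ i
... | yes e = 0 , ℕ.s≤s ℕ.z≤n , refl , e , λ ()
firstReturn-least v i f (suc m) {zero}  t<m eq | no ¬e = contradiction eq ¬e
firstReturn-least v i f (suc m) {suc t} t<m eq | no ¬e
  with s , s<m , e₁ , e₂ , below ← firstReturn-least v i (f ∘ suc) m (ℕ.s≤s⁻¹ t<m) eq =
  suc s , ℕ.s≤s s<m , e₁ , e₂ , λ { {zero} _ → ¬e ; {suc u} u<s → below (ℕ.s≤s⁻¹ u<s) }

-- Among the n + 1 iterates with exponents 0 to n two coincide, and cancelling the smaller exponent
-- leaves a return after at most n steps. Hence the search of `cycleLen` never ends in its default
-- value 0.
returns-within : ∀ {v : Vec (Fin n) n} → Injective v → ∀ i → ∃[ t ] t ℕ.< n × iter v (suc t) i ≡ i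
returns-within {n} {v} inj i with s , t , s<t , eq ← Finₚ.pigeonhole (ℕₚ.n<1+n n) (λ t → iter v (toℕ t) i) =
  ℕ.pred d , subst (_≤ n) (sym suc-pred) (ℕₚ.≤-trans (ℕₚ.m∸n≤m (toℕ t) (toℕ s)) (ℕ.s≤s⁻¹ (Finₚ.toℕ<n t))) ,
  trans (cong (λ e → iter v e i) suc-pred) (iter-cancel inj i s<t eq)
  where
  d = toℕ t ℕ.∸ toℕ s
  suc-pred : suc (ℕ.pred d) ≡ d
  suc-pred = ℕₚ.suc-pred d {{ℕ.>-nonZero (ℕₚ.m<n⇒0<n∸m s<t)}}

cycleLen-isPeriod : ∀ {v : Vec (Fin n) n} → Injective v → ∀ i → IsPeriod v i (cycleLen v i) × cycleLen v i ≤ n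
cycleLen-isPeriod {n} {v} inj i
  with t , t<n , eq ← returns-within inj i
  with s , s<n , e₁ , e₂ , below ← firstReturn-least v i suc n t<n eq =
  subst (λ k → IsPeriod v i k × k ≤ n) (sym (trans (cycleLen≡firstReturn v i)
    (trans (cong (firstReturn v i) (Listₚ.map-upTo suc n)) e₁)))
  (isPeriod (ℕ.s≤s ℕ.z≤n) e₂ (λ { (suc j) _ j<s → below (ℕ.s≤s⁻¹ j<s) }) , s<n)

cycleLen≡ : ∀ {v : Vec (Fin n) n} → Injective v → ∀ {i k} → IsPeriod v i k → cycleLen v i ≡ k
cycleLen≡ inj {i} P = IsPeriod-unique (proj₁ (cycleLen-isPeriod inj i)) P

iter-ins-zero : ∀ (v : Vec (Fin n) n) k j → iter (ins zero v) k (suc j) ≡ suc (iter v k j)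
iter-ins-zero v zero    j = refl
iter-ins-zero v (suc k) j = trans (cong (lookup (ins zero v)) (iter-ins-zero v k j)) (lookup-ins zero v (iter v k j))

cycleLen-ins-zero-0 : ∀ {v : Vec (Fin n) n} → Injective v → cycleLen (ins zero v) zero ≡ 1
cycleLen-ins-zero-0 inj = cycleLen≡ (Injective-ins zero inj) {zero}
  (isPeriod (ℕ.s≤s ℕ.z≤n) refl (λ { (suc j) _ (ℕ.s≤s ()) }))

cycleLen-ins-zero-suc : ∀ {v : Vec (Fin n) n} → Injective v → ∀ j → cycleLen (ins zero v) (suc j) ≡ cycleLen v j
cycleLen-ins-zero-suc {v = v} inj j with P , _ ← cycleLen-isPeriod inj j =
  cycleLen≡ (Injective-ins zero inj) (isPeriod (positive P)
    (trans (iter-ins-zero v (cycleLen v j) j) (cong suc (returns P)))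
    (λ t 1≤t t<k eq → least P t 1≤t t<k (Finₚ.suc-injective (trans (sym (iter-ins-zero v t j)) eq))))

-- Only the arrow into a is redirected, to the new letter, so both walks agree until they would
-- arrive at a. Starting at j = a is allowed, since the condition begins at the first step.
iter-ins-suc : ∀ (v : Vec (Fin n) n) a j t → (∀ u → 1 ≤ u → u ≤ t → iter v u j ≢ a) →
               iter (ins (suc a) v) t (suc j) ≡ suc (iter v t j)
iter-ins-suc v a j zero    avoid = refl
iter-ins-suc v a j (suc t) avoid = begin
  lookup (ins (suc a) v) (iter (ins (suc a) v) t (suc j))
    ≡⟨ cong (lookup (ins (suc a) v)) (iter-ins-suc v a j t (λ u 1≤u u≤t → avoid u 1≤u (ℕₚ.m≤n⇒m≤1+n u≤t))) ⟩
  lookup (ins (suc a) v) (suc (iter v t j))  ≡⟨ lookup-ins (suc a) v (iter v t j) ⟩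
  relabel (suc a) (iter v (suc t) j)         ≡⟨ relabel-≢ (avoid (suc t) (ℕ.s≤s ℕ.z≤n) ℕₚ.≤-refl) ⟩
  suc (iter v (suc t) j)                     ∎
  where open ≡-Reasoning

-- The cycle that receives the new letter

module Cycle {v : Vec (Fin n) n} (inj : Injective v) (a : Fin n) where

  L : ℕ
  L = cycleLen v a

  private
    v′ = ins (suc a) v
    inj′ = Injective-ins (suc a) inj
    P = proj₁ (cycleLen-isPeriod inj a)

  L-positive : 1 ≤ L
  L-positive = positive P

  orbit : List (Fin n)
  orbit = applyUpTo (λ t → iter v t a) L

  orbit-unique : Unique orbit
  orbit-unique = Uniqueₚ.applyUpTo⁺₁ (λ t → iter v t a) L (λ {s} {t} s<t t<L eq →
    least P (t ℕ.∸ s) (ℕₚ.m<n⇒0<n∸m s<t) (ℕₚ.≤-<-trans (ℕₚ.m∸n≤m t s) t<L) (iter-cancel inj a s<t eq))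

  orbit-lookup⁻ : ∀ {j} → lookup v j ∈ orbit → j ∈ orbit
  orbit-lookup⁻ {j} fj∈ with ∈ₚ.∈-applyUpTo⁻ (λ t → iter v t a) fj∈
  ... | suc t , t<L , eq = subst (_∈ orbit) (sym (injective inj eq)) (∈ₚ.∈-applyUpTo⁺ (λ t → iter v t a) (ℕₚ.<⇒≤ t<L))
  -- Here j is the predecessor of a itself, which is the last point of the orbit, with exponent L -
  -- 1, since the L-th iterate returns to a.
  ... | zero  , _   , eq = subst (_∈ orbit) (sym (injective inj (trans eq (sym
      (trans (cong (λ e → iter v e a) suc-pred) (returns P))))))
      (∈ₚ.∈-applyUpTo⁺ (λ t → iter v t a) (subst (_≤ L) (sym suc-pred) ℕₚ.≤-refl))
    where
    suc-pred : suc (ℕ.pred L) ≡ L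
    suc-pred = ℕₚ.suc-pred L {{ℕ.>-nonZero L-positive}}

  orbit-iter⁻ : ∀ u {j} → iter v u j ∈ orbit → j ∈ orbit
  orbit-iter⁻ zero    j∈ = j∈
  orbit-iter⁻ (suc u) j∈ = orbit-iter⁻ u (orbit-lookup⁻ j∈)

  cycleLen-orbit : ∀ {j} → j ∈ orbit → cycleLen v j ≡ L
  cycleLen-orbit j∈ with t , _ , refl ← ∈ₚ.∈-applyUpTo⁻ (λ t → iter v t a) j∈ =
    cycleLen≡ inj (IsPeriod-iter inj P t)

  iter-ins-0 : ∀ {t} → t ℕ.< L → iter v′ (suc t) zero ≡ suc (iter v t a)
  iter-ins-0 {t} t<L = trans (sym (iter-lookup v′ t zero))
    (iter-ins-suc v a a t (λ u 1≤u u≤t → least P u 1≤u (ℕₚ.≤-<-trans u≤t t<L)))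

  -- The walk from 0 passes through the L letters of the orbit and closes at step L + 1: v sends the
  -- last of them to a, for which `relabel` substitutes 0.
  isPeriod-0 : IsPeriod v′ zero (suc L)
  isPeriod-0 = isPeriod (ℕ.s≤s ℕ.z≤n) ret
    (λ { (suc t) _ t<L eq → contradiction (trans (sym (iter-ins-0 (ℕ.s≤s⁻¹ t<L))) eq) λ () })
    where
    open ≡-Reasoning
    l = ℕ.pred L
    suc-pred : suc l ≡ L
    suc-pred = ℕₚ.suc-pred L {{ℕ.>-nonZero L-positive}}
    ret : iter v′ (suc L) zero ≡ zero
    ret = begin
      lookup v′ (iter v′ L zero)        ≡⟨ cong (λ e → lookup v′ (iter v′ e zero)) suc-pred ⟨
      lookup v′ (iter v′ (suc l) zero)  ≡⟨ cong (lookup v′) (iter-ins-0 (subst (l ℕ.<_) suc-pred (ℕₚ.n<1+n l))) ⟩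
      lookup v′ (suc (iter v l a))      ≡⟨ lookup-ins (suc a) v (iter v l a) ⟩
      relabel (suc a) (iter v (suc l) a) ≡⟨ cong (λ e → relabel (suc a) (iter v e a)) suc-pred ⟩
      relabel (suc a) (iter v L a)      ≡⟨ cong (relabel (suc a)) (returns P) ⟩
      relabel (suc a) a                 ≡⟨ relabel-≡ a ⟩
      zero                              ∎

  cycleLen-0 : cycleLen v′ zero ≡ suc L
  cycleLen-0 = cycleLen≡ inj′ isPeriod-0

  -- By `iter-ins-0` the letter is an iterate of 0, so it shares the period of 0.
  cycleLen-in : ∀ {j} → j ∈ orbit → cycleLen v′ (suc j) ≡ suc L
  cycleLen-in j∈ with t , t<L , refl ← ∈ₚ.∈-applyUpTo⁻ (λ t → iter v t a) j∈ =
    cycleLen≡ inj′ (subst (λ i → IsPeriod v′ i (suc L)) (iter-ins-0 t<L) (IsPeriod-iter inj′ isPeriod-0 (suc t)))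

  -- The orbit is closed under preimages, so a walk from outside never reaches a and never uses the
  -- redirected arrow.
  cycleLen-out : ∀ {j} → ¬ (j ∈ orbit) → cycleLen v′ (suc j) ≡ cycleLen v j
  cycleLen-out {j} j∉ = cycleLen≡ inj′ (isPeriod (positive Q)
      (trans (iter′ (cycleLen v j)) (cong suc (returns Q)))
      (λ t 1≤t t<k eq → least Q t 1≤t t<k (Finₚ.suc-injective (trans (sym (iter′ t)) eq))))
    where
    Q = proj₁ (cycleLen-isPeriod inj j)
    iter′ : ∀ t → iter v′ t (suc j) ≡ suc (iter v t j)
    iter′ t = iter-ins-suc v a j t (λ u _ _ eq → j∉ (orbit-iter⁻ u
      (subst (_∈ orbit) (sym eq) (∈ₚ.∈-applyUpTo⁺ (λ t → iter v t a) L-positive))))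

  length-orbit : ∑ (allFin n) (λ j → 𝟙 (member? Finₚ._≟_ j orbit)) ≡ ι L
  length-orbit = begin
    ∑ (allFin n) (λ j → 𝟙 (O? j))      ≡⟨ ι-length-filter O? (allFin n) ⟨
    ι (length (filter O? (allFin n)))  ≡⟨ ι-length (filter O? (allFin n)) ⟩
    ∑ (filter O? (allFin n)) (λ _ → 1ℚ) ≡⟨ ∑-↭ ↭orbit (λ _ → 1ℚ) ⟩
    ∑ orbit (λ _ → 1ℚ)                 ≡⟨ ι-length orbit ⟨
    ι (length orbit)                   ≡⟨ cong ι (Listₚ.length-applyUpTo (λ t → iter v t a) L) ⟩
    ι L                                ∎
    where
    open ≡-Reasoning
    O? = λ j → member? Finₚ._≟_ j orbit
    ↭orbit : filter O? (allFin n) ↭ orbit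
    ↭orbit = unique∧set⇒↭ (Uniqueₚ.filter⁺ O? (Uniqueₚ.allFin⁺ n)) orbit-unique
      (mk⇔ (λ j∈ → proj₂ (∈ₚ.∈-filter⁻ O? {xs = allFin n} j∈)) (λ j∈ → ∈ₚ.∈-filter⁺ O? (∈ₚ.∈-allFin _) j∈))

-- Letters counted by cycle length

letters : ℕ → Vec (Fin n) n → ℕ
letters {n} k v = length (filter (λ i → cycleLen v i ℕ.≟ k) (allFin n))

ι-letters : ∀ k (v : Vec (Fin n) n) → ι (letters k v) ≡ ∑ (allFin n) (λ i → 𝟙 (cycleLen v i ℕ.≟ k))
ι-letters {n} k v = ι-length-filter (λ i → cycleLen v i ℕ.≟ k) (allFin n)

ι-letters-suc : ∀ k (v : Vec (Fin (suc n)) (suc n)) →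
  ι (letters k v) ≡ 𝟙 (cycleLen v zero ℕ.≟ k) + ∑ (allFin n) (λ i → 𝟙 (cycleLen v (suc i) ℕ.≟ k))
ι-letters-suc {n} k v = trans (ι-letters k v) (∑-allFin-suc n (λ i → 𝟙 (cycleLen v i ℕ.≟ k)))

letters-ins-zero-1 : ∀ {v : Vec (Fin n) n} → Injective v → letters 1 (ins zero v) ≡ suc (letters 1 v)
letters-ins-zero-1 {n} {v} inj = ι-injective (begin
  ι (letters 1 (ins zero v))
    ≡⟨ ι-letters-suc 1 (ins zero v) ⟩
  𝟙 (cycleLen (ins zero v) zero ℕ.≟ 1) + ∑ (allFin n) (λ i → 𝟙 (cycleLen (ins zero v) (suc i) ℕ.≟ 1))
    ≡⟨ cong₂ ℚ._+_ (𝟙-yes (cycleLen (ins zero v) zero ℕ.≟ 1) (cycleLen-ins-zero-0 inj)) (∑-cong (allFin n) (λ i → cong (λ l → 𝟙 (l ℕ.≟ 1)) (cycleLen-ins-zero-suc inj i))) ⟩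
  1ℚ + ∑ (allFin n) (λ i → 𝟙 (cycleLen v i ℕ.≟ 1))
    ≡⟨ +-congˡ 1ℚ (ι-letters 1 v) ⟨
  1ℚ + ι (letters 1 v)
    ≡⟨ ι-suc (letters 1 v) ⟨
  ι (suc (letters 1 v)) ∎)
  where open ≡-Reasoning

letters-ins-zero-≢ : ∀ {v : Vec (Fin n) n} {k} → Injective v → k ≢ 1 → letters k (ins zero v) ≡ letters k v
letters-ins-zero-≢ {n} {v} {k} inj k≢1 = ι-injective (begin
  ι (letters k (ins zero v))
    ≡⟨ ι-letters-suc k (ins zero v) ⟩
  𝟙 (cycleLen (ins zero v) zero ℕ.≟ k) + ∑ (allFin n) (λ i → 𝟙 (cycleLen (ins zero v) (suc i) ℕ.≟ k))
    ≡⟨ cong₂ ℚ._+_ (𝟙-no (cycleLen (ins zero v) zero ℕ.≟ k) (λ e → k≢1 (trans (sym e) (cycleLen-ins-zero-0 inj))))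
         (∑-cong (allFin n) (λ i → cong (λ l → 𝟙 (l ℕ.≟ k)) (cycleLen-ins-zero-suc inj i))) ⟩
  0ℚ + ∑ (allFin n) (λ i → 𝟙 (cycleLen v i ℕ.≟ k))
    ≡⟨ ℚₚ.+-identityˡ (∑ (allFin n) (λ i → 𝟙 (cycleLen v i ℕ.≟ k))) ⟩
  ∑ (allFin n) (λ i → 𝟙 (cycleLen v i ℕ.≟ k))
    ≡⟨ ι-letters k v ⟨
  ι (letters k v) ∎)
  where open ≡-Reasoning

module _ {v : Vec (Fin n) n} (inj : Injective v) (a : Fin n) where
  open Cycle inj a
  private v′ = ins (suc a) v

  -- The L letters of the cycle move from length L to length L + 1, where the new letter joins them.
  -- Losses stand on the left and gains on the right, so one equation without subtraction covers
  -- every k.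
  ι-letters-ins : ∀ k → ι (letters k v′) + ι L * 𝟙 (L ℕ.≟ k) ≡ ι (letters k v) + ι (suc L) * 𝟙 (suc L ℕ.≟ k)
  ι-letters-ins k = begin
    ι (letters k v′) + ι L * x
      ≡⟨ cong₂ ℚ._+_ (ι-letters-suc k v′) (*-congʳ x (sym length-orbit)) ⟩
    𝟙 (cycleLen v′ zero ℕ.≟ k) + ∑ (allFin n) new + ∑ (allFin n) o * x
      ≡⟨ cong₂ (λ p q → p + ∑ (allFin n) new + q) (cong (λ l → 𝟙 (l ℕ.≟ k)) cycleLen-0) (sym (∑-*ʳ (allFin n) x o)) ⟩
    y + ∑ (allFin n) new + ∑ (allFin n) (λ j → o j * x)
      ≡⟨ ℚₚ.+-assoc y (∑ (allFin n) new) (∑ (allFin n) (λ j → o j * x)) ⟩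
    y + (∑ (allFin n) new + ∑ (allFin n) (λ j → o j * x))
      ≡⟨ +-congˡ y (∑-+ (allFin n) new (λ j → o j * x)) ⟨
    y + ∑ (allFin n) (λ j → new j + o j * x)
      ≡⟨ +-congˡ y (∑-cong (allFin n) pointwise) ⟩
    y + ∑ (allFin n) (λ j → old j + o j * y)
      ≡⟨ +-congˡ y (trans (∑-+ (allFin n) old (λ j → o j * y)) (cong₂ ℚ._+_ (sym (ι-letters k v)) (trans (∑-*ʳ (allFin n) y o) (*-congʳ y length-orbit)))) ⟩
    y + (ι (letters k v) + ι L * y)
      ≡⟨ solve 3 (λ y c l → y :+ (c :+ l :* y) := c :+ (con 1ℚ :+ l) :* y) refl y (ι (letters k v)) (ι L) ⟩
    ι (letters k v) + (1ℚ + ι L) * y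
      ≡⟨ +-congˡ (ι (letters k v)) (*-congʳ y (ι-suc L)) ⟨
    ι (letters k v) + ι (suc L) * y ∎
    where
    open ≡-Reasoning
    x = 𝟙 (L ℕ.≟ k)
    y = 𝟙 (suc L ℕ.≟ k)
    new old o : Fin n → ℚ
    new j = 𝟙 (cycleLen v′ (suc j) ℕ.≟ k)
    old j = 𝟙 (cycleLen v j ℕ.≟ k)
    o j = 𝟙 (member? Finₚ._≟_ j orbit)
    pointwise : ∀ j → new j + o j * x ≡ old j + o j * y
    pointwise j with member? Finₚ._≟_ j orbit
    ... | yes j∈ = trans
      (cong₂ (λ l p → 𝟙 (l ℕ.≟ k) + p) (cycleLen-in j∈) (ℚₚ.*-identityˡ x))
      (trans (ℚₚ.+-comm y x)
      (cong₂ (λ l p → 𝟙 (l ℕ.≟ k) + p) (sym (cycleLen-orbit j∈)) (sym (ℚₚ.*-identityˡ y))))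
    ... | no j∉ = cong₂ (λ l p → 𝟙 (l ℕ.≟ k) + p) (cycleLen-out j∉) (trans (ℚₚ.*-zeroˡ x) (sym (ℚₚ.*-zeroˡ y)))

  letters-ins-L : letters L v ≡ L ℕ.+ letters L v′
  letters-ins-L = ι-injective (begin
    ι (letters L v)
      ≡⟨ solve 2 (λ c l → c := c :+ l :* con 0ℚ) refl (ι (letters L v)) (ι (suc L)) ⟩
    ι (letters L v) + ι (suc L) * 0ℚ
      ≡⟨ +-congˡ (ι (letters L v)) (*-congˡ (ι (suc L)) (sym (𝟙-no (suc L ℕ.≟ L) ℕₚ.1+n≢n))) ⟩
    ι (letters L v) + ι (suc L) * 𝟙 (suc L ℕ.≟ L)
      ≡⟨ ι-letters-ins L ⟨
    ι (letters L v′) + ι L * 𝟙 (L ℕ.≟ L)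
      ≡⟨ +-congˡ (ι (letters L v′)) (*-congˡ (ι L) (𝟙-yes (L ℕ.≟ L) refl)) ⟩
    ι (letters L v′) + ι L * 1ℚ
      ≡⟨ solve 2 (λ c l → c :+ l :* con 1ℚ := l :+ c) refl (ι (letters L v′)) (ι L) ⟩
    ι L + ι (letters L v′)
      ≡⟨ ι-+ L (letters L v′) ⟨
    ι (L ℕ.+ letters L v′) ∎)
    where open ≡-Reasoning

  letters-ins-suc-L : letters (suc L) v′ ≡ suc L ℕ.+ letters (suc L) v
  letters-ins-suc-L = ι-injective (begin
    ι (letters (suc L) v′)
      ≡⟨ solve 2 (λ c l → c := c :+ l :* con 0ℚ) refl (ι (letters (suc L) v′)) (ι L) ⟩
    ι (letters (suc L) v′) + ι L * 0ℚ
      ≡⟨ +-congˡ (ι (letters (suc L) v′)) (*-congˡ (ι L) (sym (𝟙-no (L ℕ.≟ suc L) (ℕₚ.1+n≢n ∘ sym)))) ⟩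
    ι (letters (suc L) v′) + ι L * 𝟙 (L ℕ.≟ suc L)
      ≡⟨ ι-letters-ins (suc L) ⟩
    ι (letters (suc L) v) + ι (suc L) * 𝟙 (suc L ℕ.≟ suc L)
      ≡⟨ +-congˡ (ι (letters (suc L) v)) (*-congˡ (ι (suc L)) (𝟙-yes (suc L ℕ.≟ suc L) refl)) ⟩
    ι (letters (suc L) v) + ι (suc L) * 1ℚ
      ≡⟨ solve 2 (λ c l → c :+ l :* con 1ℚ := l :+ c) refl (ι (letters (suc L) v)) (ι (suc L)) ⟩
    ι (suc L) + ι (letters (suc L) v)
      ≡⟨ ι-+ (suc L) (letters (suc L) v) ⟨
    ι (suc L ℕ.+ letters (suc L) v) ∎)
    where open ≡-Reasoning

  letters-ins-≢ : ∀ {k} → L ≢ k → suc L ≢ k → letters k v′ ≡ letters k v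
  letters-ins-≢ {k} L≢k sL≢k = ι-injective (begin
    ι (letters k v′)
      ≡⟨ solve 2 (λ c l → c := c :+ l :* con 0ℚ) refl (ι (letters k v′)) (ι L) ⟩
    ι (letters k v′) + ι L * 0ℚ
      ≡⟨ +-congˡ (ι (letters k v′)) (*-congˡ (ι L) (sym (𝟙-no (L ℕ.≟ k) L≢k))) ⟩
    ι (letters k v′) + ι L * 𝟙 (L ℕ.≟ k)
      ≡⟨ ι-letters-ins k ⟩
    ι (letters k v) + ι (suc L) * 𝟙 (suc L ℕ.≟ k)
      ≡⟨ +-congˡ (ι (letters k v)) (*-congˡ (ι (suc L)) (𝟙-no (suc L ℕ.≟ k) sL≢k)) ⟩
    ι (letters k v) + ι (suc L) * 0ℚ
      ≡⟨ solve 2 (λ c l → c :+ l :* con 0ℚ := c) refl (ι (letters k v)) (ι (suc L)) ⟩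
    ι (letters k v) ∎)
    where open ≡-Reasoning

-- This makes the division in `cycleType` exact. Building the permutation letter by letter, each
-- insertion changes the count for a length k by 0 or by exactly k.
letters-∣ : ∀ n (v : Vec (Fin n) n) → Injective v → ∀ k → k ∣ letters k v
letters-∣ zero    v inj k = k ∣.∣0
letters-∣ (suc n) v inj k with ins-surjective v inj
... | zero  , w , w-inj , refl with k ℕ.≟ 1
...   | yes refl = ∣.1∣ letters 1 (ins zero w)
...   | no k≢1   = subst (k ∣_) (sym (letters-ins-zero-≢ w-inj k≢1)) (letters-∣ n w w-inj k)
letters-∣ (suc n) v inj k | suc a , w , w-inj , refl with cycleLen w a ℕ.≟ k | suc (cycleLen w a) ℕ.≟ k
-- For k = L the count before insertion is L plus the count after it, so divisibility passes to the
-- second summand.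
...   | yes refl | _ = ∣.∣m+n∣m⇒∣n (subst (k ∣_) (letters-ins-L w-inj a) (letters-∣ n w w-inj k)) ∣.∣-refl
...   | no _     | yes refl = subst (k ∣_) (sym (letters-ins-suc-L w-inj a)) (∣.∣m∣n⇒∣m+n ∣.∣-refl (letters-∣ n w w-inj k))
...   | no L≢k   | no sL≢k  = subst (k ∣_) (sym (letters-ins-≢ w-inj a L≢k sL≢k)) (letters-∣ n w w-inj k)

-- The cycle type of v, recorded up to length N.
type : ∀ N → Vec (Fin n) n → Vec ℕ N
type N v = Vec.tabulate (λ k → letters (size k) v ℕ./ size k)

lookup-type : ∀ (v : Vec (Fin n) n) (k : Fin N) → lookup (type N v) k ≡ letters (size k) v ℕ./ size k
lookup-type v k = Vecₚ.lookup∘tabulate (λ k → letters (size k) v ℕ./ size k) k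

size*type : ∀ {v : Vec (Fin n) n} → Injective v → (k : Fin N) → size k ℕ.* lookup (type N v) k ≡ letters (size k) v
size*type {n} {v = v} inj k = trans (cong (size k ℕ.*_) (lookup-type v k)) (DivMod.m*[n/m]≡n (letters-∣ n v inj (size k)))

[k+m]/k : ∀ k m → (suc k ℕ.+ m) ℕ./ suc k ≡ suc (m ℕ./ suc k)
[k+m]/k k m = trans (DivMod.+-distrib-/-∣ˡ m (∣.∣-refl {suc k})) (cong (ℕ._+ m ℕ./ suc k) (DivMod.n/n≡1 (suc k)))

lookup-inc-≢ : ∀ {i k : Fin N} v → i ≢ k → lookup (inc k v) i ≡ lookup v i
lookup-inc-≢ {i = i} {k} v i≢k = Vecₚ.lookup∘updateAt′ i k i≢k v

lookup-dec-≢ : ∀ {i k : Fin N} v → i ≢ k → lookup (dec k v) i ≡ lookup v i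
lookup-dec-≢ {i = i} {k} v i≢k = Vecₚ.lookup∘updateAt′ i k i≢k v

type-ins-zero : ∀ {v : Vec (Fin n) n} → Injective v → type (suc N) (ins zero v) ≡ inc zero (type (suc N) v)
type-ins-zero {N = N} {v} inj = lookup-ext eq
  where
  eq : ∀ k → lookup (type (suc N) (ins zero v)) k ≡ lookup (inc zero (type (suc N) v)) k
  eq zero    = trans (cong (ℕ._/ 1) (letters-ins-zero-1 inj)) ([k+m]/k 0 (letters 1 v))
  eq (suc k) = begin
    lookup (type (suc N) (ins zero v)) (suc k)     ≡⟨ lookup-type (ins zero v) (suc k) ⟩
    letters (size (suc k)) (ins zero v) ℕ./ size (suc k)
      ≡⟨ cong (ℕ._/ size (suc k)) (letters-ins-zero-≢ {v = v} inj (λ ())) ⟩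
    letters (size (suc k)) v ℕ./ size (suc k)      ≡⟨ lookup-type v (suc k) ⟨
    lookup (type (suc N) v) (suc k)                ∎
    where open ≡-Reasoning

-- The effect of an insertion on the type: a cycle of length `size k`, at index `Fin.inject₁ k`,
-- becomes one that is longer by one, at index `suc k`.
shift : Fin N → Vec ℕ (suc N) → Vec ℕ (suc N)
shift k u = inc (suc k) (dec (Fin.inject₁ k) u)

type-ins-suc : ∀ {v : Vec (Fin n) n} → Injective v → ∀ a (k : Fin N) → cycleLen v a ≡ size k →
               type (suc N) (ins (suc a) v) ≡ shift k (type (suc N) v)
type-ins-suc {N = N} {v} inj a k L≡ = lookup-ext eq
  where
  open ≡-Reasoning
  L = cycleLen v a
  v′ = ins (suc a) v
  T = type (suc N) v
  k₁ = Fin.inject₁ k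
  L≡size-k₁ : L ≡ size k₁
  L≡size-k₁ = trans L≡ (cong suc (sym (Finₚ.toℕ-inject₁ k)))
  suc-L≡ : suc L ≡ size (suc k)
  suc-L≡ = cong suc L≡
  suc-k≢k₁ : suc k ≢ k₁
  suc-k≢k₁ e = ℕₚ.1+n≢n (trans (cong toℕ e) (Finₚ.toℕ-inject₁ k))
  eq : ∀ i → lookup (type (suc N) v′) i ≡ lookup (shift k T) i
  eq i with i Finₚ.≟ suc k | i Finₚ.≟ k₁
  ... | yes refl | _ = begin
    lookup (type (suc N) v′) (suc k)          ≡⟨ lookup-type v′ (suc k) ⟩
    letters (size (suc k)) v′ ℕ./ size (suc k)
      ≡⟨ cong (ℕ._/ size (suc k)) (subst (λ l → letters l v′ ≡ l ℕ.+ letters l v) suc-L≡ (letters-ins-suc-L inj a)) ⟩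
    (size (suc k) ℕ.+ letters (size (suc k)) v) ℕ./ size (suc k)
      ≡⟨ [k+m]/k (toℕ (suc k)) (letters (size (suc k)) v) ⟩
    suc (letters (size (suc k)) v ℕ./ size (suc k)) ≡⟨ cong suc (lookup-type v (suc k)) ⟨
    suc (lookup T (suc k))                    ≡⟨ cong suc (lookup-dec-≢ T suc-k≢k₁) ⟨
    suc (lookup (dec k₁ T) (suc k))           ≡⟨ Vecₚ.lookup∘updateAt (suc k) (dec k₁ T) ⟨
    lookup (shift k T) (suc k)                ∎
  ... | no i≢ | yes refl = begin
    lookup (type (suc N) v′) k₁               ≡⟨ lookup-type v′ k₁ ⟩
    ℕ.pred (suc (letters (size k₁) v′ ℕ./ size k₁))
      ≡⟨ cong ℕ.pred ([k+m]/k (toℕ k₁) (letters (size k₁) v′)) ⟨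
    ℕ.pred ((size k₁ ℕ.+ letters (size k₁) v′) ℕ./ size k₁)
      ≡⟨ cong (λ m → ℕ.pred (m ℕ./ size k₁)) (subst (λ l → letters l v ≡ l ℕ.+ letters l v′) L≡size-k₁ (letters-ins-L inj a)) ⟨
    ℕ.pred (letters (size k₁) v ℕ./ size k₁)  ≡⟨ cong ℕ.pred (lookup-type v k₁) ⟨
    ℕ.pred (lookup T k₁)                      ≡⟨ Vecₚ.lookup∘updateAt k₁ T ⟨
    lookup (dec k₁ T) k₁                      ≡⟨ lookup-inc-≢ (dec k₁ T) i≢ ⟨
    lookup (shift k T) k₁                     ∎
  ... | no i≢ | no i≢k₁ = begin
    lookup (type (suc N) v′) i                ≡⟨ lookup-type v′ i ⟩
    letters (size i) v′ ℕ./ size i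
      ≡⟨ cong (ℕ._/ size i) (letters-ins-≢ inj a
           (λ e → i≢k₁ (Finₚ.toℕ-injective (ℕₚ.suc-injective (trans (sym e) L≡size-k₁))))
           (λ e → i≢ (Finₚ.toℕ-injective (ℕₚ.suc-injective (trans (sym e) suc-L≡))))) ⟩
    letters (size i) v ℕ./ size i             ≡⟨ lookup-type v i ⟨
    lookup T i                                ≡⟨ lookup-dec-≢ T i≢k₁ ⟨
    lookup (dec k₁ T) i                       ≡⟨ lookup-inc-≢ (dec k₁ T) i≢ ⟨
    lookup (shift k T) i                      ∎

-- Counting permutations by cycle type

_≟ᵛ_ : DecidableEquality (Vec ℕ N)
_≟ᵛ_ = Vecₚ.≡-dec ℕ._≟_

zeros : ∀ N → Vec ℕ N
zeros N = Vec.replicate N 0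

weight-zeros : ∀ d N → weight d (zeros N) ≡ 0
weight-zeros d zero    = refl
weight-zeros d (suc N) = cong₂ ℕ._+_ (ℕₚ.*-zeroʳ d) (weight-zeros (suc d) N)

weight≡0 : ∀ d (u : Vec ℕ N) → weight d u ≡ 0 → u ≡ zeros N
weight≡0 d []      eq = refl
weight≡0 d (x ∷ u) eq = cong₂ _∷_
  (ℕₚ.m+n≡0⇒m≡0 x (ℕₚ.m+n≡0⇒m≡0 (suc d ℕ.* x) eq))
  (weight≡0 (suc d) u (ℕₚ.m+n≡0⇒n≡0 (suc d ℕ.* x) eq))

prob-zeros : ∀ d N → prob d (zeros N) ≡ 1ℚ
prob-zeros d zero    = refl
prob-zeros d (suc N) = trans (ℚₚ.*-identityˡ (prob (suc d) (zeros N))) (prob-zeros (suc d) N)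

∑-partitions-0 : ∀ N (F : Vec ℕ N → ℚ) → ∑ (partitions N 0) F ≡ F (zeros N)
∑-partitions-0 N F = trans
  (∑-cong∈ (partitions N 0) (λ {u} u∈ → sym (trans
    (*-congˡ (F u) (𝟙-yes (u ≟ᵛ zeros N) (weight≡0 0 u (∈-partitions⁻ u∈)))) (ℚₚ.*-identityʳ (F u)))))
  (∑-𝟙 _≟ᵛ_ F (partitions-unique N 0) (∈-partitions⁺ (weight-zeros 0 N)))

type-[] : ∀ N → type N [] ≡ zeros N
type-[] N = lookup-ext (λ k → trans (lookup-type [] k) (trans (DivMod.0/n≡0 (size k)) (sym (Vecₚ.lookup-replicate k 0))))

-- The new type depends on a only through the length of the cycle of a; grouping the letters by that
-- length gives the coefficients. The bound n ≤ N provides an index in `Fin N` for every length that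
-- occurs.
∑-type-ins : ∀ {v : Vec (Fin n) n} → Injective v → n ≤ N → (G : Vec ℕ (suc N) → ℚ) →
  ∑ (allFin n) (λ a → G (type (suc N) (ins (suc a) v))) ≡
  ∑ (allFin N) (λ k → ι (letters (size k) v) * G (shift k (type (suc N) v)))
∑-type-ins {n} {N} {v} inj n≤N G = begin
  ∑ (allFin n) (λ a → G (type (suc N) (ins (suc a) v)))
    ≡⟨ ∑-cong (allFin n) split ⟩
  ∑ (allFin n) (λ a → ∑ (allFin N) (λ k → 𝟙 (cycleLen v a ℕ.≟ size k) * g k))
    ≡⟨ ∑-swap (allFin n) (allFin N) (λ a k → 𝟙 (cycleLen v a ℕ.≟ size k) * g k) ⟩
  ∑ (allFin N) (λ k → ∑ (allFin n) (λ a → 𝟙 (cycleLen v a ℕ.≟ size k) * g k))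
    ≡⟨ ∑-cong (allFin N) (λ k → trans (∑-*ʳ (allFin n) (g k) (λ a → 𝟙 (cycleLen v a ℕ.≟ size k)))
                                      (*-congʳ (g k) (sym (ι-letters (size k) v)))) ⟩
  ∑ (allFin N) (λ k → ι (letters (size k) v) * g k) ∎
  where
  open ≡-Reasoning
  g : Fin N → ℚ
  g k = G (shift k (type (suc N) v))
  split : ∀ a → G (type (suc N) (ins (suc a) v)) ≡ ∑ (allFin N) (λ k → 𝟙 (cycleLen v a ℕ.≟ size k) * g k)
  split a with cycleLen v a in L≡ | proj₁ (cycleLen-isPeriod inj a) | proj₂ (cycleLen-isPeriod inj a)
  ... | zero  | P | _   = contradiction (positive P) λ ()
  ... | suc l | _ | l<n = begin
    G (type (suc N) (ins (suc a) v))                     ≡⟨ cong G (type-ins-suc inj a kₐ (trans L≡ (cong suc (sym toℕ-kₐ)))) ⟩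
    g kₐ                                                 ≡⟨ ∑-𝟙 Finₚ._≟_ g (Uniqueₚ.allFin⁺ N) (∈ₚ.∈-allFin kₐ) ⟨
    ∑ (allFin N) (λ k → g k * 𝟙 (k Finₚ.≟ kₐ))           ≡⟨ ∑-cong (allFin N) (λ k → trans (ℚₚ.*-comm (g k) (𝟙 (k Finₚ.≟ kₐ)))
                                                              (*-congʳ (g k) (𝟙-⇔ (k Finₚ.≟ kₐ) (suc l ℕ.≟ size k)
                                                                (λ { refl → cong suc (sym toℕ-kₐ) })
                                                                (λ e → Finₚ.toℕ-injective (trans (sym (ℕₚ.suc-injective e)) (sym toℕ-kₐ)))))) ⟩
    ∑ (allFin N) (λ k → 𝟙 (suc l ℕ.≟ size k) * g k)      ∎
    where
    l<N = ℕₚ.≤-trans l<n n≤N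
    kₐ = Fin.fromℕ< l<N
    toℕ-kₐ : toℕ kₐ ≡ l
    toℕ-kₐ = Finₚ.toℕ-fromℕ< l<N

biased-zero-* : ∀ (k : Fin N) (G : Vec ℕ N → ℚ) u → ¬ (1 ≤ lookup u k) → biased k u * G u ≡ 0ℚ
biased-zero-* k G u ¬1≤ = trans (*-congʳ (G u) (biased-zero k u ¬1≤)) (ℚₚ.*-zeroˡ (G u))

∑-biased-inc : ∀ N n (k : Fin N) (G : Vec ℕ N → ℚ) →
  ∑ (partitions N (size k ℕ.+ n)) (λ u → biased k u * G u) ≡ ∑ (partitions N n) (λ u → prob 0 u * G (inc k u))
∑-biased-inc N n k G = trans (∑-remove N n k (λ u → biased k u * G u) (biased-zero-* k G))
  (∑-cong (partitions N n) (λ u → *-congʳ (G (inc k u)) (biased-inc k u)))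

-- With j = `size k`, both sides equal the sum of p(u) G(u + e), u running over the partitions of n
-- - j and e being one part of size j + 1: the left side removes a part j and adds j + 1, the right
-- side removes j + 1. If j > n, both are empty.
∑-shift : ∀ N n (k : Fin N) (G : Vec ℕ (suc N) → ℚ) →
  ∑ (partitions (suc N) n) (λ u → biased (Fin.inject₁ k) u * G (shift k u)) ≡
  ∑ (partitions (suc N) (suc n)) (λ u → biased (suc k) u * G u)
∑-shift N n k G with size k ℕ.≤? n
... | yes k≤n = begin
  ∑ (partitions (suc N) n) (λ u → biased k₁ u * G (shift k u))
    ≡⟨ cong (λ l → ∑ (partitions (suc N) l) (λ u → biased k₁ u * G (shift k u))) n≡ ⟩
  ∑ (partitions (suc N) (size k₁ ℕ.+ m′)) (λ u → biased k₁ u * G (shift k u))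
    ≡⟨ ∑-biased-inc (suc N) m′ k₁ (G ∘ shift k) ⟩
  ∑ (partitions (suc N) m′) (λ u → prob 0 u * G (shift k (inc k₁ u)))
    ≡⟨ ∑-cong (partitions (suc N) m′) (λ u → cong (λ w → prob 0 u * G (inc (suc k) w)) (dec-inc k₁ u)) ⟩
  ∑ (partitions (suc N) m′) (λ u → prob 0 u * G (inc (suc k) u))
    ≡⟨ ∑-biased-inc (suc N) m′ (suc k) G ⟨
  ∑ (partitions (suc N) (size (suc k) ℕ.+ m′)) (λ u → biased (suc k) u * G u)
    ≡⟨ cong (λ l → ∑ (partitions (suc N) (suc l)) (λ u → biased (suc k) u * G u)) (ℕₚ.m+[n∸m]≡n k≤n) ⟩
  ∑ (partitions (suc N) (suc n)) (λ u → biased (suc k) u * G u) ∎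
  where
  open ≡-Reasoning
  k₁ = Fin.inject₁ k
  m′ = n ℕ.∸ size k
  n≡ : n ≡ size k₁ ℕ.+ m′
  n≡ = trans (sym (ℕₚ.m+[n∸m]≡n k≤n)) (cong (λ e → suc e ℕ.+ m′) (sym (Finₚ.toℕ-inject₁ k)))
... | no k≰n = trans
  (∑-remove-none (suc N) n k₁ (λ u → biased k₁ u * G (shift k u)) (biased-zero-* k₁ (G ∘ shift k))
    (subst (n ℕ.<_) (cong suc (sym (Finₚ.toℕ-inject₁ k))) (ℕₚ.≰⇒> k≰n)))
  (sym (∑-remove-none (suc N) (suc n) (suc k) (λ u → biased (suc k) u * G u) (biased-zero-* (suc k) G)
    (ℕ.s≤s (ℕₚ.≰⇒> k≰n))))
  where k₁ = Fin.inject₁ k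

-- With an indicator function for G: n! / z_u permutations of n letters have cycle type u.
∑-perms : ∀ n N → n ≤ N → (G : Vec ℕ N → ℚ) →
          ∑ (perms n) (λ v → G (type N v)) ≡ ι (n ℕ.!) * ∑ (partitions N n) (λ u → prob 0 u * G u)
∑-perms zero N n≤N G = begin
  G (type N []) + 0ℚ                    ≡⟨ ℚₚ.+-identityʳ (G (type N [])) ⟩
  G (type N [])                         ≡⟨ cong G (type-[] N) ⟩
  G (zeros N)                           ≡⟨ ℚₚ.*-identityˡ (G (zeros N)) ⟨
  1ℚ * G (zeros N)                      ≡⟨ *-congʳ (G (zeros N)) (prob-zeros 0 N) ⟨
  prob 0 (zeros N) * G (zeros N)        ≡⟨ ∑-partitions-0 N (λ u → prob 0 u * G u) ⟨
  S                                     ≡⟨ ℚₚ.*-identityˡ S ⟨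
  1ℚ * S                                ≡⟨ *-congʳ S ι-1 ⟨
  ι 1 * S                               ∎
  where open ≡-Reasoning
        S = ∑ (partitions N 0) (λ u → prob 0 u * G u)
∑-perms (suc n) (suc N) (ℕ.s≤s n≤N) G = begin
  ∑ (perms (suc n)) (G ∘ T)
    ≡⟨ ∑-↭ (perms-↭ n) (G ∘ T) ⟩
  ∑ (cartesianProductWith ins (allFin (suc n)) (perms n)) (G ∘ T)
    ≡⟨ ∑-cartesianProductWith ins (allFin (suc n)) (perms n) (G ∘ T) ⟩
  ∑ (allFin (suc n)) (λ x → ∑ (perms n) (λ v → G (T (ins x v))))
    ≡⟨ ∑-allFin-suc n (λ x → ∑ (perms n) (λ v → G (T (ins x v)))) ⟩
  ∑ (perms n) (λ v → G (T (ins zero v))) + ∑ (allFin n) (λ a → ∑ (perms n) (λ v → G (T (ins (suc a) v))))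
    ≡⟨ +-congˡ (∑ (perms n) (λ v → G (T (ins zero v)))) (∑-swap (allFin n) (perms n) (λ a v → G (T (ins (suc a) v)))) ⟩
  ∑ (perms n) (λ v → G (T (ins zero v))) + ∑ (perms n) (λ v → ∑ (allFin n) (λ a → G (T (ins (suc a) v))))
    ≡⟨ ∑-+ (perms n) (λ v → G (T (ins zero v))) (λ v → ∑ (allFin n) (λ a → G (T (ins (suc a) v)))) ⟨
  ∑ (perms n) (λ v → G (T (ins zero v)) + ∑ (allFin n) (λ a → G (T (ins (suc a) v))))
    ≡⟨ ∑-cong∈ (perms n) (λ v∈ → insert (∈-perms⁻ v∈)) ⟩
  ∑ (perms n) (λ v → H (type (suc N) v))
    ≡⟨ ∑-perms n (suc N) (ℕₚ.m≤n⇒m≤1+n n≤N) H ⟩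
  ι (n ℕ.!) * ∑ (partitions (suc N) n) (λ u → prob 0 u * H u)
    ≡⟨ *-congˡ (ι (n ℕ.!)) reindex ⟩
  ι (n ℕ.!) * (ι (suc n) * S)
    ≡⟨ solve 3 (λ a b c → a :* (b :* c) := (b :* a) :* c) refl (ι (n ℕ.!)) (ι (suc n)) S ⟩
  ι (suc n) * ι (n ℕ.!) * S
    ≡⟨ *-congʳ S (ι-* (suc n) (n ℕ.!)) ⟨
  ι (suc n ℕ.!) * S ∎
  where
  open ≡-Reasoning
  T : ∀ {m} → Vec (Fin m) m → Vec ℕ (suc N)
  T = type (suc N)
  S = ∑ (partitions (suc N) (suc n)) (λ u → prob 0 u * G u)
  h : Fin N → Vec ℕ (suc N) → ℚ
  h k u = ι (size (Fin.inject₁ k) ℕ.* lookup u (Fin.inject₁ k)) * G (shift k u)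
  -- The sum of G over all ways to insert a letter into a permutation of type u: one new fixed
  -- point, or a place before any letter of a cycle of length `size (Fin.inject₁ k)`.
  H : Vec ℕ (suc N) → ℚ
  H u = G (inc zero u) + ∑ (allFin N) (λ k → h k u)

  insert : ∀ {v} → Injective v → G (T (ins zero v)) + ∑ (allFin n) (λ a → G (T (ins (suc a) v))) ≡ H (T v)
  insert {v} inj = cong₂ ℚ._+_ (cong G (type-ins-zero inj)) (trans (∑-type-ins inj n≤N G)
    (∑-cong (allFin N) (λ k → *-congʳ (G (shift k (T v))) (cong ι
      (trans (cong (λ e → letters (suc e) v) (sym (Finₚ.toℕ-inject₁ k))) (sym (size*type inj (Fin.inject₁ k))))))))

  b : Fin (suc N) → Vec ℕ (suc N) → ℚ
  b k u = biased k u * G u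

  expand : ∀ u → prob 0 u * H u ≡ prob 0 u * G (inc zero u) + ∑ (allFin N) (λ k → biased (Fin.inject₁ k) u * G (shift k u))
  expand u = trans (ℚₚ.*-distribˡ-+ (prob 0 u) (G (inc zero u)) (∑ (allFin N) (λ k → h k u)))
    (+-congˡ (prob 0 u * G (inc zero u)) (trans (sym (∑-*ˡ (allFin N) (prob 0 u) (λ k → h k u)))
      (∑-cong (allFin N) (λ k → solve 3 (λ a b c → a :* (b :* c) := (b :* a) :* c) refl
        (prob 0 u) (ι (size (Fin.inject₁ k) ℕ.* lookup u (Fin.inject₁ k))) (G (shift k u))))))

  -- The new fixed point becomes the removal of a part of size 1 and the k-th shift the removal of a
  -- part of size `size (suc k)`; together these are all removals from partitions of n + 1, and
  -- `∑-biased` adds them up to the factor n + 1.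
  reindex : ∑ (partitions (suc N) n) (λ u → prob 0 u * H u) ≡ ι (suc n) * S
  reindex = begin
    ∑ (partitions (suc N) n) (λ u → prob 0 u * H u)
      ≡⟨ ∑-cong (partitions (suc N) n) expand ⟩
    ∑ (partitions (suc N) n) (λ u → prob 0 u * G (inc zero u) + ∑ (allFin N) (λ k → biased (Fin.inject₁ k) u * G (shift k u)))
      ≡⟨ ∑-+ (partitions (suc N) n) (λ u → prob 0 u * G (inc zero u)) (λ u → ∑ (allFin N) (λ k → biased (Fin.inject₁ k) u * G (shift k u))) ⟩
    ∑ (partitions (suc N) n) (λ u → prob 0 u * G (inc zero u)) +
    ∑ (partitions (suc N) n) (λ u → ∑ (allFin N) (λ k → biased (Fin.inject₁ k) u * G (shift k u)))
      ≡⟨ cong₂ ℚ._+_ (sym (∑-biased-inc (suc N) n zero G))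
           (trans (∑-swap (partitions (suc N) n) (allFin N) (λ u k → biased (Fin.inject₁ k) u * G (shift k u)))
                  (∑-cong (allFin N) (λ k → ∑-shift N n k G))) ⟩
    ∑ (partitions (suc N) (suc n)) (b zero) + ∑ (allFin N) (λ k → ∑ (partitions (suc N) (suc n)) (b (suc k)))
      ≡⟨ ∑-allFin-suc N (λ k → ∑ (partitions (suc N) (suc n)) (b k)) ⟨
    ∑ (allFin (suc N)) (λ k → ∑ (partitions (suc N) (suc n)) (b k))
      ≡⟨ ∑-swap (allFin (suc N)) (partitions (suc N) (suc n)) b ⟩
    ∑ (partitions (suc N) (suc n)) (λ u → ∑ (allFin (suc N)) (λ k → b k u))
      ≡⟨ ∑-cong∈ (partitions (suc N) (suc n)) (λ {u} u∈ → begin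
           ∑ (allFin (suc N)) (λ k → biased k u * G u)
             ≡⟨ ∑-*ʳ (allFin (suc N)) (G u) (λ k → biased k u) ⟩
           ∑ (allFin (suc N)) (λ k → biased k u) * G u
             ≡⟨ *-congʳ (G u) (trans (∑-biased u) (cong (λ e → ι e * prob 0 u) (∈-partitions⁻ u∈))) ⟩
           ι (suc n) * prob 0 u * G u
             ≡⟨ ℚₚ.*-assoc (ι (suc n)) (prob 0 u) (G u) ⟩
           ι (suc n) * (prob 0 u * G u) ∎) ⟩
    ∑ (partitions (suc N) (suc n)) (λ u → ι (suc n) * (prob 0 u * G u))
      ≡⟨ ∑-*ˡ (partitions (suc N) (suc n)) (ι (suc n)) (λ u → prob 0 u * G u) ⟩
    ι (suc n) * S ∎

-- From tuples of permutations to sums over partitions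

==L⇒≡ : ∀ xs ys → (xs ==L ys) ≡ true → xs ≡ ys
==L⇒≡ []       []       eq = refl
==L⇒≡ (x ∷ xs) (y ∷ ys) eq with e₁ , e₂ ← ∧-true⁻ {x ℕ.≡ᵇ y} eq =
  cong₂ _∷_ (ℕₚ.≡ᵇ⇒≡ x y (subst Bool.T (sym e₁) _)) (==L⇒≡ xs ys e₂)

==L-refl : ∀ xs → (xs ==L xs) ≡ true
==L-refl []       = refl
==L-refl (x ∷ xs) = trans (cong (Bool._∧ (xs ==L xs)) (T⇒true (ℕₚ.≡⇒≡ᵇ x x refl))) (==L-refl xs)
  where
  T⇒true : ∀ {b} → Bool.T b → b ≡ true
  T⇒true {true} _ = refl

map-≡⁻ : ∀ {f g : A → B} xs → map f xs ≡ map g xs → ∀ {x} → x ∈ xs → f x ≡ g x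
map-≡⁻ (x ∷ xs) eq (here refl) = Listₚ.∷-injectiveˡ eq
map-≡⁻ (x ∷ xs) eq (there x∈)  = map-≡⁻ xs (Listₚ.∷-injectiveʳ eq) x∈

map-≡⁺ : ∀ {f g : A → B} xs → (∀ {x} → x ∈ xs → f x ≡ g x) → map f xs ≡ map g xs
map-≡⁺ []       eq = refl
map-≡⁺ (x ∷ xs) eq = cong₂ _∷_ (eq (here refl)) (map-≡⁺ xs (eq ∘ there))

letters-> : ∀ {v : Vec (Fin n) n} {k} → Injective v → n ℕ.< k → letters k v ≡ 0
letters-> {n} {v} {k} inj n<k = ι-injective (trans (ι-letters k v) (trans
  (∑-cong (allFin n) (λ i → 𝟙-no (cycleLen v i ℕ.≟ k) (λ { refl → ℕₚ.<⇒≱ n<k (proj₂ (cycleLen-isPeriod inj i)) })))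
  (trans (∑-zero (allFin n)) (sym ι-0))))

-- `cycleType` records lengths up to n only; beyond n both types vanish by `letters->`.
cycleType≡⇒type≡ : ∀ {u v : Vec (Fin n) n} → Injective u → Injective v → cycleType u ≡ cycleType v → type N u ≡ type N v
cycleType≡⇒type≡ {n} {N} {u} {v} u-inj v-inj eq = lookup-ext (λ k → trans (lookup-type u k) (trans (lem k) (sym (lookup-type v k))))
  where
  lem : ∀ (k : Fin N) → letters (size k) u ℕ./ size k ≡ letters (size k) v ℕ./ size k
  lem k with toℕ k ℕ.<? n
  ... | yes k<n = map-≡⁻ (upTo n) eq (∈ₚ.∈-upTo⁺ k<n)
  ... | no k≮n  = cong (ℕ._/ size k) (trans (letters-> u-inj n<k) (sym (letters-> v-inj n<k)))
    where n<k = ℕ.s≤s (ℕₚ.≮⇒≥ k≮n)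

type≡⇒cycleType≡ : ∀ {u v : Vec (Fin n) n} → n ≤ N → type N u ≡ type N v → cycleType u ≡ cycleType v
type≡⇒cycleType≡ {n} {N} {u} {v} n≤N eq = map-≡⁺ (upTo n) (λ {j} j∈ → lem (ℕₚ.<-≤-trans (∈ₚ.∈-upTo⁻ j∈) n≤N))
  where
  lem : ∀ {j} → j ℕ.< N → letters (suc j) u ℕ./ suc j ≡ letters (suc j) v ℕ./ suc j
  lem {j} j<N = subst (λ e → letters (suc e) u ℕ./ suc e ≡ letters (suc e) v ℕ./ suc e) (Finₚ.toℕ-fromℕ< j<N)
    (trans (sym (lookup-type u k)) (trans (cong (λ w → lookup w k) eq) (lookup-type v k)))
    where k = Fin.fromℕ< j<N

𝟙-∧ : ∀ a b → 𝟙 ((a Bool.∧ b) Bool.≟ true) ≡ 𝟙 (a Bool.≟ true) * 𝟙 (b Bool.≟ true)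
𝟙-∧ true  b = sym (ℚₚ.*-identityˡ (𝟙 (b Bool.≟ true)))
𝟙-∧ false b = sym (ℚₚ.*-zeroˡ (𝟙 (b Bool.≟ true)))

-- The condition is imposed on each component separately, so the count of tuples is a power.
∑-tuples : ∀ n r (f : Vec (Fin n) n → Bool) →
           ∑ (tuples n r) (λ τs → 𝟙 (allB f τs Bool.≟ true)) ≡ ∑ (perms n) (λ τ → 𝟙 (f τ Bool.≟ true)) ^ℚ r
∑-tuples n zero    f = refl
∑-tuples n (suc r) f = begin
  ∑ (tuples n (suc r)) (λ τs → 𝟙 (allB f τs Bool.≟ true))
    ≡⟨ ∑-concatMap (λ σ → map (σ ∷_) (tuples n r)) (perms n) (λ τs → 𝟙 (allB f τs Bool.≟ true)) ⟩
  ∑ (perms n) (λ σ → ∑ (map (σ ∷_) (tuples n r)) (λ τs → 𝟙 (allB f τs Bool.≟ true)))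
    ≡⟨ ∑-cong (perms n) (λ σ → trans (∑-map (σ ∷_) (tuples n r) (λ τs → 𝟙 (allB f τs Bool.≟ true)))
         (trans (∑-cong (tuples n r) (λ τs → 𝟙-∧ (f σ) (allB f τs)))
         (trans (∑-*ˡ (tuples n r) (𝟙 (f σ Bool.≟ true)) (λ τs → 𝟙 (allB f τs Bool.≟ true)))
                (*-congˡ (𝟙 (f σ Bool.≟ true)) (∑-tuples n r f))))) ⟩
  ∑ (perms n) (λ σ → 𝟙 (f σ Bool.≟ true) * c ^ℚ r)
    ≡⟨ ∑-*ʳ (perms n) (c ^ℚ r) (λ σ → 𝟙 (f σ Bool.≟ true)) ⟩
  c * c ^ℚ r ∎
  where open ≡-Reasoning
        c = ∑ (perms n) (λ τ → 𝟙 (f τ Bool.≟ true))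

count-type : ∀ n N → n ≤ N → ∀ {u} → u ∈ partitions N n →
             ∑ (perms n) (λ v → 𝟙 (type N v ≟ᵛ u)) ≡ ι (n ℕ.!) * prob 0 u
count-type n N n≤N {u} u∈ = trans (∑-perms n N n≤N (λ w → 𝟙 (w ≟ᵛ u)))
  (*-congˡ (ι (n ℕ.!)) (∑-𝟙 _≟ᵛ_ (prob 0) (partitions-unique N n) u∈))

-- The first permutation fixes the type u and each of the other r has n! p(u) choices. Summing over
-- the first one contributes another n! p(u) for each u.
count-sameType : ∀ n N r → n ≤ N →
  ι (length (filter (λ t → sameType t Bool.≟ true) (tuples n (suc r)))) ≡
  ι ((n ℕ.!) ^ suc r) * ∑ (partitions N n) (λ u → prob 0 u ^ℚ suc r)
count-sameType n N r n≤N = begin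
  ι (length (filter (λ t → sameType t Bool.≟ true) (tuples n (suc r))))
    ≡⟨ ι-length-filter (λ t → sameType t Bool.≟ true) (tuples n (suc r)) ⟩
  ∑ (tuples n (suc r)) (λ t → 𝟙 (sameType t Bool.≟ true))
    ≡⟨ ∑-concatMap (λ σ → map (σ ∷_) (tuples n r)) (perms n) (λ t → 𝟙 (sameType t Bool.≟ true)) ⟩
  ∑ (perms n) (λ σ → ∑ (map (σ ∷_) (tuples n r)) (λ t → 𝟙 (sameType t Bool.≟ true)))
    ≡⟨ ∑-cong (perms n) (λ σ → trans (∑-map (σ ∷_) (tuples n r) (λ t → 𝟙 (sameType t Bool.≟ true)))
                                     (∑-tuples n r (λ τ → cycleType σ ==L cycleType τ))) ⟩
  ∑ (perms n) (λ σ → ∑ (perms n) (λ τ → 𝟙 ((cycleType σ ==L cycleType τ) Bool.≟ true)) ^ℚ r)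
    ≡⟨ ∑-cong∈ (perms n) (λ σ∈ → cong (_^ℚ r) (∑-cong∈ (perms n) (λ τ∈ → same (∈-perms⁻ σ∈) (∈-perms⁻ τ∈)))) ⟩
  ∑ (perms n) (λ σ → c (type N σ) ^ℚ r)
    ≡⟨ ∑-perms n N n≤N (λ u → c u ^ℚ r) ⟩
  ι (n ℕ.!) * ∑ (partitions N n) (λ u → prob 0 u * c u ^ℚ r)
    ≡⟨ *-congˡ (ι (n ℕ.!)) (∑-cong∈ (partitions N n) (λ {u} u∈ → powers u (count-type n N n≤N u∈))) ⟩
  ι (n ℕ.!) * ∑ (partitions N n) (λ u → ι (n ℕ.!) ^ℚ r * prob 0 u ^ℚ suc r)
    ≡⟨ *-congˡ (ι (n ℕ.!)) (∑-*ˡ (partitions N n) (ι (n ℕ.!) ^ℚ r) (λ u → prob 0 u ^ℚ suc r)) ⟩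
  ι (n ℕ.!) * (ι (n ℕ.!) ^ℚ r * S)
    ≡⟨ ℚₚ.*-assoc (ι (n ℕ.!)) (ι (n ℕ.!) ^ℚ r) S ⟨
  ι (n ℕ.!) ^ℚ suc r * S
    ≡⟨ *-congʳ S (ι-^ (n ℕ.!) (suc r)) ⟨
  ι ((n ℕ.!) ^ suc r) * S ∎
  where
  open ≡-Reasoning
  S = ∑ (partitions N n) (λ u → prob 0 u ^ℚ suc r)
  c : Vec ℕ N → ℚ
  c u = ∑ (perms n) (λ τ → 𝟙 (type N τ ≟ᵛ u))
  same : ∀ {σ τ} → Injective σ → Injective τ →
         𝟙 ((cycleType σ ==L cycleType τ) Bool.≟ true) ≡ 𝟙 (type N τ ≟ᵛ type N σ)
  same {σ} {τ} σ-inj τ-inj = 𝟙-⇔ ((cycleType σ ==L cycleType τ) Bool.≟ true) (type N τ ≟ᵛ type N σ)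
    (λ e → cycleType≡⇒type≡ τ-inj σ-inj (sym (==L⇒≡ (cycleType σ) (cycleType τ) e)))
    (λ e → subst (λ xs → (cycleType σ ==L xs) ≡ true) (type≡⇒cycleType≡ {u = σ} {τ} n≤N (sym e)) (==L-refl (cycleType σ)))
  powers : ∀ u → c u ≡ ι (n ℕ.!) * prob 0 u → prob 0 u * c u ^ℚ r ≡ ι (n ℕ.!) ^ℚ r * prob 0 u ^ℚ suc r
  powers u eq = trans (cong (λ x → prob 0 u * x ^ℚ r) eq) (trans (*-congˡ (prob 0 u) (Exp.^-distrib-* (ι (n ℕ.!)) (prob 0 u) r))
    (solve 3 (λ a b c → a :* (b :* c) := b :* (a :* c)) refl (prob 0 u) (ι (n ℕ.!) ^ℚ r) (prob 0 u ^ℚ r)))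

1^ : ∀ r → 1ℚ ^ℚ r ≡ 1ℚ
1^ zero    = refl
1^ (suc r) = trans (ℚₚ.*-identityˡ (1ℚ ^ℚ r)) (1^ r)

-- The conventional value 1 at n = 0 agrees with the empty partition. The free N lets W_r(m) for all
-- m < n be expressed by vectors of the common length n.
W≡∑ : ∀ r n N → n ≤ N → W (suc r) n ≡ ∑ (partitions N n) (λ u → prob 0 u ^ℚ suc r)
W≡∑ r zero N n≤N = sym (trans (∑-partitions-0 N (λ u → prob 0 u ^ℚ suc r))
  (trans (cong (_^ℚ suc r) (prob-zeros 0 N)) (1^ (suc r))))
W≡∑ r n@(suc _) N n≤N = *-cancelˡ-nonZero ((n ℕ.!) ^ suc r) {{nz}}
  (trans (ι-*-/ _ ((n ℕ.!) ^ suc r) {{nz}}) (count-sameType n N r n≤N))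
  where
  nz = ℕₚ.m^n≢0 (n ℕ.!) (suc r) {{n ℕₚ.!≢0}}
  *-cancelˡ-nonZero : ∀ m .{{_ : ℕ.NonZero m}} {p q} → ι m * p ≡ ι m * q → p ≡ q
  *-cancelˡ-nonZero (suc m) eq = *-cancelˡ-suc m eq

-- Powers of sums and convolutions

p≤q⇒0≤q-p : ∀ {p q} → p ℚ.≤ q → 0ℚ ℚ.≤ q - p
p≤q⇒0≤q-p {p} {q} p≤q = subst (ℚ._≤ q - p) (ℚₚ.+-inverseʳ p) (ℚₚ.+-monoˡ-≤ (ℚ.- p) p≤q)

-- In closed form (r + 1) b^r; the recurrence is the one produced by the induction in `^≤∑-^`.
slack : ℕ → ℕ → ℕ
slack b zero    = 1
slack b (suc r) = b ℕ.* slack b r ℕ.+ b ^ suc r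

module Powers (xs : List A) (a : A → ℚ) (0≤a : ∀ x → 0ℚ ℚ.≤ a x) where

  private
    Σa = ∑ xs a

  0≤Σa : 0ℚ ℚ.≤ Σa
  0≤Σa = 0≤∑ xs 0≤a

  -- The off-diagonal part of the square of Σ a: the sum of all products taken at two distinct
  -- positions.
  defect : ℚ
  defect = ∑ xs (λ x → (Σa - a x) * a x)

  0≤Σa-a : ∀ {x} → x ∈ xs → 0ℚ ℚ.≤ Σa - a x
  0≤Σa-a {x} x∈ = p≤q⇒0≤q-p (term≤∑ a 0≤a x∈)

  0≤defect : 0ℚ ℚ.≤ defect
  0≤defect = subst (ℚ._≤ defect) (∑-zero xs) (∑-mono∈ xs (λ {x} x∈ → 0≤* (0≤Σa-a x∈) (0≤a x)))

  Σa²≡ : Σa * Σa ≡ ∑ xs (λ x → a x * a x) + defect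
  Σa²≡ = begin
    Σa * Σa                                             ≡⟨ ∑-*ˡ xs Σa a ⟨
    ∑ xs (λ x → Σa * a x)                               ≡⟨ ∑-cong xs (λ x → solve 2 (λ s y → s :* y := y :* y :+ (s :- y) :* y) refl Σa (a x)) ⟩
    ∑ xs (λ x → a x * a x + (Σa - a x) * a x)           ≡⟨ ∑-+ xs (λ x → a x * a x) (λ x → (Σa - a x) * a x) ⟩
    ∑ xs (λ x → a x * a x) + defect                     ∎
    where open ≡-Reasoning

  ∑-^≤^ : ∀ r → ∑ xs (λ x → a x ^ℚ suc r) ℚ.≤ Σa ^ℚ suc r
  ∑-^≤^ r = begin
    ∑ xs (λ x → a x * a x ^ℚ r)  ≤⟨ ∑-mono∈ xs (λ {x} x∈ → *-monoʳ (0≤a x) (^-mono r (0≤a x) (term≤∑ a 0≤a x∈))) ⟩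
    ∑ xs (λ x → a x * Σa ^ℚ r)   ≡⟨ ∑-*ʳ xs (Σa ^ℚ r) a ⟩
    Σa * Σa ^ℚ r                 ∎
    where open ℚₚ.≤-Reasoning

  module _ (b : ℕ) (Σa≤b : Σa ℚ.≤ ι b) where

    -- Each further factor Σ a multiplies the old error by at most b and creates new cross terms,
    -- which are products from `defect` times a power of at most b.
    ^≤∑-^ : ∀ r → Σa ^ℚ suc (suc r) ℚ.≤ ∑ xs (λ x → a x ^ℚ suc (suc r)) + ι (slack b r) * defect
    ^≤∑-^ zero = ℚₚ.≤-reflexive (begin
      Σa * (Σa * 1ℚ)                                  ≡⟨ *-congˡ Σa (ℚₚ.*-identityʳ Σa) ⟩
      Σa * Σa                                         ≡⟨ Σa²≡ ⟩
      ∑ xs (λ x → a x * a x) + defect                 ≡⟨ cong₂ ℚ._+_ (∑-cong xs (λ x → *-congˡ (a x) (sym (ℚₚ.*-identityʳ (a x)))))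
                                                           (trans (sym (ℚₚ.*-identityˡ defect)) (*-congʳ defect (sym ι-1))) ⟩
      ∑ xs (λ x → a x * (a x * 1ℚ)) + ι 1 * defect    ∎)
      where open ≡-Reasoning
    ^≤∑-^ (suc r) = begin
      Σa * Σa ^ℚ s
        ≤⟨ *-monoʳ 0≤Σa (^≤∑-^ r) ⟩
      Σa * (∑ xs (λ x → a x ^ℚ s) + c * defect)
        ≡⟨ ℚₚ.*-distribˡ-+ Σa (∑ xs (λ x → a x ^ℚ s)) (c * defect) ⟩
      Σa * ∑ xs (λ x → a x ^ℚ s) + Σa * (c * defect)
        ≤⟨ ℚₚ.+-mono-≤ first (*-monoˡ (0≤* (0≤ι (slack b r)) 0≤defect) Σa≤b) ⟩
      ∑ xs (λ x → a x ^ℚ suc s) + ι b ^ℚ suc r * defect + ι b * (c * defect)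
        ≡⟨ solve 5 (λ x y d b c → x :+ y :* d :+ b :* (c :* d) := x :+ (b :* c :+ y) :* d) refl
             (∑ xs (λ x → a x ^ℚ suc s)) (ι b ^ℚ suc r) defect (ι b) c ⟩
      ∑ xs (λ x → a x ^ℚ suc s) + (ι b * c + ι b ^ℚ suc r) * defect
        ≡⟨ cong (λ t → ∑ xs (λ x → a x ^ℚ suc s) + t * defect)
             (sym (trans (ι-+ (b ℕ.* slack b r) (b ^ suc r)) (cong₂ ℚ._+_ (ι-* b (slack b r)) (ι-^ b (suc r))))) ⟩
      ∑ xs (λ x → a x ^ℚ suc s) + ι (slack b (suc r)) * defect ∎
      where
      open ℚₚ.≤-Reasoning
      s = suc (suc r)
      c = ι (slack b r)
      a≤b : ∀ {x} → x ∈ xs → a x ℚ.≤ ι b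
      a≤b x∈ = ℚₚ.≤-trans (term≤∑ a 0≤a x∈) Σa≤b
      -- Σa · y^s = y^(s+1) + (Σa - y) y · y^(s-1) with y = a x; the last power is bounded by that
      -- of b, and what remains sums to `defect`.
      first : Σa * ∑ xs (λ x → a x ^ℚ s) ℚ.≤ ∑ xs (λ x → a x ^ℚ suc s) + ι b ^ℚ suc r * defect
      first = begin
        Σa * ∑ xs (λ x → a x ^ℚ s)
          ≡⟨ ∑-*ˡ xs Σa (λ x → a x ^ℚ s) ⟨
        ∑ xs (λ x → Σa * a x ^ℚ s)
          ≡⟨ ∑-cong xs (λ x → solve 3 (λ s y z → s :* (y :* z) := y :* (y :* z) :+ ((s :- y) :* y) :* z) refl Σa (a x) (a x ^ℚ suc r)) ⟩
        ∑ xs (λ x → a x ^ℚ suc s + (Σa - a x) * a x * a x ^ℚ suc r)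
          ≤⟨ ∑-mono∈ xs (λ {x} x∈ → ℚₚ.+-monoʳ-≤ (a x ^ℚ suc s)
               (*-monoʳ (0≤* (0≤Σa-a x∈) (0≤a x)) (^-mono (suc r) (0≤a x) (a≤b x∈)))) ⟩
        ∑ xs (λ x → a x ^ℚ suc s + (Σa - a x) * a x * ι b ^ℚ suc r)
          ≡⟨ ∑-+ xs (λ x → a x ^ℚ suc s) (λ x → (Σa - a x) * a x * ι b ^ℚ suc r) ⟩
        ∑ xs (λ x → a x ^ℚ suc s) + ∑ xs (λ x → (Σa - a x) * a x * ι b ^ℚ suc r)
          ≡⟨ +-congˡ (∑ xs (λ x → a x ^ℚ suc s)) (trans (∑-*ʳ xs (ι b ^ℚ suc r) (λ x → (Σa - a x) * a x)) (ℚₚ.*-comm defect (ι b ^ℚ suc r))) ⟩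
        ∑ xs (λ x → a x ^ℚ suc s) + ι b ^ℚ suc r * defect ∎

-- (f ⊛ u) n = Σ f(i) u(j) over i + j + 1 = n.
infixl 7 _⊛_
_⊛_ : (ℕ → ℚ) → (ℕ → ℚ) → ℕ → ℚ
(f ⊛ u) zero    = 0ℚ
(f ⊛ u) (suc n) = f 0 * u n + ((f ∘ suc) ⊛ u) n

⊛-monoˡ : ∀ {f g u} → (∀ i → f i ℚ.≤ g i) → (∀ i → 0ℚ ℚ.≤ u i) → ∀ n → (f ⊛ u) n ℚ.≤ (g ⊛ u) n
⊛-monoˡ f≤g 0≤u zero    = ℚₚ.≤-refl
⊛-monoˡ f≤g 0≤u (suc n) = ℚₚ.+-mono-≤ (*-monoˡ (0≤u n) (f≤g 0)) (⊛-monoˡ (f≤g ∘ suc) 0≤u n)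

⊛-linear : ∀ c f g u n → ((λ i → c * f i + g i) ⊛ u) n ≡ c * (f ⊛ u) n + (g ⊛ u) n
⊛-linear c f g u zero    = solve 1 (λ c → con 0ℚ := c :* con 0ℚ :+ con 0ℚ) refl c
⊛-linear c f g u (suc n) = trans (+-congˡ ((c * f 0 + g 0) * u n) (⊛-linear c (f ∘ suc) (g ∘ suc) u n))
  (solve 6 (λ c f g u x y → (c :* f :+ g) :* u :+ (c :* x :+ y) := c :* (f :* u :+ x) :+ (g :* u :+ y)) refl
    c (f 0) (g 0) (u n) (((f ∘ suc) ⊛ u) n) (((g ∘ suc) ⊛ u) n))

⊛-assoc : ∀ f g u n → (f ⊛ g ⊛ u) n ≡ (f ⊛ (g ⊛ u)) n
⊛-assoc f g u zero    = refl
⊛-assoc f g u (suc n) = begin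
  0ℚ * u n + ((λ i → f 0 * g i + ((f ∘ suc) ⊛ g) i) ⊛ u) n
    ≡⟨ trans (+-congʳ _ (ℚₚ.*-zeroˡ (u n))) (ℚₚ.+-identityˡ (((λ i → f 0 * g i + ((f ∘ suc) ⊛ g) i) ⊛ u) n)) ⟩
  ((λ i → f 0 * g i + ((f ∘ suc) ⊛ g) i) ⊛ u) n
    ≡⟨ ⊛-linear (f 0) g ((f ∘ suc) ⊛ g) u n ⟩
  f 0 * (g ⊛ u) n + ((f ∘ suc) ⊛ g ⊛ u) n
    ≡⟨ +-congˡ (f 0 * (g ⊛ u) n) (⊛-assoc (f ∘ suc) g u n) ⟩
  f 0 * (g ⊛ u) n + ((f ∘ suc) ⊛ (g ⊛ u)) n ∎
  where open ≡-Reasoning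

-- before u n k = u (n - (k + 1)), or 0 when n ≤ k.
before : (ℕ → ℚ) → ℕ → ℕ → ℚ
before u zero    k       = 0ℚ
before u (suc n) zero    = u n
before u (suc n) (suc k) = before u n k

before-+ : ∀ u k m → before u (suc k ℕ.+ m) k ≡ u m
before-+ u zero    m = refl
before-+ u (suc k) m = before-+ u k m

before-≤ : ∀ u {n k} → n ≤ k → before u n k ≡ 0ℚ
before-≤ u {zero}              _          = refl
before-≤ u {suc n} {suc k} (ℕ.s≤s n≤k) = before-≤ u n≤k

before-mono : ∀ {u u′} n k → (∀ {m} → m ℕ.< n → u m ℚ.≤ u′ m) → before u n k ℚ.≤ before u′ n k
before-mono zero    k       le = ℚₚ.≤-refl
before-mono (suc n) zero    le = le (ℕₚ.n<1+n n)
before-mono (suc n) (suc k) le = before-mono n k (le ∘ ℕₚ.m<n⇒m<1+n)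

before-cong : ∀ {u u′} n k → (∀ {m} → m ℕ.< n → u m ≡ u′ m) → before u n k ≡ before u′ n k
before-cong n k eq = ℚₚ.≤-antisym (before-mono n k (ℚₚ.≤-reflexive ∘ eq)) (before-mono n k (ℚₚ.≤-reflexive ∘ sym ∘ eq))

before-*ˡ : ∀ c u n k → before (λ m → c * u m) n k ≡ c * before u n k
before-*ˡ c u zero    k       = sym (ℚₚ.*-zeroʳ c)
before-*ˡ c u (suc n) zero    = refl
before-*ˡ c u (suc n) (suc k) = before-*ˡ c u n k

before-∑ : ∀ (xs : List A) (u : A → ℕ → ℚ) n k → before (λ m → ∑ xs (λ x → u x m)) n k ≡ ∑ xs (λ x → before (u x) n k)
before-∑ xs u zero    k       = sym (∑-zero xs)
before-∑ xs u (suc n) zero    = refl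
before-∑ xs u (suc n) (suc k) = before-∑ xs u n k

∑-before : ∀ {N} n g u → n ≤ N → ∑ (allFin N) (λ k → g (toℕ k) * before u n (toℕ k)) ≡ (g ⊛ u) n
∑-before {N} zero g u n≤N = trans (∑-cong (allFin N) (λ k → ℚₚ.*-zeroʳ (g (toℕ k)))) (∑-zero (allFin N))
∑-before {suc N} (suc n) g u (ℕ.s≤s n≤N) = trans
  (∑-allFin-suc N (λ k → g (toℕ k) * before u (suc n) (toℕ k)))
  (+-congˡ (g 0 * u n) (∑-before n (g ∘ suc) u n≤N))

-- The default value 0 of `before` is the correct one when the part exceeds n, so both cases of
-- removal fit into one formula.
∑-remove-before : ∀ N n (k : Fin N) (F : Vec ℕ N → ℚ) → (∀ v → ¬ (1 ≤ lookup v k) → F v ≡ 0ℚ) →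
                  ∑ (partitions N n) F ≡ before (λ m → ∑ (partitions N m) (F ∘ inc k)) n (toℕ k)
∑-remove-before N n k F F≡0 with size k ℕ.≤? n
... | yes k≤n = subst (λ l → ∑ (partitions N l) F ≡ before (λ m → ∑ (partitions N m) (F ∘ inc k)) l (toℕ k))
  (ℕₚ.m+[n∸m]≡n k≤n)
  (trans (∑-remove N (n ℕ.∸ size k) k F F≡0) (sym (before-+ (λ m → ∑ (partitions N m) (F ∘ inc k)) (toℕ k) (n ℕ.∸ size k))))
... | no k≰n = trans (∑-remove-none N n k F F≡0 (ℕₚ.≰⇒> k≰n))
  (sym (before-≤ (λ m → ∑ (partitions N m) (F ∘ inc k)) (ℕ.s≤s⁻¹ (ℕₚ.≰⇒> k≰n))))

partialSum≡⊛ : ∀ r n → partialSum r n ≡ ((λ _ → 1ℚ) ⊛ W r) n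
partialSum≡⊛ r zero    = refl
partialSum≡⊛ r (suc n) = trans (cong (λ p → p + W r n) (partialSum≡⊛ r n))
  (solve 2 (λ x y → x :+ y := con 1ℚ :* y :+ x) refl (((λ _ → 1ℚ) ⊛ W r) n) (W r n))

∑-biased-^ : ∀ r n → ∑ (partitions n n) (λ v → ∑ (allFin n) (λ k → biased k v ^ℚ suc r)) ≡ partialSum (suc r) n
∑-biased-^ r n = begin
  ∑ (partitions n n) (λ v → ∑ (allFin n) (λ k → biased k v ^ℚ suc r))
    ≡⟨ ∑-swap (partitions n n) (allFin n) (λ v k → biased k v ^ℚ suc r) ⟩
  ∑ (allFin n) (λ k → ∑ (partitions n n) (λ v → biased k v ^ℚ suc r))
    ≡⟨ ∑-cong (allFin n) (λ k → trans
         (∑-remove-before n n k (λ v → biased k v ^ℚ suc r) (λ v ¬1≤ → trans (cong (_^ℚ suc r) (biased-zero k v ¬1≤)) (ℚₚ.*-zeroˡ (0ℚ ^ℚ r))))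
         (trans (before-cong n (toℕ k) (λ {m} m<n → trans
           (∑-cong (partitions n m) (λ u → cong (_^ℚ suc r) (biased-inc k u)))
           (sym (W≡∑ r m n (ℕₚ.<⇒≤ m<n)))))
         (sym (ℚₚ.*-identityˡ (before (W (suc r)) n (toℕ k)))))) ⟩
  ∑ (allFin n) (λ k → 1ℚ * before (W (suc r)) n (toℕ k))
    ≡⟨ ∑-before n (λ _ → 1ℚ) (W (suc r)) ℕₚ.≤-refl ⟩
  ((λ _ → 1ℚ) ⊛ W (suc r)) n
    ≡⟨ partialSum≡⊛ (suc r) n ⟨
  partialSum (suc r) n ∎
  where open ≡-Reasoning

-- The exact quotient is 1 / (k (uₖ + 1)) for part size k; the factor uₖ + 1 ≥ 1 is dropped.
prob-inc≤ : ∀ (k : Fin N) u → prob 0 (inc k u) ℚ.≤ recip (toℕ k) * prob 0 u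
prob-inc≤ k u = ≤-recip (toℕ k) (begin
  ι (size k) * prob 0 (inc k u)                           ≤⟨ *-monoˡ (0≤prob 0 (inc k u)) (ι-mono (ℕₚ.m≤m*n (size k) (suc (lookup u k)))) ⟩
  ι (size k ℕ.* suc (lookup u k)) * prob 0 (inc k u)      ≡⟨ prob-inc 0 k u ⟩
  prob 0 u                                                ∎)
  where open ℚₚ.≤-Reasoning

W2≡∑ : ∀ n N → n ≤ N → W 2 n ≡ ∑ (partitions N n) (λ u → prob 0 u * prob 0 u)
W2≡∑ n N n≤N = trans (W≡∑ 1 n N n≤N) (∑-cong (partitions N n) (λ u → *-congˡ (prob 0 u) (ℚₚ.*-identityʳ (prob 0 u))))

∑-prob-biased : ∀ N n → n ≤ N → (l : Fin N) →
  ∑ (partitions N n) (λ u → prob 0 u * biased l u) ℚ.≤ recip (toℕ l) * before (W 2) n (toℕ l)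
∑-prob-biased N n n≤N l = begin
  ∑ (partitions N n) (λ u → prob 0 u * biased l u)
    ≡⟨ ∑-remove-before N n l (λ u → prob 0 u * biased l u)
         (λ v ¬1≤ → trans (*-congˡ (prob 0 v) (biased-zero l v ¬1≤)) (ℚₚ.*-zeroʳ (prob 0 v))) ⟩
  before (λ m → ∑ (partitions N m) (λ u → prob 0 (inc l u) * biased l (inc l u))) n (toℕ l)
    ≤⟨ before-mono n (toℕ l) (λ {m} m<n → bound m (ℕₚ.≤-trans (ℕₚ.<⇒≤ m<n) n≤N)) ⟩
  before (λ m → recip (toℕ l) * W 2 m) n (toℕ l)
    ≡⟨ before-*ˡ (recip (toℕ l)) (W 2) n (toℕ l) ⟩
  recip (toℕ l) * before (W 2) n (toℕ l) ∎
  where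
  open ℚₚ.≤-Reasoning
  bound : ∀ m → m ≤ N → ∑ (partitions N m) (λ u → prob 0 (inc l u) * biased l (inc l u)) ℚ.≤ recip (toℕ l) * W 2 m
  bound m m≤N = begin
    ∑ (partitions N m) (λ u → prob 0 (inc l u) * biased l (inc l u))
      ≤⟨ ∑-mono (partitions N m) (λ u → ℚₚ.≤-trans
           (ℚₚ.≤-reflexive (*-congˡ (prob 0 (inc l u)) (biased-inc l u)))
           (ℚₚ.≤-trans (*-monoˡ (0≤prob 0 u) (prob-inc≤ l u))
             (ℚₚ.≤-reflexive (ℚₚ.*-assoc (recip (toℕ l)) (prob 0 u) (prob 0 u))))) ⟩
    ∑ (partitions N m) (λ u → recip (toℕ l) * (prob 0 u * prob 0 u))
      ≡⟨ ∑-*ˡ (partitions N m) (recip (toℕ l)) (λ u → prob 0 u * prob 0 u) ⟩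
    recip (toℕ l) * ∑ (partitions N m) (λ u → prob 0 u * prob 0 u)
      ≡⟨ *-congˡ (recip (toℕ l)) (W2≡∑ m N m≤N) ⟨
    recip (toℕ l) * W 2 m ∎

-- Removing the part k first turns `biased k` into p and costs at most 1 / `size k` in `biased l`,
-- whose multiplicity is untouched because l ≢ k. Removing l is then `∑-prob-biased`.
∑-biased-biased : ∀ N n → n ≤ N → (k l : Fin N) → l ≢ k →
  ∑ (partitions N n) (λ u → biased l u * biased k u) ℚ.≤
  recip (toℕ k) * before (λ m → recip (toℕ l) * before (W 2) m (toℕ l)) n (toℕ k)
∑-biased-biased N n n≤N k l l≢k = begin
  ∑ (partitions N n) (λ u → biased l u * biased k u)
    ≡⟨ ∑-remove-before N n k (λ u → biased l u * biased k u)
         (λ v ¬1≤ → trans (*-congˡ (biased l v) (biased-zero k v ¬1≤)) (ℚₚ.*-zeroʳ (biased l v))) ⟩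
  before (λ m → ∑ (partitions N m) (λ u → biased l (inc k u) * biased k (inc k u))) n (toℕ k)
    ≤⟨ before-mono n (toℕ k) (λ {m} m<n → bound m (ℕₚ.≤-trans (ℕₚ.<⇒≤ m<n) n≤N)) ⟩
  before (λ m → recip (toℕ k) * (recip (toℕ l) * before (W 2) m (toℕ l))) n (toℕ k)
    ≡⟨ before-*ˡ (recip (toℕ k)) (λ m → recip (toℕ l) * before (W 2) m (toℕ l)) n (toℕ k) ⟩
  recip (toℕ k) * before (λ m → recip (toℕ l) * before (W 2) m (toℕ l)) n (toℕ k) ∎
  where
  open ℚₚ.≤-Reasoning
  pointwise : ∀ u → biased l (inc k u) * biased k (inc k u) ℚ.≤ recip (toℕ k) * (prob 0 u * biased l u)
  pointwise u = begin
    biased l (inc k u) * biased k (inc k u)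
      ≡⟨ cong₂ (λ x y → ι (size l ℕ.* x) * prob 0 (inc k u) * y) (lookup-inc-≢ u l≢k) (biased-inc k u) ⟩
    c * prob 0 (inc k u) * prob 0 u
      ≤⟨ *-monoˡ (0≤prob 0 u) (*-monoʳ (0≤ι (size l ℕ.* lookup u l)) (prob-inc≤ k u)) ⟩
    c * (recip (toℕ k) * prob 0 u) * prob 0 u
      ≡⟨ solve 3 (λ c r p → c :* (r :* p) :* p := r :* (p :* (c :* p))) refl c (recip (toℕ k)) (prob 0 u) ⟩
    recip (toℕ k) * (prob 0 u * biased l u) ∎
    where c = ι (size l ℕ.* lookup u l)
  bound : ∀ m → m ≤ N → ∑ (partitions N m) (λ u → biased l (inc k u) * biased k (inc k u)) ℚ.≤
          recip (toℕ k) * (recip (toℕ l) * before (W 2) m (toℕ l))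
  bound m m≤N = begin
    ∑ (partitions N m) (λ u → biased l (inc k u) * biased k (inc k u))
      ≤⟨ ∑-mono (partitions N m) pointwise ⟩
    ∑ (partitions N m) (λ u → recip (toℕ k) * (prob 0 u * biased l u))
      ≡⟨ ∑-*ˡ (partitions N m) (recip (toℕ k)) (λ u → prob 0 u * biased l u) ⟩
    recip (toℕ k) * ∑ (partitions N m) (λ u → prob 0 u * biased l u)
      ≤⟨ *-monoʳ (0≤recip (toℕ k)) (∑-prob-biased N m m≤N l) ⟩
    recip (toℕ k) * (recip (toℕ l) * before (W 2) m (toℕ l)) ∎

-- The cross terms

open Powers using (defect; Σa²≡; ∑-^≤^; ^≤∑-^)

recip² : ℕ → ℚ
recip² = recip ⊛ recip

deficiency : ∀ N → Vec ℕ N → ℚ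
deficiency N v = defect (allFin N) (λ k → biased k v) (λ k → 0≤biased k v)

Σ-deficiency : ℕ → ℚ
Σ-deficiency n = ∑ (partitions n n) (deficiency n)

0≤W : ∀ r n → 0ℚ ℚ.≤ W (suc r) n
0≤W r n = subst (0ℚ ℚ.≤_) (sym (W≡∑ r n n ℕₚ.≤-refl)) (0≤∑ (partitions n n) (λ u → 0≤^ (suc r) (0≤prob 0 u)))

0≤before : ∀ {u} → (∀ m → 0ℚ ℚ.≤ u m) → ∀ n k → 0ℚ ℚ.≤ before u n k
0≤before 0≤u zero    k       = ℚₚ.≤-refl
0≤before 0≤u (suc n) zero    = 0≤u n
0≤before 0≤u (suc n) (suc k) = 0≤before 0≤u n k

Σ-deficiency≤ : ∀ n → Σ-deficiency n ℚ.≤ (recip² ⊛ W 2) n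
Σ-deficiency≤ n = begin
  ∑ P (λ v → ∑ K (λ k → (∑ K (λ l → biased l v) - biased k v) * biased k v))
    ≡⟨ ∑-cong P (λ v → ∑-cong K (λ k → expand v k)) ⟩
  ∑ P (λ v → ∑ K (λ k → ∑ K (λ l → biased l v * biased k v * off k l)))
    ≡⟨ ∑-swap P K (λ v k → ∑ K (λ l → biased l v * biased k v * off k l)) ⟩
  ∑ K (λ k → ∑ P (λ v → ∑ K (λ l → biased l v * biased k v * off k l)))
    ≡⟨ ∑-cong K (λ k → ∑-swap P K (λ v l → biased l v * biased k v * off k l)) ⟩
  ∑ K (λ k → ∑ K (λ l → ∑ P (λ v → biased l v * biased k v * off k l)))
    ≤⟨ ∑-mono K (λ k → ∑-mono K (λ l → bound k l)) ⟩
  ∑ K (λ k → ∑ K (λ l → recip (toℕ k) * before (c l) n (toℕ k)))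
    ≡⟨ ∑-cong K (λ k → trans (∑-*ˡ K (recip (toℕ k)) (λ l → before (c l) n (toℕ k)))
         (*-congˡ (recip (toℕ k)) (trans (sym (before-∑ K c n (toℕ k)))
           (before-cong n (toℕ k) (λ {m} m<n → ∑-before m recip (W 2) (ℕₚ.<⇒≤ m<n)))))) ⟩
  ∑ K (λ k → recip (toℕ k) * before (recip ⊛ W 2) n (toℕ k))
    ≡⟨ ∑-before n recip (recip ⊛ W 2) ℕₚ.≤-refl ⟩
  (recip ⊛ (recip ⊛ W 2)) n
    ≡⟨ ⊛-assoc recip recip (W 2) n ⟨
  (recip² ⊛ W 2) n ∎
  where
  open ℚₚ.≤-Reasoning
  P = partitions n n
  K = allFin n
  -- The indicator of l ≢ k, which turns the difference in `defect` into a double sum that can be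
  -- bounded term by term.
  off : Fin n → Fin n → ℚ
  off k l = 1ℚ - 𝟙 (l Finₚ.≟ k)
  c : Fin n → ℕ → ℚ
  c l m = recip (toℕ l) * before (W 2) m (toℕ l)
  expand : ∀ v k → (∑ K (λ l → biased l v) - biased k v) * biased k v ≡ ∑ K (λ l → biased l v * biased k v * off k l)
  expand v k = E.begin
    (∑ K (λ l → biased l v) - b) * b
      E.≡⟨ cong (λ x → (∑ K (λ l → biased l v) - x) * b) (sym (∑-𝟙 Finₚ._≟_ (λ l → biased l v) (Uniqueₚ.allFin⁺ n) (∈ₚ.∈-allFin k))) ⟩
    (∑ K (λ l → biased l v) - ∑ K (λ l → biased l v * 𝟙 (l Finₚ.≟ k))) * b
      E.≡⟨ solve 3 (λ x y b → (x :- y) :* b := b :* x :+ (con (ℚ.- 1ℚ) :* b) :* y) refl (∑ K (λ l → biased l v)) (∑ K (λ l → biased l v * 𝟙 (l Finₚ.≟ k))) b ⟩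
    b * ∑ K (λ l → biased l v) + (ℚ.- 1ℚ * b) * ∑ K (λ l → biased l v * 𝟙 (l Finₚ.≟ k))
      E.≡⟨ cong₂ ℚ._+_ (sym (∑-*ˡ K b (λ l → biased l v))) (sym (∑-*ˡ K (ℚ.- 1ℚ * b) (λ l → biased l v * 𝟙 (l Finₚ.≟ k)))) ⟩
    ∑ K (λ l → b * biased l v) + ∑ K (λ l → (ℚ.- 1ℚ * b) * (biased l v * 𝟙 (l Finₚ.≟ k)))
      E.≡⟨ sym (∑-+ K (λ l → b * biased l v) (λ l → (ℚ.- 1ℚ * b) * (biased l v * 𝟙 (l Finₚ.≟ k)))) ⟩
    ∑ K (λ l → b * biased l v + (ℚ.- 1ℚ * b) * (biased l v * 𝟙 (l Finₚ.≟ k)))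
      E.≡⟨ ∑-cong K (λ l → solve 3 (λ b x y → b :* x :+ (con (ℚ.- 1ℚ) :* b) :* (x :* y) := x :* b :* (con 1ℚ :- y)) refl b (biased l v) (𝟙 (l Finₚ.≟ k))) ⟩
    ∑ K (λ l → biased l v * b * off k l) E.∎
    where module E = ≡-Reasoning
          b = biased k v
  0≤c : ∀ l m → 0ℚ ℚ.≤ c l m
  0≤c l m = 0≤* (0≤recip (toℕ l)) (0≤before (0≤W 1) m (toℕ l))
  bound : ∀ k l → ∑ P (λ v → biased l v * biased k v * off k l) ℚ.≤ recip (toℕ k) * before (c l) n (toℕ k)
  bound k l with l Finₚ.≟ k
  -- Diagonal terms are 0 on the left; keeping nonnegative terms on the right completes the sums
  -- over k and l to full convolutions.
  ... | yes _ = ℚₚ.≤-trans (ℚₚ.≤-reflexive (trans (∑-cong P (λ v → ℚₚ.*-zeroʳ (biased l v * biased k v))) (∑-zero P)))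
    (0≤* (0≤recip (toℕ k)) (0≤before (0≤c l) n (toℕ k)))
  ... | no l≢k = ℚₚ.≤-trans (ℚₚ.≤-reflexive (∑-cong P (λ v → ℚₚ.*-identityʳ (biased l v * biased k v))))
    (∑-biased-biased n n ℕₚ.≤-refl k l l≢k)

-- Expansion of n^r W_r(n)

∑-biased≡ : ∀ {N n} {v : Vec ℕ N} → v ∈ partitions N n → ∑ (allFin N) (λ k → biased k v) ≡ ι n * prob 0 v
∑-biased≡ {v = v} v∈ = trans (∑-biased v) (cong (λ e → ι e * prob 0 v) (∈-partitions⁻ v∈))

n^r*W≡ : ∀ r n → ι (n ^ suc r) * W (suc r) n ≡ ∑ (partitions n n) (λ v → ∑ (allFin n) (λ k → biased k v) ^ℚ suc r)
n^r*W≡ r n = begin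
  ι (n ^ suc r) * W (suc r) n
    ≡⟨ cong₂ ℚ._*_ (ι-^ n (suc r)) (W≡∑ r n n ℕₚ.≤-refl) ⟩
  ι n ^ℚ suc r * ∑ (partitions n n) (λ u → prob 0 u ^ℚ suc r)
    ≡⟨ ∑-*ˡ (partitions n n) (ι n ^ℚ suc r) (λ u → prob 0 u ^ℚ suc r) ⟨
  ∑ (partitions n n) (λ u → ι n ^ℚ suc r * prob 0 u ^ℚ suc r)
    ≡⟨ ∑-cong∈ (partitions n n) (λ {u} u∈ → trans (sym (Exp.^-distrib-* (ι n) (prob 0 u) (suc r))) (cong (_^ℚ suc r) (sym (∑-biased≡ u∈)))) ⟩
  ∑ (partitions n n) (λ v → ∑ (allFin n) (λ k → biased k v) ^ℚ suc r) ∎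
  where open ≡-Reasoning

partialSum≤n^r*W : ∀ r n → partialSum (suc r) n ℚ.≤ ι (n ^ suc r) * W (suc r) n
partialSum≤n^r*W r n = begin
  partialSum (suc r) n
    ≡⟨ ∑-biased-^ r n ⟨
  ∑ (partitions n n) (λ v → ∑ (allFin n) (λ k → biased k v ^ℚ suc r))
    ≤⟨ ∑-mono (partitions n n) (λ v → ∑-^≤^ (allFin n) (λ k → biased k v) (λ k → 0≤biased k v) r) ⟩
  ∑ (partitions n n) (λ v → ∑ (allFin n) (λ k → biased k v) ^ℚ suc r)
    ≡⟨ n^r*W≡ r n ⟨
  ι (n ^ suc r) * W (suc r) n ∎
  where open ℚₚ.≤-Reasoning

n^r*W≤ : ∀ r n b → (∀ {v} → v ∈ partitions n n → ∑ (allFin n) (λ k → biased k v) ℚ.≤ ι b) →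
         ι (n ^ suc (suc r)) * W (suc (suc r)) n ℚ.≤ partialSum (suc (suc r)) n + ι (slack b r) * Σ-deficiency n
n^r*W≤ r n b Σ≤b = begin
  ι (n ^ s) * W s n
    ≡⟨ n^r*W≡ (suc r) n ⟩
  ∑ P (λ v → ∑ K (λ k → biased k v) ^ℚ s)
    ≤⟨ ∑-mono∈ P (λ {v} v∈ → ^≤∑-^ K (λ k → biased k v) (λ k → 0≤biased k v) b (Σ≤b v∈) r) ⟩
  ∑ P (λ v → ∑ K (λ k → biased k v ^ℚ s) + ι (slack b r) * deficiency n v)
    ≡⟨ ∑-+ P (λ v → ∑ K (λ k → biased k v ^ℚ s)) (λ v → ι (slack b r) * deficiency n v) ⟩
  ∑ P (λ v → ∑ K (λ k → biased k v ^ℚ s)) + ∑ P (λ v → ι (slack b r) * deficiency n v)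
    ≡⟨ cong₂ ℚ._+_ (∑-biased-^ (suc r) n) (∑-*ˡ P (ι (slack b r)) (deficiency n)) ⟩
  partialSum s n + ι (slack b r) * Σ-deficiency n ∎
  where
  open ℚₚ.≤-Reasoning
  s = suc (suc r)
  P = partitions n n
  K = allFin n

-- An identity, valid with no bound on n p(v); such a bound is derived from its consequences.
n²*W₂≡ : ∀ n → ι n * ι n * W 2 n ≡ partialSum 2 n + Σ-deficiency n
n²*W₂≡ n = begin
  ι n * ι n * W 2 n
    ≡⟨ cong (λ x → ι n * x * W 2 n) (sym (ℚₚ.*-identityʳ (ι n))) ⟩
  ι n ^ℚ 2 * W 2 n
    ≡⟨ cong (λ x → x * W 2 n) (sym (ι-^ n 2)) ⟩
  ι (n ^ 2) * W 2 n
    ≡⟨ n^r*W≡ 1 n ⟩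
  ∑ P (λ v → ∑ K (λ k → biased k v) ^ℚ 2)
    ≡⟨ ∑-cong P (λ v → trans (*-congˡ (A₁ v) (ℚₚ.*-identityʳ (A₁ v))) (Σa²≡ K (λ k → biased k v) (λ k → 0≤biased k v))) ⟩
  ∑ P (λ v → ∑ K (λ k → biased k v * biased k v) + deficiency n v)
    ≡⟨ ∑-+ P (λ v → ∑ K (λ k → biased k v * biased k v)) (deficiency n) ⟩
  ∑ P (λ v → ∑ K (λ k → biased k v * biased k v)) + Σ-deficiency n
    ≡⟨ +-congʳ (Σ-deficiency n) (trans (∑-cong P (λ v → ∑-cong K (λ k → *-congˡ (biased k v) (sym (ℚₚ.*-identityʳ (biased k v))))))
         (∑-biased-^ 1 n)) ⟩
  partialSum 2 n + Σ-deficiency n ∎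
  where
  open ≡-Reasoning
  P = partitions n n
  K = allFin n
  A₁ : Vec ℕ n → ℚ
  A₁ v = ∑ K (λ k → biased k v)

-- Convolutions of reciprocals

⊛-*ˡ : ∀ c f u n → ((λ i → c * f i) ⊛ u) n ≡ c * (f ⊛ u) n
⊛-*ˡ c f u zero    = sym (ℚₚ.*-zeroʳ c)
⊛-*ˡ c f u (suc n) = trans (+-congˡ (c * f 0 * u n) (⊛-*ˡ c (f ∘ suc) u n))
  (solve 4 (λ c f u x → c :* f :* u :+ c :* x := c :* (f :* u :+ x)) refl c (f 0) (u n) (((f ∘ suc) ⊛ u) n))

⊛-const : ∀ c n → ((λ _ → c) ⊛ (λ _ → 1ℚ)) n ≡ ι n * c
⊛-const c zero    = sym (trans (*-congʳ c ι-0) (ℚₚ.*-zeroˡ c))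
⊛-const c (suc n) = begin
  c * 1ℚ + ((λ _ → c) ⊛ (λ _ → 1ℚ)) n ≡⟨ +-congˡ (c * 1ℚ) (⊛-const c n) ⟩
  c * 1ℚ + ι n * c                    ≡⟨ solve 2 (λ c n → c :* con 1ℚ :+ n :* c := (con 1ℚ :+ n) :* c) refl c (ι n) ⟩
  (1ℚ + ι n) * c                      ≡⟨ *-congʳ c (ι-suc n) ⟨
  ι (suc n) * c                       ∎
  where open ≡-Reasoning

⊛-mono-diagonal : ∀ n {f u f₁ u₁ f₂ u₂} →
  (∀ i j → suc (i ℕ.+ j) ≡ n → f i * u j ℚ.≤ f₁ i * u₁ j + f₂ i * u₂ j) → (f ⊛ u) n ℚ.≤ (f₁ ⊛ u₁) n + (f₂ ⊛ u₂) n
⊛-mono-diagonal zero    le = ℚₚ.≤-refl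
⊛-mono-diagonal (suc n) {f} {u} {f₁} {u₁} {f₂} {u₂} le = begin
  f 0 * u n + ((f ∘ suc) ⊛ u) n
    ≤⟨ ℚₚ.+-mono-≤ (le 0 n refl) (⊛-mono-diagonal n {f₁ = f₁ ∘ suc} {u₁} {f₂ ∘ suc} {u₂} (λ i j eq → le (suc i) j (cong suc eq))) ⟩
  f₁ 0 * u₁ n + f₂ 0 * u₂ n + (((f₁ ∘ suc) ⊛ u₁) n + ((f₂ ∘ suc) ⊛ u₂) n)
    ≡⟨ solve 4 (λ a b c d → a :+ b :+ (c :+ d) := a :+ c :+ (b :+ d)) refl
         (f₁ 0 * u₁ n) (f₂ 0 * u₂ n) (((f₁ ∘ suc) ⊛ u₁) n) (((f₂ ∘ suc) ⊛ u₂) n) ⟩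
  f₁ 0 * u₁ n + ((f₁ ∘ suc) ⊛ u₁) n + (f₂ 0 * u₂ n + ((f₂ ∘ suc) ⊛ u₂) n) ∎
  where open ℚₚ.≤-Reasoning

⊛-1-last : ∀ f n → (f ⊛ (λ _ → 1ℚ)) (suc n) ≡ (f ⊛ (λ _ → 1ℚ)) n + f n
⊛-1-last f zero    = solve 1 (λ x → x :* con 1ℚ :+ con 0ℚ := con 0ℚ :+ x) refl (f 0)
⊛-1-last f (suc n) = trans (+-congˡ (f 0 * 1ℚ) (⊛-1-last (f ∘ suc) n))
  (sym (ℚₚ.+-assoc (f 0 * 1ℚ) (((f ∘ suc) ⊛ (λ _ → 1ℚ)) n) (f (suc n))))

⊛-1-comm : ∀ f n → ((λ _ → 1ℚ) ⊛ f) n ≡ (f ⊛ (λ _ → 1ℚ)) n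
⊛-1-comm f zero    = refl
⊛-1-comm f (suc n) = trans (cong₂ ℚ._+_ (ℚₚ.*-identityˡ (f n)) (⊛-1-comm f n))
  (trans (ℚₚ.+-comm (f n) ((f ⊛ (λ _ → 1ℚ)) n)) (sym (⊛-1-last f n)))

-- Partial fractions: 1/(ab) = (1/a + 1/b) / (a + b) with a = i + 1 and b = j + 1.
recip*recip : ∀ i j → recip i * recip j ≡ recip (suc (i ℕ.+ j)) * recip i + recip (suc (i ℕ.+ j)) * recip j
recip*recip i j = *-cancelˡ-suc (suc (i ℕ.+ j)) (begin
  s * (x * y)                      ≡⟨ *-congʳ (x * y) (trans (cong ι (cong suc (sym (ℕₚ.+-suc i j)))) (ι-+ (suc i) (suc j))) ⟩
  (ι (suc i) + ι (suc j)) * (x * y) ≡⟨ solve 4 (λ a b x y → (a :+ b) :* (x :* y) := (a :* x) :* y :+ (b :* y) :* x) refl (ι (suc i)) (ι (suc j)) x y ⟩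
  (ι (suc i) * x) * y + (ι (suc j) * y) * x ≡⟨ cong₂ (λ p q → p * y + q * x) (recip-inverse i) (recip-inverse j) ⟩
  1ℚ * y + 1ℚ * x                  ≡⟨ solve 2 (λ x y → con 1ℚ :* y :+ con 1ℚ :* x := con 1ℚ :* (x :+ y)) refl x y ⟩
  1ℚ * (x + y)                     ≡⟨ *-congʳ (x + y) (recip-inverse (suc (i ℕ.+ j))) ⟨
  (s * z) * (x + y)                ≡⟨ solve 4 (λ s z x y → (s :* z) :* (x :+ y) := s :* (z :* x :+ z :* y)) refl s z x y ⟩
  s * (z * x + z * y)              ∎)
  where
  open ≡-Reasoning
  s = ι (suc (suc (i ℕ.+ j)))
  x = recip i
  y = recip j
  z = recip (suc (i ℕ.+ j))

-- For a, b ≥ 1 one has ab ≥ a + b - 1; here a = i + 1 and b = j + 1.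
recip*recip≤ : ∀ i j → recip i * recip j ℚ.≤ recip (i ℕ.+ j)
recip*recip≤ i j = subst (recip i * recip j ℚ.≤_) (ℚₚ.*-identityʳ (recip (i ℕ.+ j))) (≤-recip (i ℕ.+ j) (begin
  ι (suc (i ℕ.+ j)) * (x * y)     ≤⟨ *-monoˡ (0≤* (0≤recip i) (0≤recip j)) (ι-mono {suc (i ℕ.+ j)} {suc i ℕ.* suc j} le) ⟩
  ι (suc i ℕ.* suc j) * (x * y)   ≡⟨ *-congʳ (x * y) (ι-* (suc i) (suc j)) ⟩
  ι (suc i) * ι (suc j) * (x * y) ≡⟨ solve 4 (λ a b x y → a :* b :* (x :* y) := (a :* x) :* (b :* y)) refl (ι (suc i)) (ι (suc j)) x y ⟩
  ι (suc i) * x * (ι (suc j) * y) ≡⟨ cong₂ ℚ._*_ (recip-inverse i) (recip-inverse j) ⟩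
  1ℚ                              ∎))
  where
  open ℚₚ.≤-Reasoning
  x = recip i
  y = recip j
  le : suc (i ℕ.+ j) ≤ suc i ℕ.* suc j
  le = ℕ.s≤s (subst (_≤ j ℕ.+ i ℕ.* suc j) (ℕₚ.+-comm j i) (ℕₚ.+-monoʳ-≤ j (ℕₚ.m≤m*n i (suc j))))

-- At `suc n` there are n + 1 terms, each at most 1 / (n + 1).
recip²≤1 : ∀ n → recip² n ℚ.≤ 1ℚ
recip²≤1 zero    = 0≤1
recip²≤1 (suc n) = begin
  recip² (suc n)
    ≤⟨ ⊛-mono-diagonal (suc n) {recip} {recip} {f₁ = λ _ → recip n} {λ _ → 1ℚ} {λ _ → 0ℚ} {λ _ → 1ℚ} diagonal ⟩
  ((λ _ → recip n) ⊛ (λ _ → 1ℚ)) (suc n) + ((λ _ → 0ℚ) ⊛ (λ _ → 1ℚ)) (suc n)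
    ≡⟨ cong₂ ℚ._+_ (trans (⊛-const (recip n) (suc n)) (recip-inverse n)) (trans (⊛-const 0ℚ (suc n)) (ℚₚ.*-zeroʳ (ι (suc n)))) ⟩
  1ℚ ∎
  where
  open ℚₚ.≤-Reasoning
  diagonal : ∀ i j → suc (i ℕ.+ j) ≡ suc n → recip i * recip j ℚ.≤ recip n * 1ℚ + 0ℚ * 1ℚ
  diagonal i j refl = subst (recip i * recip j ℚ.≤_)
    (solve 1 (λ x → x := x :* con 1ℚ :+ con 0ℚ :* con 1ℚ) refl (recip (i ℕ.+ j))) (recip*recip≤ i j)

-- Bounds the first K terms by 1 and the others by δ.
⊛-1-split : ∀ K {f δ} → (∀ i → f i ℚ.≤ 1ℚ) → 0ℚ ℚ.≤ δ → (∀ i → K ≤ i → f i ℚ.≤ δ) → ∀ n →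
            (f ⊛ (λ _ → 1ℚ)) n ℚ.≤ ι K + ι n * δ
⊛-1-split zero    {f} {δ} f≤1 0≤δ f≤δ n = begin
  (f ⊛ (λ _ → 1ℚ)) n          ≤⟨ ⊛-monoˡ (λ i → f≤δ i ℕ.z≤n) (λ _ → 0≤1) n ⟩
  ((λ _ → δ) ⊛ (λ _ → 1ℚ)) n  ≡⟨ ⊛-const δ n ⟩
  ι n * δ                     ≡⟨ ℚₚ.+-identityˡ (ι n * δ) ⟨
  0ℚ + ι n * δ                ≡⟨ +-congʳ (ι n * δ) ι-0 ⟨
  ι 0 + ι n * δ               ∎
  where open ℚₚ.≤-Reasoning
⊛-1-split (suc K) {f} {δ} f≤1 0≤δ f≤δ zero    = 0≤+ (0≤ι (suc K)) (0≤* (0≤ι 0) 0≤δ)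
⊛-1-split (suc K) {f} {δ} f≤1 0≤δ f≤δ (suc n) = begin
  f 0 * 1ℚ + ((f ∘ suc) ⊛ (λ _ → 1ℚ)) n
    ≤⟨ ℚₚ.+-mono-≤ (*-monoˡ 0≤1 (f≤1 0)) (⊛-1-split K (f≤1 ∘ suc) 0≤δ (λ i K≤i → f≤δ (suc i) (ℕ.s≤s K≤i)) n) ⟩
  1ℚ * 1ℚ + (ι K + ι n * δ)   ≡⟨ ℚₚ.+-assoc 1ℚ (ι K) (ι n * δ) ⟨
  1ℚ + ι K + ι n * δ          ≡⟨ +-congʳ (ι n * δ) (ι-suc K) ⟨
  ι (suc K) + ι n * δ         ≤⟨ ℚₚ.+-monoʳ-≤ (ι (suc K)) (*-monoˡ 0≤δ (ι-mono (ℕₚ.n≤1+n n))) ⟩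
  ι (suc K) + ι (suc n) * δ   ∎
  where open ℚₚ.≤-Reasoning

-- Partial fractions give 2 H / (n + 1) with H the n-th harmonic number, and H ≤ 2 n / (k + 1) once
-- n ≥ (k + 1)². This is where the constant 4 comes from.
recip²-small : ∀ k n → suc k ℕ.* suc k ≤ n → recip² n ℚ.≤ ι 4 * recip k
recip²-small k zero ()
recip²-small k n@(suc n₁) K²≤n = begin
  recip² n
    ≤⟨ ⊛-mono-diagonal n {recip} {recip} {f₁ = λ i → c * recip i} {λ _ → 1ℚ} {λ _ → c * 1ℚ} {recip} diagonal ⟩
  ((λ i → c * recip i) ⊛ (λ _ → 1ℚ)) n + ((λ _ → c * 1ℚ) ⊛ recip) n
    ≡⟨ cong₂ ℚ._+_ (⊛-*ˡ c recip (λ _ → 1ℚ) n) (trans (⊛-*ˡ c (λ _ → 1ℚ) recip n) (*-congˡ c (⊛-1-comm recip n))) ⟩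
  c * H + c * H
    ≡⟨ solve 2 (λ c x → c :* x :+ c :* x := c :* (x :+ x)) refl c H ⟩
  c * (H + H)
    ≤⟨ *-monoʳ (0≤recip n) (ℚₚ.+-mono-≤ H≤ H≤) ⟩
  c * (ι n * δ + ι n * δ + (ι n * δ + ι n * δ))
    ≡⟨ solve 3 (λ c n d → c :* (n :* d :+ n :* d :+ (n :* d :+ n :* d)) := (n :* c) :* ((con 1ℚ :+ con 1ℚ :+ (con 1ℚ :+ con 1ℚ)) :* d)) refl c (ι n) δ ⟩
  (ι n * c) * ((1ℚ + 1ℚ + (1ℚ + 1ℚ)) * δ)
    ≤⟨ *-monoˡ (0≤* (ℚₚ.nonNegative⁻¹ _) (0≤recip k)) (ℚₚ.≤-trans (*-monoˡ (0≤recip n) (ι-mono (ℕₚ.n≤1+n n))) (ℚₚ.≤-reflexive (recip-inverse n))) ⟩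
  1ℚ * ((1ℚ + 1ℚ + (1ℚ + 1ℚ)) * δ)
    ≡⟨ trans (ℚₚ.*-identityˡ ((1ℚ + 1ℚ + (1ℚ + 1ℚ)) * δ)) (*-congʳ δ (sym (ι≡/ 4))) ⟩
  ι 4 * δ ∎
  where
  open ℚₚ.≤-Reasoning
  c = recip n
  δ = recip k
  H = (recip ⊛ (λ _ → 1ℚ)) n
  diagonal : ∀ i j → suc (i ℕ.+ j) ≡ n → recip i * recip j ℚ.≤ c * recip i * 1ℚ + c * 1ℚ * recip j
  diagonal i j refl = ℚₚ.≤-reflexive (trans (recip*recip i j)
    (solve 3 (λ c x y → c :* x :+ c :* y := c :* x :* con 1ℚ :+ c :* con 1ℚ :* y) refl c (recip i) (recip j)))
  -- The first k + 1 terms are at most 1 and the others at most δ; since n ≥ (k + 1)², the number k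
  -- + 1 is itself at most n δ.
  H≤ : H ℚ.≤ ι n * δ + ι n * δ
  H≤ = ℚₚ.≤-trans (⊛-1-split (suc k) recip≤1 (0≤recip k) (λ i k<i → recip-antimono (ℕₚ.<⇒≤ k<i)) n)
    (ℚₚ.+-monoˡ-≤ (ι n * δ) (subst (ι (suc k) ℚ.≤_) (ℚₚ.*-comm δ (ι n)) (≤-recip k
      (subst (ℚ._≤ ι n) (ι-* (suc k) (suc k)) (ι-mono K²≤n)))))

-- Growth and convergence of the partial sums

n²*W₂≤2S : ∀ n → ι n * ι n * W 2 n ℚ.≤ partialSum 2 n + partialSum 2 n
n²*W₂≤2S n = begin
  ι n * ι n * W 2 n                    ≡⟨ n²*W₂≡ n ⟩
  partialSum 2 n + Σ-deficiency n      ≤⟨ ℚₚ.+-monoʳ-≤ (partialSum 2 n) (Σ-deficiency≤ n) ⟩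
  partialSum 2 n + (recip² ⊛ W 2) n         ≤⟨ ℚₚ.+-monoʳ-≤ (partialSum 2 n) (⊛-monoˡ recip²≤1 (0≤W 1) n) ⟩
  partialSum 2 n + ((λ _ → 1ℚ) ⊛ W 2) n ≡⟨ +-congˡ (partialSum 2 n) (partialSum≡⊛ 2 n) ⟨
  partialSum 2 n + partialSum 2 n      ∎
  where open ℚₚ.≤-Reasoning

partialSum-mono : ∀ r j n → partialSum (suc r) n ℚ.≤ partialSum (suc r) (j ℕ.+ n)
partialSum-mono r zero    n = ℚₚ.≤-refl
partialSum-mono r (suc j) n = ℚₚ.≤-trans (partialSum-mono r j n) (p≤p+q (0≤W r (j ℕ.+ n)))

*-cancelˡ-≤-suc : ∀ n {p q} → ι (suc n) * p ℚ.≤ ι (suc n) * q → p ℚ.≤ q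
*-cancelˡ-≤-suc n = ℚₚ.*-cancelˡ-≤-pos (ι (suc n)) {{ι-pos n}}

private
  c₂ c₁₄ : ℚ
  c₂ = + 2 / 1
  c₁₄ = + 14 / 1

-- n³ (14 (n - 1) - (n + 1) (S + w)) is a nonnegative combination of the two hypotheses plus 14 (2 n + 4).
invariant-step : ∀ m {S w} → ι (suc m) * S ℚ.≤ c₁₄ * (ι (suc m) - c₂) → ι (suc m) * ι (suc m) * w ℚ.≤ S + S →
                 (1ℚ + ι (suc m)) * (S + w) ℚ.≤ c₁₄ * (1ℚ + ι (suc m) - c₂)
invariant-step m {S} {w} h₁ h₂ = *-cancelˡ-≤-suc m (*-cancelˡ-≤-suc m (*-cancelˡ-≤-suc m (≤-by
  (0≤+ (0≤+ (0≤* (ℚₚ.nonNegative⁻¹ c₁₄) (0≤+ (0≤+ 0≤n 0≤n) (ℚₚ.nonNegative⁻¹ (+ 4 / 1))))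
            (0≤* (0≤* (0≤+ 0≤1 0≤n) (0≤+ (0≤* 0≤n 0≤n) (ℚₚ.nonNegative⁻¹ c₂))) (p≤q⇒0≤q-p h₁)))
       (0≤* (0≤* 0≤n (0≤+ 0≤1 0≤n)) (p≤q⇒0≤q-p h₂)))
  (solve 3 (λ n S w →
    n :* (n :* (n :* ((con 1ℚ :+ n) :* (S :+ w)))) :+
    (con c₁₄ :* (n :+ n :+ con (+ 4 / 1)) :+
     (con 1ℚ :+ n) :* (n :* n :+ con c₂) :* (con c₁₄ :* (n :- con c₂) :- n :* S) :+
     n :* (con 1ℚ :+ n) :* (S :+ S :- n :* n :* w))
    := n :* (n :* (n :* (con c₁₄ :* (con 1ℚ :+ n :- con c₂))))) refl (ι (suc m)) S w))))
  where 0≤n = 0≤ι (suc m)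

-- Stated for an abstract sequence since W 2 1 and W 2 2 would be evaluated otherwise.
module Growth (w S : ℕ → ℚ) (S-0 : S 0 ≡ 0ℚ) (S-suc : ∀ n → S (suc n) ≡ S n + w n) (w-0 : w 0 ≡ 1ℚ)
              (n²w≤2S : ∀ n → ι n * ι n * w n ℚ.≤ S n + S n) where

  S-1 : S 1 ≡ 1ℚ
  S-1 = trans (S-suc 0) (cong₂ ℚ._+_ S-0 w-0)

  w₁≤2 : w 1 ℚ.≤ c₂
  w₁≤2 = begin
    w 1              ≡⟨ solve 1 (λ x → x := con 1ℚ :* con 1ℚ :* x) refl (w 1) ⟩
    1ℚ * 1ℚ * w 1    ≡⟨ cong (λ x → x * x * w 1) ι-1 ⟨
    ι 1 * ι 1 * w 1  ≤⟨ n²w≤2S 1 ⟩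
    S 1 + S 1        ≡⟨ cong (λ x → x + x) S-1 ⟩
    c₂               ∎
    where open ℚₚ.≤-Reasoning

  4w₂≤2+2w₁ : (+ 4 / 1) * w 2 ℚ.≤ c₂ * (1ℚ + w 1)
  4w₂≤2+2w₁ = begin
    (+ 4 / 1) * w 2          ≡⟨ cong (λ x → x * x * w 2) (ι≡/ 2) ⟨
    ι 2 * ι 2 * w 2          ≤⟨ n²w≤2S 2 ⟩
    S 2 + S 2                ≡⟨ cong (λ x → x + x) (trans (S-suc 1) (+-congʳ (w 1) S-1)) ⟩
    1ℚ + w 1 + (1ℚ + w 1)    ≡⟨ solve 1 (λ x → x :+ x := con c₂ :* x) refl (1ℚ + w 1) ⟩
    c₂ * (1ℚ + w 1)          ∎
    where open ℚₚ.≤-Reasoning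

  -- From w 1 ≤ 2 and then w 2 ≤ 3/2 follows S 3 ≤ 9/2, and 27/2 ≤ 14. This fixes the constant 14.
  S-3≤ : (+ 3 / 1) * S 3 ℚ.≤ c₁₄
  S-3≤ = ≤-by
    (0≤+ (0≤+ (ℚₚ.nonNegative⁻¹ (+ 1 / 2)) (0≤* (ℚₚ.nonNegative⁻¹ (+ 9 / 2)) (p≤q⇒0≤q-p w₁≤2)))
         (0≤* (ℚₚ.nonNegative⁻¹ (+ 3 / 4)) (p≤q⇒0≤q-p 4w₂≤2+2w₁)))
    (trans (cong (λ x → (+ 3 / 1) * x + _) (trans (S-suc 2) (+-congʳ (w 2) (trans (S-suc 1) (+-congʳ (w 1) S-1)))))
    (solve 2 (λ w₁ w₂ →
      con (+ 3 / 1) :* (con 1ℚ :+ w₁ :+ w₂) :+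
      (con (+ 1 / 2) :+ con (+ 9 / 2) :* (con c₂ :- w₁) :+
       con (+ 3 / 4) :* (con c₂ :* (con 1ℚ :+ w₁) :- con (+ 4 / 1) :* w₂))
      := con c₁₄) refl (w 1) (w 2)))

  -- In the form S n ≤ 14 (1 - 2/n) this bounds S while leaving room for the growth factor 1 + 2/n².
  -- It starts at 3 because the right side is 0 at n = 2.
  invariant : ∀ m → ι (3 ℕ.+ m) * S (3 ℕ.+ m) ℚ.≤ c₁₄ * (ι (3 ℕ.+ m) - c₂)
  invariant zero    = subst (λ x → x * S 3 ℚ.≤ c₁₄ * (x - c₂)) (sym (ι≡/ 3)) S-3≤
  invariant (suc m) = subst (λ x → x ℚ.≤ c₁₄ * (ι (4 ℕ.+ m) - c₂)) (*-congˡ (ι (4 ℕ.+ m)) (sym (S-suc (3 ℕ.+ m))))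
    (subst (λ x → x * (S (3 ℕ.+ m) + w (3 ℕ.+ m)) ℚ.≤ c₁₄ * (x - c₂)) (sym (ι-suc (3 ℕ.+ m)))
      (invariant-step (2 ℕ.+ m) (invariant m) (n²w≤2S (3 ℕ.+ m))))

  S≤14 : ∀ n → S (3 ℕ.+ n) ℚ.≤ c₁₄
  S≤14 n = *-cancelˡ-≤-suc (2 ℕ.+ n) (ℚₚ.≤-trans (invariant n)
    (≤-by (ℚₚ.nonNegative⁻¹ (+ 28 / 1))
      (solve 1 (λ x → con c₁₄ :* (x :- con c₂) :+ con (+ 28 / 1) := x :* con c₁₄) refl (ι (3 ℕ.+ n)))))

partialSum₂≤14 : ∀ n → partialSum 2 n ℚ.≤ c₁₄
partialSum₂≤14 n = ℚₚ.≤-trans (partialSum-mono 1 3 n)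
  (Growth.S≤14 (W 2) (partialSum 2) refl (λ _ → refl) refl n²*W₂≤2S n)

n²*W₂≤28 : ∀ n → ι n * ι n * W 2 n ℚ.≤ + 28 / 1
n²*W₂≤28 n = ℚₚ.≤-trans (n²*W₂≤2S n) (ℚₚ.+-mono-≤ (partialSum₂≤14 n) (partialSum₂≤14 n))

recip-telescope : ∀ m → recip m ≡ recip (suc m) + recip m * recip (suc m)
recip-telescope m = *-cancelˡ-suc (suc m) (begin
  ι (2 ℕ.+ m) * x           ≡⟨ *-congʳ x (ι-suc (suc m)) ⟩
  (1ℚ + ι (suc m)) * x      ≡⟨ solve 2 (λ n x → (con 1ℚ :+ n) :* x := n :* x :+ x) refl (ι (suc m)) x ⟩
  ι (suc m) * x + x         ≡⟨ +-congʳ x (recip-inverse m) ⟩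
  1ℚ + x                    ≡⟨ solve 1 (λ x → con 1ℚ :+ x := con 1ℚ :* (con 1ℚ :+ x)) refl x ⟩
  1ℚ * (1ℚ + x)             ≡⟨ *-congʳ (1ℚ + x) (recip-inverse (suc m)) ⟨
  ι (2 ℕ.+ m) * y * (1ℚ + x) ≡⟨ solve 3 (λ n x y → n :* y :* (con 1ℚ :+ x) := n :* (y :+ x :* y)) refl (ι (2 ℕ.+ m)) x y ⟩
  ι (2 ℕ.+ m) * (y + x * y) ∎)
  where
  open ≡-Reasoning
  x = recip m
  y = recip (suc m)

private
  c₅₆ : ℚ
  c₅₆ = + 56 / 1

-- 28 / (m+1)² ≤ 56 / ((m+1)(m+2)), since m + 2 ≤ 2 (m + 1), and the right side is 56 times the
-- difference of consecutive reciprocals.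
W₂-telescope : ∀ m → W 2 (suc m) + c₅₆ * recip (suc m) ℚ.≤ c₅₆ * recip m
W₂-telescope m = begin
  w + c₅₆ * y                 ≤⟨ ℚₚ.+-monoˡ-≤ (c₅₆ * y) (≤-recip m (≤-recip (suc m) bound)) ⟩
  x * (y * c₅₆) + c₅₆ * y     ≡⟨ solve 3 (λ x y c → x :* (y :* c) :+ c :* y := c :* (y :+ x :* y)) refl x y c₅₆ ⟩
  c₅₆ * (y + x * y)           ≡⟨ *-congˡ c₅₆ (recip-telescope m) ⟨
  c₅₆ * x                     ∎
  where
  open ℚₚ.≤-Reasoning
  w = W 2 (suc m)
  x = recip m
  y = recip (suc m)
  a = ι (suc m)
  bound : ι (2 ℕ.+ m) * (a * w) ℚ.≤ c₅₆
  bound = begin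
    ι (2 ℕ.+ m) * (a * w)   ≡⟨ *-congʳ (a * w) (ι-suc (suc m)) ⟩
    (1ℚ + a) * (a * w)      ≤⟨ *-monoˡ (0≤* (0≤ι (suc m)) (0≤W 1 (suc m))) (ℚₚ.+-monoˡ-≤ a (subst (ℚ._≤ a) ι-1 (ι-mono (ℕ.s≤s (ℕ.z≤n {m}))))) ⟩
    (a + a) * (a * w)       ≡⟨ solve 2 (λ n w → (n :+ n) :* (n :* w) := n :* n :* w :+ n :* n :* w) refl a w ⟩
    a * a * w + a * a * w   ≤⟨ ℚₚ.+-mono-≤ (n²*W₂≤28 (suc m)) (n²*W₂≤28 (suc m)) ⟩
    c₅₆                     ∎

W≤W₂ : ∀ r n → W (suc (suc r)) n ℚ.≤ W 2 n
W≤W₂ r n = begin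
  W (suc (suc r)) n                                           ≡⟨ W≡∑ (suc r) n n ℕₚ.≤-refl ⟩
  ∑ (partitions n n) (λ u → prob 0 u ^ℚ suc (suc r))          ≤⟨ ∑-mono (partitions n n) (λ u → *-monoʳ (0≤prob 0 u) (*-monoʳ (0≤prob 0 u)
                                                                   (subst (prob 0 u ^ℚ r ℚ.≤_) (1^ r) (^-mono r (0≤prob 0 u) (prob≤1 0 u))))) ⟩
  ∑ (partitions n n) (λ u → prob 0 u ^ℚ 2)                    ≡⟨ W≡∑ 1 n n ℕₚ.≤-refl ⟨
  W 2 n                                                       ∎
  where open ℚₚ.≤-Reasoning

-- By `W≤W₂` and the telescoping bound, the sum of the first n terms plus 56 / n does not increase
-- for n ≥ 1.
partialSum-tail : ∀ r j m → partialSum (suc (suc r)) (j ℕ.+ suc m) + c₅₆ * recip (j ℕ.+ m) ℚ.≤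
                            partialSum (suc (suc r)) (suc m) + c₅₆ * recip m
partialSum-tail r zero    m = ℚₚ.≤-refl
partialSum-tail r (suc j) m = begin
  S + W s (j ℕ.+ suc m) + c₅₆ * recip (suc (j ℕ.+ m))       ≡⟨ ℚₚ.+-assoc S (W s (j ℕ.+ suc m)) (c₅₆ * recip (suc (j ℕ.+ m))) ⟩
  S + (W s (j ℕ.+ suc m) + c₅₆ * recip (suc (j ℕ.+ m)))     ≤⟨ ℚₚ.+-monoʳ-≤ S (ℚₚ.+-monoˡ-≤ (c₅₆ * recip (suc (j ℕ.+ m))) (W≤W₂ r (j ℕ.+ suc m))) ⟩
  S + (W 2 (j ℕ.+ suc m) + c₅₆ * recip (suc (j ℕ.+ m)))     ≡⟨ cong (λ e → S + (W 2 e + c₅₆ * recip (suc (j ℕ.+ m)))) (ℕₚ.+-suc j m) ⟩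
  S + (W 2 (suc (j ℕ.+ m)) + c₅₆ * recip (suc (j ℕ.+ m)))   ≤⟨ ℚₚ.+-monoʳ-≤ S (W₂-telescope (j ℕ.+ m)) ⟩
  S + c₅₆ * recip (j ℕ.+ m)                                 ≤⟨ partialSum-tail r j m ⟩
  partialSum s (suc m) + c₅₆ * recip m                      ∎
  where
  open ℚₚ.≤-Reasoning
  s = suc (suc r)
  S = partialSum s (j ℕ.+ suc m)

partialSum-cauchy : ∀ r {k n₁ n₂} → suc k ≤ n₁ → n₁ ≤ n₂ →
                    partialSum (suc (suc r)) n₂ ℚ.≤ partialSum (suc (suc r)) n₁ + c₅₆ * recip k
partialSum-cauchy r {k} {suc m} {n₂} (ℕ.s≤s k≤m) n₁≤n₂ = begin
  partialSum s n₂                                          ≡⟨ cong (partialSum s) (ℕₚ.m∸n+n≡m n₁≤n₂) ⟨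
  partialSum s (j ℕ.+ suc m)                               ≤⟨ p≤p+q (0≤* (ℚₚ.nonNegative⁻¹ c₅₆) (0≤recip (j ℕ.+ m))) ⟩
  partialSum s (j ℕ.+ suc m) + c₅₆ * recip (j ℕ.+ m)       ≤⟨ partialSum-tail r j m ⟩
  partialSum s (suc m) + c₅₆ * recip m                     ≤⟨ ℚₚ.+-monoʳ-≤ (partialSum s (suc m)) (*-monoʳ (ℚₚ.nonNegative⁻¹ c₅₆) (recip-antimono k≤m)) ⟩
  partialSum s (suc m) + c₅₆ * recip k                     ∎
  where
  open ℚₚ.≤-Reasoning
  s = suc (suc r)
  j = n₂ ℕ.∸ suc m

-- Vanishing of the cross terms and the limit

⊛-split : ∀ s {f δ} → (∀ i → f i ℚ.≤ 1ℚ) → (∀ i → s ≤ i → f i ℚ.≤ δ) → ∀ n →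
          (f ⊛ W 2) (s ℕ.+ n) + partialSum 2 n ℚ.≤ partialSum 2 (s ℕ.+ n) + δ * partialSum 2 n
⊛-split zero {f} {δ} f≤1 f≤δ n = begin
  (f ⊛ W 2) n + S                    ≤⟨ ℚₚ.+-monoˡ-≤ S (⊛-monoˡ {g = λ _ → δ * 1ℚ} (λ i → subst (f i ℚ.≤_) (sym (ℚₚ.*-identityʳ δ)) (f≤δ i ℕ.z≤n)) (0≤W 1) n) ⟩
  ((λ _ → δ * 1ℚ) ⊛ W 2) n + S       ≡⟨ +-congʳ S (trans (⊛-*ˡ δ (λ _ → 1ℚ) (W 2) n) (*-congˡ δ (sym (partialSum≡⊛ 2 n)))) ⟩
  δ * S + S                          ≡⟨ ℚₚ.+-comm (δ * S) S ⟩
  S + δ * S                          ∎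
  where open ℚₚ.≤-Reasoning
        S = partialSum 2 n
⊛-split (suc s) {f} {δ} f≤1 f≤δ n = begin
  -- The first values of f are bounded by 1 and meet `W 2` only at indices from n on; these terms
  -- make up the difference of the two partial sums.
  f 0 * w + x + S                    ≤⟨ ℚₚ.+-monoˡ-≤ S (ℚₚ.+-monoˡ-≤ x (*-monoˡ (0≤W 1 (s ℕ.+ n)) (f≤1 0))) ⟩
  1ℚ * w + x + S                     ≡⟨ solve 3 (λ w x S → con 1ℚ :* w :+ x :+ S := w :+ (x :+ S)) refl w x S ⟩
  w + (x + S)                        ≤⟨ ℚₚ.+-monoʳ-≤ w (⊛-split s (f≤1 ∘ suc) (λ i s≤i → f≤δ (suc i) (ℕ.s≤s s≤i)) n) ⟩
  w + (T + δ * S)                    ≡⟨ solve 3 (λ w T y → w :+ (T :+ y) := (T :+ w) :+ y) refl w T (δ * S) ⟩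
  T + w + δ * S                      ∎
  where
  open ℚₚ.≤-Reasoning
  S = partialSum 2 n
  T = partialSum 2 (s ℕ.+ n)
  w = W 2 (s ℕ.+ n)
  x = ((f ∘ suc) ⊛ W 2) (s ℕ.+ n)

-- K² + K with K = k + 1: past the first K² terms `recip²` is at most 4 / K, and the at least K
-- remaining indices make the tail of Σ W_2 beyond them at most 56 / K.
threshold : ℕ → ℕ
threshold k = suc k ℕ.* suc k ℕ.+ suc k

-- 112 = 4 · 14 + 56: small values of `recip²` times the whole sum of W_2, plus the tail of that
-- sum.
Σ-deficiency-small : ∀ k n → threshold k ≤ n → Σ-deficiency n ℚ.≤ ι 112 * recip k
Σ-deficiency-small k n t≤n = subst (λ e → Σ-deficiency e ℚ.≤ ι 112 * δ) (ℕₚ.m+[n∸m]≡n K²≤n)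
  (ℚₚ.≤-trans (Σ-deficiency≤ (s ℕ.+ n′)) (≤-by (0≤+ (0≤+ (p≤q⇒0≤q-p split) (p≤q⇒0≤q-p tail))
      (0≤* (0≤* (0≤ι 4) (0≤recip k)) (p≤q⇒0≤q-p (partialSum₂≤14 n′))))
    (begin
      x + (T + ι 4 * δ * S - (x + S) + (S + c₅₆ * δ - T) + ι 4 * δ * (c₁₄ - S))
        ≡⟨ solve 6 (λ x T S f d c → x :+ (T :+ f :* d :* S :- (x :+ S) :+ (S :+ c :* d :- T) :+ f :* d :* (con c₁₄ :- S))
             := (c :+ f :* con c₁₄) :* d) refl x T S (ι 4) δ c₅₆ ⟩
      (c₅₆ + ι 4 * c₁₄) * δ
        ≡⟨ *-congʳ δ (trans (cong (λ e → c₅₆ + e * c₁₄) (ι≡/ 4)) (sym (ι≡/ 112))) ⟩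
      ι 112 * δ ∎)))
  where
  open ≡-Reasoning
  s = suc k ℕ.* suc k
  n′ = n ℕ.∸ s
  δ = recip k
  K²≤n = ℕₚ.m+n≤o⇒m≤o s t≤n
  K≤n′ : suc k ≤ n′
  K≤n′ = subst (_≤ n′) (ℕₚ.m+n∸m≡n s (suc k)) (ℕₚ.∸-monoˡ-≤ s t≤n)
  x = (recip² ⊛ W 2) (s ℕ.+ n′)
  S = partialSum 2 n′
  T = partialSum 2 (s ℕ.+ n′)
  split : x + S ℚ.≤ T + ι 4 * δ * S
  split = ⊛-split s recip²≤1 (recip²-small k) n′
  tail : T ℚ.≤ S + c₅₆ * δ
  tail = partialSum-cauchy 0 K≤n′ (ℕₚ.m≤n+m n′ s)

p≤1+p² : ∀ {p} → 0ℚ ℚ.≤ p → p ℚ.≤ 1ℚ + p * p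
p≤1+p² {p} 0≤p with ℚₚ.≤-total p 1ℚ
... | inj₁ p≤1 = ℚₚ.≤-trans p≤1 (p≤p+q (0≤* 0≤p 0≤p))
... | inj₂ 1≤p = ℚₚ.≤-trans (subst (ℚ._≤ p * p) (ℚₚ.*-identityʳ p) (*-monoʳ 0≤p 1≤p))
  (≤-by 0≤1 (ℚₚ.+-comm (p * p) 1ℚ))

-- (n p(v))² is a single term of n² W_2(n) ≤ 28, and x ≤ 1 + x² replaces taking a square root.
∑-biased≤29 : ∀ n {v} → v ∈ partitions n n → ∑ (allFin n) (λ k → biased k v) ℚ.≤ ι 29
∑-biased≤29 n {v} v∈ = begin
  ∑ (allFin n) (λ k → biased k v)            ≡⟨ ∑-biased≡ v∈ ⟩
  ι n * p                                    ≤⟨ p≤1+p² (0≤* (0≤ι n) (0≤prob 0 v)) ⟩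
  1ℚ + ι n * p * (ι n * p)                   ≡⟨ +-congˡ 1ℚ (solve 2 (λ n p → n :* p :* (n :* p) := n :* n :* (p :* p)) refl (ι n) p) ⟩
  1ℚ + ι n * ι n * (p * p)                   ≤⟨ ℚₚ.+-monoʳ-≤ 1ℚ (*-monoʳ (0≤* (0≤ι n) (0≤ι n)) p²≤W) ⟩
  1ℚ + ι n * ι n * W 2 n                     ≤⟨ ℚₚ.+-monoʳ-≤ 1ℚ (n²*W₂≤28 n) ⟩
  1ℚ + (+ 28 / 1)                            ≡⟨ ι≡/ 29 ⟨
  ι 29                                       ∎
  where
  open ℚₚ.≤-Reasoning
  p = prob 0 v
  p²≤W : p * p ℚ.≤ W 2 n
  p²≤W = subst (p * p ℚ.≤_) (sym (W2≡∑ n n ℕₚ.≤-refl))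
    (term≤∑ (λ u → prob 0 u * prob 0 u) (λ u → 0≤* (0≤prob 0 u) (0≤prob 0 u)) v∈)

0<ε⇒recip≤ε : ∀ ε → ℚ.Positive ε → recip (ℚ.denominator-1 ε) ℚ.≤ ε
0<ε⇒recip≤ε ε@(ℚ.mkℚ (+ suc a) d _) _ = *-cancelˡ-≤-suc d (begin
  ι (suc d) * recip d         ≡⟨ recip-inverse d ⟩
  1ℚ                          ≡⟨ ι-1 ⟨
  ι 1                         ≤⟨ ι-mono (ℕ.s≤s ℕ.z≤n) ⟩
  ι (suc a)                   ≡⟨ ι-*-/ (suc a) (suc d) ⟨
  ι (suc d) * (+ suc a / suc d) ≡⟨ *-congˡ (ι (suc d)) (ℚₚ.↥p/↧p≡p ε) ⟩
  ι (suc d) * ε               ∎)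
  where open ℚₚ.≤-Reasoning

archimedean : ∀ x ε → ℚ.Positive ε → ∃[ k ] ι x * recip k < ε
archimedean x ε 0<ε = k , ℚₚ.<-≤-trans (ℚₚ.*-cancelˡ-<-nonNeg (ι (suc k)) {{ℚ.nonNegative (0≤ι (suc k))}} lt) (0<ε⇒recip≤ε ε 0<ε)
  where
  open ℚₚ.≤-Reasoning
  d = ℚ.denominator-1 ε
  -- With D the denominator of ε and k = x D, x / (k + 1) < 1 / D ≤ ε.
  k = x ℕ.* suc d
  lt : ι (suc k) * (ι x * recip k) < ι (suc k) * recip d
  lt = begin-strict
    ι (suc k) * (ι x * recip k)          ≡⟨ solve 3 (λ a b c → a :* (b :* c) := b :* (a :* c)) refl (ι (suc k)) (ι x) (recip k) ⟩
    ι x * (ι (suc k) * recip k)          ≡⟨ *-congˡ (ι x) (recip-inverse k) ⟩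
    ι x * 1ℚ                             ≡⟨ *-congˡ (ι x) (recip-inverse d) ⟨
    ι x * (ι (suc d) * recip d)          ≡⟨ ℚₚ.*-assoc (ι x) (ι (suc d)) (recip d) ⟨
    ι x * ι (suc d) * recip d            ≡⟨ *-congʳ (recip d) (ι-* x (suc d)) ⟨
    ι k * recip d                        <⟨ ℚₚ.*-monoˡ-<-pos (recip d) {{ℚ.positive 0<recip}} k<suc-k ⟩
    ι (suc k) * recip d                  ∎
    where
    0<1 = ℚₚ.positive⁻¹ 1ℚ
    k<suc-k : ι k < ι (suc k)
    k<suc-k = subst (ι k <_) (sym (ι-suc k)) (subst (_< 1ℚ + ι k) (ℚₚ.+-identityˡ (ι k)) (ℚₚ.+-monoˡ-< (ι k) 0<1))
    0<recip : 0ℚ < recip d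
    0<recip = ℚₚ.*-cancelˡ-<-nonNeg (ι (suc d)) {{ℚ.nonNegative (0≤ι (suc d))}}
      (subst (_< ι (suc d) * recip d) (sym (ℚₚ.*-zeroʳ (ι (suc d)))) (subst (0ℚ <_) (sym (recip-inverse d)) 0<1))

∣p-q∣≤ : ∀ {p q b} → p ℚ.≤ q + b → q ℚ.≤ p + b → ∣ p - q ∣ ℚ.≤ b
∣p-q∣≤ {p} {q} {b} p≤ q≤ with ℚₚ.∣p∣≡p∨∣p∣≡-p (p - q)
... | inj₁ eq = subst (ℚ._≤ b) (sym eq) (≤-by (p≤q⇒0≤q-p p≤) (solve 3 (λ p q b → p :- q :+ (q :+ b :- p) := b) refl p q b))
... | inj₂ eq = subst (ℚ._≤ b) (sym eq) (≤-by (p≤q⇒0≤q-p q≤) (solve 3 (λ p q b → (:- (p :- q)) :+ (p :+ b :- q) := b) refl p q b))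

-- The summand 56 pays for replacing n by M in the partial sum, in both directions; the multiple of
-- 112 pays for the cross terms, which occur only in the upper estimate.
conclusion : ∀ r k n M → threshold k ≤ n → threshold k ≤ M →
  ∣ ι (n ^ suc (suc r)) * W (suc (suc r)) n - partialSum (suc (suc r)) M ∣ ℚ.≤
  ι (slack 29 r ℕ.* 112 ℕ.+ 56) * recip k
conclusion r k n M t≤n t≤M = ∣p-q∣≤ upper lower
  where
  open ℚₚ.≤-Reasoning
  s = suc (suc r)
  δ = recip k
  κ = ι (slack 29 r)
  bound = ι (slack 29 r ℕ.* 112 ℕ.+ 56) * δ
  K≤t = ℕₚ.m≤n+m (suc k) (suc k ℕ.* suc k)
  cauchy : ∀ n₁ n₂ → threshold k ≤ n₁ → partialSum s n₂ ℚ.≤ partialSum s n₁ + c₅₆ * δ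
  cauchy n₁ n₂ t≤n₁ with ℕₚ.≤-total n₁ n₂
  ... | inj₁ n₁≤n₂ = partialSum-cauchy r (ℕₚ.≤-trans K≤t t≤n₁) n₁≤n₂
  ... | inj₂ n₂≤n₁ = ℚₚ.≤-trans
    (subst (λ e → partialSum s n₂ ℚ.≤ partialSum s e) (ℕₚ.m∸n+n≡m n₂≤n₁) (partialSum-mono (suc r) (n₁ ℕ.∸ n₂) n₂))
    (p≤p+q (0≤* (ℚₚ.nonNegative⁻¹ c₅₆) (0≤recip k)))
  bound≡ : c₅₆ * δ + κ * (ι 112 * δ) ≡ bound
  bound≡ = trans (solve 4 (λ c κ e d → c :* d :+ κ :* (e :* d) := (κ :* e :+ c) :* d) refl c₅₆ κ (ι 112) δ)
    (*-congʳ δ (sym (trans (ι-+ (slack 29 r ℕ.* 112) 56) (cong₂ ℚ._+_ (ι-* (slack 29 r) 112) (ι≡/ 56)))))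
  upper : ι (n ^ s) * W s n ℚ.≤ partialSum s M + bound
  upper = begin
    ι (n ^ s) * W s n                              ≤⟨ n^r*W≤ r n 29 (∑-biased≤29 n) ⟩
    partialSum s n + κ * Σ-deficiency n            ≤⟨ ℚₚ.+-mono-≤ (cauchy M n t≤M) (*-monoʳ (0≤ι (slack 29 r)) (Σ-deficiency-small k n t≤n)) ⟩
    partialSum s M + c₅₆ * δ + κ * (ι 112 * δ)     ≡⟨ ℚₚ.+-assoc (partialSum s M) (c₅₆ * δ) (κ * (ι 112 * δ)) ⟩
    partialSum s M + (c₅₆ * δ + κ * (ι 112 * δ))   ≡⟨ +-congˡ (partialSum s M) bound≡ ⟩
    partialSum s M + bound                         ∎
  lower : partialSum s M ℚ.≤ ι (n ^ s) * W s n + bound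
  lower = begin
    partialSum s M                    ≤⟨ cauchy n M t≤n ⟩
    partialSum s n + c₅₆ * δ          ≤⟨ ℚₚ.+-mono-≤ (partialSum≤n^r*W (suc r) n)
                                           (ℚₚ.≤-trans (p≤p+q (0≤* (0≤ι (slack 29 r)) (0≤* (0≤ι 112) (0≤recip k)))) (ℚₚ.≤-reflexive bound≡)) ⟩
    ι (n ^ s) * W s n + bound         ∎

-- Closeness to all late partial sums expresses convergence without naming the real number A_r: it
-- forces the partial sums to be Cauchy and n^r W_r(n) to have the same limit. That limit is at
-- least W_r(0) = 1, hence nonzero, so convergence amounts to the asymptotic equivalence.
theoremA1 : (r : ℕ) → 2 ≤ r → (ε : ℚ) → Positive ε →
    ∃[ N ] ((n M : ℕ) → N ≤ n → N ≤ M →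
    ∣ ((+ (n ^ r)) / 1) * W r n - partialSum r M ∣ < ε)
theoremA1 (suc (suc r)) (ℕ.s≤s (ℕ.s≤s ℕ.z≤n)) ε 0<ε = threshold k , λ n M t≤n t≤M → ℚₚ.≤-<-trans
  (subst (λ x → ∣ x * W (suc (suc r)) n - partialSum (suc (suc r)) M ∣ ℚ.≤ ι (slack 29 r ℕ.* 112 ℕ.+ 56) * recip k)
    (ι≡/ (n ^ suc (suc r))) (conclusion r k n M t≤n t≤M))
  (proj₂ small)
  where
  small = archimedean (slack 29 r ℕ.* 112 ℕ.+ 56) ε 0<ε
  k = proj₁ small
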